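{- Let $A$ and $B$ be finite sets with $|A|,|B|\ge 2$ and $A\cap B=\{e\}$, and let $E=A\cup B$. Let $C_{A,B}$ be the graphic matroid on $E$ of the graph obtained by gluing a cycle with edge set $A$ and a cycle with edge set $B$ along the common edge $e$. Let $\mathfrak{S}_{A\smallsetminus e}\times\mathfrak{S}_{B\smallsetminus e}$ act on $C_{A,B}$ by permuting $A\smallsetminus\{e\}$ and $B\smallsetminus\{e\}$ and fixing $e$. Then $$P_{C_{A,B}}^{\mathfrak{S}_{A\smallsetminus e}\times\mathfrak{S}_{B\smallsetminus e}}(x)=P_{C_{E\smallsetminus e}}^{\mathfrak{S}_{A\smallsetminus e}\times\mathfrak{S}_{B\smallsetminus e}}(x)-x\,P_{C_{A\smallsetminus e}}^{\mathfrak{S}_{A\smallsetminus e}}(x)\otimes P_{C_{B\smallsetminus e}}^{\mathfrak{S}_{B\smallsetminus e}}(x).$$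
   Context: For a finite nonempty set $S$, $C_S$ is the graphic matroid of a cycle with edge set $S$, i.e. the uniform matroid $U_{|S|-1,S}$ of rank $|S|-1$ on $S$ (a single loop when $|S|=1$), and $\mathfrak{S}_S$ is the symmetric group on $S$. The matroid $C_{A,B}$ has circuits $A$, $B$ and $(A\cup B)\smallsetminus\{e\}$. The symbol $\otimes$ denotes the external tensor product of a graded $\mathfrak{S}_{A\smallsetminus e}$-representation and a graded $\mathfrak{S}_{B\smallsetminus e}$-representation, which is a graded representation of the product group. $\mathrm{VRep}(W)$ is the Grothendieck ring (with respect to direct sums) of finite-dimensional representations of $W$ over $\mathbb{Q}$, and $\mathrm{grVRep}(W)=\mathrm{VRep}(W)[x]$. $\mathbf{1}_W$ is the trivial representation, and $\mathcal{L}(M)$ the lattice of flats of $M$. Equivariant Kazhdan–Lusztig and $Z$-polynomials: there is a unique way to associate to every loopless matroid $M$ and every group action of $W$ on $M$ (an action on the ground set preserving the bases) elements $P_M^W(x),Z_M^W(x)\in\mathrm{grVRep}(W)$ such that: (i) if $\mathrm{rk}(M)=0$ then $P_M^W(x)=Z_M^W(x)=\mathbf{1}_W$; (ii) if $\mathrm{rk}(M)>0$ then $\deg P_M^W(x)<\frac12\mathrm{rk}(M)$; (iii) for every $M$, $$Z_M^W(x)=\sum_{[F]\in\mathcal{L}(M)/W}x^{\mathrm{rk}(F)}\,\mathrm{Ind}_{W_F}^W P_{M/F}^{W_F}(x)$$ is palindromic of degree $\mathrm{rk}(M)$ (the coefficients of $x^j$ and $x^{\mathrm{rk}(M)-j}$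 agree), where $W_F$ is the stabilizer of $F$. If a matroid $M$ has loops, set $P_M^W(x)=0$. -}

module Defs where

open import Level using (0ℓ)
open import Algebra.Bundles using (Group; CommutativeRing)
import Algebra.Construct.DirectProduct as DirectProduct
import Algebra.Properties.Group as GroupProperties
import Algebra.Properties.Semiring.Sum as SemiringSum
open import Data.Bool.Base using (if_then_else_)
import Data.Bool.Properties as Bool
open import Data.Fin.Base using (Fin; zero; suc; splitAt; join; _↑ˡ_; _↑ʳ_; combine; remQuot)
import Data.Fin.Properties as Fin
open import Data.Fin.Permutation as Perm using (Permutation′; permutation; _⟨$⟩ʳ_; _⟨$⟩ˡ_)
open import Data.Fin.Subset
open import Data.Fin.Subset.Properties
open import Data.List.Base as List
  using (List; []; _∷_; _++_; allFin; cartesianProduct; cartesianProductWith; deduplicate; filter; foldr; length)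
open import Data.List.Extrema.Nat using (max)
open import Data.List.Membership.Propositional as MembershipP using () renaming (_∈_ to _∈ₗ_)
import Data.List.Membership.Propositional.Properties as Membershipₚ
open import Data.List.Relation.Unary.All as All using (All; []; _∷_)
import Data.List.Relation.Unary.All.Properties as Allₚ
open import Data.List.Relation.Unary.AllPairs using (_∷_)
open import Data.List.Relation.Unary.Any as Any using (here; there)
import Data.List.Relation.Unary.Any.Properties as Anyₚ
open import Data.List.Relation.Unary.Enumerates.Setoid using (IsEnumeration)
import Data.List.Relation.Unary.Enumerates.Setoid.Properties as Enumerates
import Data.List.Relation.Unary.Unique.Setoid as UniqueS
import Data.List.Relation.Unary.Unique.DecSetoid.Properties as UniqueDS
open import Data.Nat.Base as ℕ using (ℕ; zero; suc; z≤n; s≤s; _∸_; _≤_; _<_)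
import Data.Nat.Properties as ℕ
open import Data.Product.Base using (Σ; ∃; _×_; _,_; proj₁; proj₂)
open import Data.Product.Relation.Binary.Pointwise.NonDependent using (×-decidable)
open import Data.Rational.Base as ℚ using (ℚ; 0ℚ; 1ℚ)
open import Data.Rational.Properties using (+-*-commutativeRing)
open import Data.Sum.Base using (_⊎_; inj₁; inj₂; [_,_]′)
open import Data.Vec.Base as Vec using (Vec; []; _∷_; lookup; tabulate)
import Data.Vec.Properties as Vec
open import Function.Base using (_∘_)
open import Relation.Binary.Bundles using (Setoid; DecSetoid)
open import Relation.Binary.Definitions using () renaming (Decidable to Decidable₂)
open import Relation.Binary.PropositionalEquality
  using (_≡_; _≢_; refl; sym; trans; cong; cong₂; subst; module ≡-Reasoning)
open import Relation.Nullary using (¬_; Dec; yes; no; does; contradiction)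
open import Relation.Nullary.Decidable using (map′; _×-dec_; _→-dec_; ¬?; dec-true; dec-false; dec-yes; decidable-stable)
open import Relation.Unary using (Pred; Decidable)

private
  variable
    m n k l : ℕ

module ℚR = CommutativeRing +-*-commutativeRing
module Σℚ = SemiringSum ℚR.semiring

Matrix : ℕ → ℕ → Set
Matrix m n = Fin m → Fin n → ℚ

infix 4 _≋_
_≋_ : Matrix m n → Matrix m n → Set
A ≋ B = ∀ i j → A i j ≡ B i j

infixl 7 _⊠_
_⊠_ : Matrix m n → Matrix n k → Matrix m k
(A ⊠ B) i j = Σℚ.sum (λ l → A i l ℚ.* B l j)

δ : Fin n → Fin n → ℚ
δ i j = if does (i Fin.≟ j) then 1ℚ else 0ℚ

𝟙 : ∀ n → Matrix n n
𝟙 n = δ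

𝟘 : ∀ m n → Matrix m n
𝟘 m n _ _ = 0ℚ

blocks : Matrix m n → Matrix k l → Fin m ⊎ Fin k → Fin n ⊎ Fin l → ℚ
blocks A B (inj₁ a) (inj₁ b) = A a b
blocks A B (inj₂ a) (inj₂ b) = B a b
blocks A B _        _        = 0ℚ

infixr 6 _⊕ᴹ_
_⊕ᴹ_ : Matrix m n → Matrix k l → Matrix (m ℕ.+ k) (n ℕ.+ l)
_⊕ᴹ_ {m} {n} A B i j = blocks A B (splitAt m i) (splitAt n j)

infixr 7 _⊗ᴹ_
_⊗ᴹ_ : Matrix m n → Matrix k l → Matrix (m ℕ.* k) (n ℕ.* l)
_⊗ᴹ_ {m} {n} {k} {l} A B i j =
  A (proj₁ (remQuot {m} k i)) (proj₁ (remQuot {n} l j)) ℚ.*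
  B (proj₂ (remQuot {m} k i)) (proj₂ (remQuot {n} l j))

≋-refl : {A : Matrix m n} → A ≋ A
≋-refl i j = refl

≋-sym : {A B : Matrix m n} → A ≋ B → B ≋ A
≋-sym p i j = sym (p i j)

≋-trans : {A B C : Matrix m n} → A ≋ B → B ≋ C → A ≋ C
≋-trans p q i j = trans (p i j) (q i j)

⊠-cong : {A A′ : Matrix m n} {B B′ : Matrix n k} → A ≋ A′ → B ≋ B′ → A ⊠ B ≋ A′ ⊠ B′
⊠-cong p q i j = Σℚ.sum-cong-≗ (λ l → cong₂ ℚ._*_ (p i l) (q l j))

δ-refl : (i : Fin n) → δ i i ≡ 1ℚ
δ-refl i rewrite dec-true (i Fin.≟ i) refl = refl

δ-≢ : {i j : Fin n} → i ≢ j → δ i j ≡ 0ℚ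
δ-≢ {i = i} {j} i≢j rewrite dec-false (i Fin.≟ j) i≢j = refl

sum-zero : (f : Fin n → ℚ) → (∀ i → f i ≡ 0ℚ) → Σℚ.sum f ≡ 0ℚ
sum-zero {n} f p = trans (Σℚ.sum-cong-≗ p) (Σℚ.sum-replicate-zero n)

sum-single : (f : Fin n → ℚ) (i : Fin n) → (∀ j → j ≢ i → f j ≡ 0ℚ) → Σℚ.sum f ≡ f i
sum-single f zero    p =
  trans (cong (f zero ℚ.+_) (sum-zero (f ∘ suc) (λ j → p (suc j) (λ ())))) (ℚR.+-identityʳ _)
sum-single f (suc i) p =
  trans (cong₂ ℚ._+_ (p zero (λ ())) (sum-single (f ∘ suc) i (λ j j≢i → p (suc j) (j≢i ∘ Fin.suc-injective))))
        (ℚR.+-identityˡ _)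

⊠-identityˡ : (A : Matrix m n) → 𝟙 m ⊠ A ≋ A
⊠-identityˡ A i j = trans
  (sum-single _ i (λ l l≢i → trans (cong (ℚ._* A l j) (δ-≢ (l≢i ∘ sym))) (ℚR.zeroˡ (A l j))))
  (trans (cong (ℚ._* A i j) (δ-refl i)) (ℚR.*-identityˡ (A i j)))

sum-+ : ∀ m {k} (f : Fin (m ℕ.+ k) → ℚ) →
        Σℚ.sum f ≡ Σℚ.sum (λ i → f (i ↑ˡ k)) ℚ.+ Σℚ.sum (λ i → f (m ↑ʳ i))
sum-+ zero    f = sym (ℚR.+-identityˡ _)
sum-+ (suc m) {k} f = trans (cong (f zero ℚ.+_) (sum-+ m (f ∘ suc)))
  (sym (ℚR.+-assoc (f zero) (Σℚ.sum (λ i → f (suc (i ↑ˡ k)))) (Σℚ.sum (λ i → f (suc (m ↑ʳ i))))))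

sum-* : ∀ m {k} (f : Fin (m ℕ.* k) → ℚ) →
        Σℚ.sum f ≡ Σℚ.sum (λ i → Σℚ.sum (λ j → f (combine {m} {k} i j)))
sum-* zero        f = refl
sum-* (suc m) {k} f = trans (sum-+ k f)
  (cong (Σℚ.sum (λ j → f (j ↑ˡ (m ℕ.* k))) ℚ.+_) (sum-* m (λ i → f (k ↑ʳ i))))

blocks-cong : {A A′ : Matrix m n} {B B′ : Matrix k l} → A ≋ A′ → B ≋ B′ →
              ∀ x y → blocks A B x y ≡ blocks A′ B′ x y
blocks-cong p q (inj₁ a) (inj₁ b) = p a b
blocks-cong p q (inj₁ a) (inj₂ b) = refl
blocks-cong p q (inj₂ a) (inj₁ b) = refl
blocks-cong p q (inj₂ a) (inj₂ b) = q a b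

⊕ᴹ-cong : {A A′ : Matrix m n} {B B′ : Matrix k l} → A ≋ A′ → B ≋ B′ → A ⊕ᴹ B ≋ A′ ⊕ᴹ B′
⊕ᴹ-cong {m} {n} {A = A} {A′} {B} {B′} p q i j =
  blocks-cong {A = A} {A′} {B} {B′} p q (splitAt m i) (splitAt n j)

⊕ᴹ-𝟙 : ∀ m k → 𝟙 m ⊕ᴹ 𝟙 k ≋ 𝟙 (m ℕ.+ k)
⊕ᴹ-𝟙 m k i j = aux (i Fin.≟ j)
  where
  diag : ∀ x → blocks (𝟙 m) (𝟙 k) x x ≡ 1ℚ
  diag (inj₁ a) = δ-refl a
  diag (inj₂ b) = δ-refl b
  off : ∀ x y → x ≢ y → blocks (𝟙 m) (𝟙 k) x y ≡ 0ℚ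
  off (inj₁ a) (inj₁ b) x≢y = δ-≢ (x≢y ∘ cong inj₁)
  off (inj₁ a) (inj₂ b) x≢y = refl
  off (inj₂ a) (inj₁ b) x≢y = refl
  off (inj₂ a) (inj₂ b) x≢y = δ-≢ (x≢y ∘ cong inj₂)
  aux : Dec (i ≡ j) → (𝟙 m ⊕ᴹ 𝟙 k) i j ≡ δ i j
  aux (yes refl) = trans (diag (splitAt m i)) (sym (δ-refl i))
  aux (no i≢j)   = trans (off (splitAt m i) (splitAt m j) (λ p → i≢j
    (trans (sym (Fin.join-splitAt m k i)) (trans (cong (join m k) p) (Fin.join-splitAt m k j)))))
    (sym (δ-≢ i≢j))

blocks-⊠ : ∀ {m n p m′ n′ p′} (A : Matrix m n) (A′ : Matrix n p) (B : Matrix m′ n′) (B′ : Matrix n′ p′) x y →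
           blocks (A ⊠ A′) (B ⊠ B′) x y ≡
           Σℚ.sum (λ c → blocks A B x (inj₁ c) ℚ.* blocks A′ B′ (inj₁ c) y) ℚ.+
           Σℚ.sum (λ d → blocks A B x (inj₂ d) ℚ.* blocks A′ B′ (inj₂ d) y)
blocks-⊠ {n′ = n′} A A′ B B′ (inj₁ a) (inj₁ b) =
  sym (trans (cong ((A ⊠ A′) a b ℚ.+_) (sum-zero {n′} _ (λ _ → ℚR.zeroˡ 0ℚ))) (ℚR.+-identityʳ ((A ⊠ A′) a b)))
blocks-⊠ {n = n} {n′ = n′} A A′ B B′ (inj₁ a) (inj₂ b) =
  sym (cong₂ ℚ._+_ (sum-zero {n} _ (λ c → ℚR.zeroʳ (A a c))) (sum-zero {n′} _ (λ d → ℚR.zeroˡ (B′ d b))))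
blocks-⊠ {n = n} {n′ = n′} A A′ B B′ (inj₂ a) (inj₁ b) =
  sym (cong₂ ℚ._+_ (sum-zero {n} _ (λ c → ℚR.zeroˡ (A′ c b))) (sum-zero {n′} _ (λ d → ℚR.zeroʳ (B a d))))
blocks-⊠ {n = n} A A′ B B′ (inj₂ a) (inj₂ b) =
  sym (trans (cong (ℚ._+ (B ⊠ B′) a b) (sum-zero {n} _ (λ _ → ℚR.zeroˡ 0ℚ))) (ℚR.+-identityˡ ((B ⊠ B′) a b)))

⊕ᴹ-⊠ : ∀ {m n p m′ n′ p′} (A : Matrix m n) (A′ : Matrix n p) (B : Matrix m′ n′) (B′ : Matrix n′ p′) →
       (A ⊠ A′) ⊕ᴹ (B ⊠ B′) ≋ (A ⊕ᴹ B) ⊠ (A′ ⊕ᴹ B′)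
⊕ᴹ-⊠ {m} {n} {p} {m′} {n′} {p′} A A′ B B′ i j = trans
  (blocks-⊠ A A′ B B′ x y)
  (sym (trans (sum-+ n (λ z → (A ⊕ᴹ B) i z ℚ.* (A′ ⊕ᴹ B′) z j))
       (cong₂ ℚ._+_
         (Σℚ.sum-cong-≗ (λ c → cong (λ z → blocks A B x z ℚ.* blocks A′ B′ z y) (Fin.splitAt-↑ˡ n c n′)))
         (Σℚ.sum-cong-≗ (λ d → cong (λ z → blocks A B x z ℚ.* blocks A′ B′ z y) (Fin.splitAt-↑ʳ n n′ d))))))
  where
  x = splitAt m i
  y = splitAt p j

⊗ᴹ-cong : {A A′ : Matrix m n} {B B′ : Matrix k l} → A ≋ A′ → B ≋ B′ → A ⊗ᴹ B ≋ A′ ⊗ᴹ B′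
⊗ᴹ-cong p q i j = cong₂ ℚ._*_ (p _ _) (q _ _)

remQuot-injective : ∀ m {k} {i j : Fin (m ℕ.* k)} → remQuot {m} k i ≡ remQuot {m} k j → i ≡ j
remQuot-injective m {k} {i} {j} p =
  trans (sym (Fin.combine-remQuot {m} k i))
        (trans (cong (λ { (a , b) → combine a b }) p) (Fin.combine-remQuot {m} k j))

⊗ᴹ-𝟙 : ∀ m k → 𝟙 m ⊗ᴹ 𝟙 k ≋ 𝟙 (m ℕ.* k)
⊗ᴹ-𝟙 m k i j = aux (i Fin.≟ j)
  where
  a  = proj₁ (remQuot {m} k i)
  a′ = proj₁ (remQuot {m} k j)
  b  = proj₂ (remQuot {m} k i)
  b′ = proj₂ (remQuot {m} k j)
  aux : Dec (i ≡ j) → δ a a′ ℚ.* δ b b′ ≡ δ i j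
  aux (yes refl) = trans (cong₂ ℚ._*_ (δ-refl a) (δ-refl b)) (trans (ℚR.*-identityˡ 1ℚ) (sym (δ-refl i)))
  aux (no i≢j) with a Fin.≟ a′
  ... | no a≢a′ = trans (ℚR.zeroˡ (δ b b′)) (sym (δ-≢ i≢j))
  ... | yes p with b Fin.≟ b′
  ...   | no b≢b′ = trans (ℚR.zeroʳ 1ℚ) (sym (δ-≢ i≢j))
  ...   | yes q = contradiction (remQuot-injective m (cong₂ _,_ p q)) i≢j

*-interchange : ∀ a b c d → (a ℚ.* b) ℚ.* (c ℚ.* d) ≡ (a ℚ.* c) ℚ.* (b ℚ.* d)
*-interchange a b c d = begin
  (a ℚ.* b) ℚ.* (c ℚ.* d) ≡⟨ ℚR.*-assoc a b (c ℚ.* d) ⟩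
  a ℚ.* (b ℚ.* (c ℚ.* d)) ≡⟨ cong (a ℚ.*_) (sym (ℚR.*-assoc b c d)) ⟩
  a ℚ.* ((b ℚ.* c) ℚ.* d) ≡⟨ cong (λ x → a ℚ.* (x ℚ.* d)) (ℚR.*-comm b c) ⟩
  a ℚ.* ((c ℚ.* b) ℚ.* d) ≡⟨ cong (a ℚ.*_) (ℚR.*-assoc c b d) ⟩
  a ℚ.* (c ℚ.* (b ℚ.* d)) ≡⟨ sym (ℚR.*-assoc a c (b ℚ.* d)) ⟩
  (a ℚ.* c) ℚ.* (b ℚ.* d) ∎
  where open ≡-Reasoning

⊗ᴹ-⊠ : ∀ {m n p m′ n′ p′} (A : Matrix m n) (A′ : Matrix n p) (B : Matrix m′ n′) (B′ : Matrix n′ p′) →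
       (A ⊠ A′) ⊗ᴹ (B ⊠ B′) ≋ (A ⊗ᴹ B) ⊠ (A′ ⊗ᴹ B′)
⊗ᴹ-⊠ {m} {n} {p} {m′} {n′} {p′} A A′ B B′ i j = begin
  Σℚ.sum (λ c → A a c ℚ.* A′ c b) ℚ.* Σℚ.sum (λ d → B a′ d ℚ.* B′ d b′)
    ≡⟨ Σℚ.*-distribʳ-sum Y (λ c → A a c ℚ.* A′ c b) ⟩
  Σℚ.sum (λ c → (A a c ℚ.* A′ c b) ℚ.* Y)
    ≡⟨ Σℚ.sum-cong-≗ {n} {λ c → (A a c ℚ.* A′ c b) ℚ.* Y} {λ c → Σℚ.sum (inner c)} expand ⟩
  Σℚ.sum (λ c → Σℚ.sum (inner c))
    ≡⟨ sym (sum-* n {n′} (λ z → (A ⊗ᴹ B) i z ℚ.* (A′ ⊗ᴹ B′) z j)) ⟩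
  ((A ⊗ᴹ B) ⊠ (A′ ⊗ᴹ B′)) i j ∎
  where
  open ≡-Reasoning
  a  = proj₁ (remQuot {m} m′ i)
  a′ = proj₂ (remQuot {m} m′ i)
  b  = proj₁ (remQuot {p} p′ j)
  b′ = proj₂ (remQuot {p} p′ j)
  Y = Σℚ.sum (λ d → B a′ d ℚ.* B′ d b′)
  inner : Fin n → Fin n′ → ℚ
  inner c d = (A ⊗ᴹ B) i (combine c d) ℚ.* (A′ ⊗ᴹ B′) (combine c d) j
  step : ∀ c d → (A ⊗ᴹ B) i (combine c d) ℚ.* (A′ ⊗ᴹ B′) (combine c d) j
               ≡ (A a c ℚ.* B a′ d) ℚ.* (A′ c b ℚ.* B′ d b′)
  step c d = cong (λ z → (A a (proj₁ z) ℚ.* B a′ (proj₂ z)) ℚ.* (A′ (proj₁ z) b ℚ.* B′ (proj₂ z) b′))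
                  (Fin.remQuot-combine {n} {n′} c d)
  expand : ∀ c → (A a c ℚ.* A′ c b) ℚ.* Y ≡ Σℚ.sum (inner c)
  expand c = trans (Σℚ.*-distribˡ-sum (A a c ℚ.* A′ c b) (λ d → B a′ d ℚ.* B′ d b′))
    (Σℚ.sum-cong-≗ {n′} {λ d → (A a c ℚ.* A′ c b) ℚ.* (B a′ d ℚ.* B′ d b′)} {inner c}
      (λ d → trans (*-interchange (A a c) (A′ c b) (B a′ d) (B′ d b′)) (sym (step c d))))

record FiniteGroup : Set₁ where
  field
    group    : Group 0ℓ 0ℓ
  open Group group public
  field
    _≟_      : Decidable₂ _≈_
    elements : List Carrier
    complete : IsEnumeration setoid elements
  open GroupProperties group public

infixr 2 _×ᴳ_
_×ᴳ_ : FiniteGroup → FiniteGroup → FiniteGroup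
G ×ᴳ H = record
  { group    = DirectProduct.group G.group H.group
  ; _≟_      = ×-decidable G._≟_ H._≟_
  ; elements = cartesianProduct G.elements H.elements
  ; complete = Enumerates.cartesianProduct⁺ G.setoid H.setoid G.complete H.complete
  }
  where
  module G = FiniteGroup G
  module H = FiniteGroup H

record Subgroup (W : FiniteGroup) : Set₁ where
  open FiniteGroup W
  field
    Mem  : Pred Carrier 0ℓ
    mem? : Decidable Mem
    resp : ∀ {g h} → g ≈ h → Mem g → Mem h
    ε∈   : Mem ε
    ∙∈   : ∀ {g h} → Mem g → Mem h → Mem (g ∙ h)
    ⁻¹∈  : ∀ {g} → Mem g → Mem (g ⁻¹)

  members : List Carrier → List (Σ Carrier Mem)
  members []       = []
  members (g ∷ gs) with mem? g
  ... | yes p = (g , p) ∷ members gs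
  ... | no  _ = members gs

  finiteGroup : FiniteGroup
  finiteGroup = record
    { group = record
      { Carrier = Σ Carrier Mem
      ; _≈_     = λ g h → proj₁ g ≈ proj₁ h
      ; _∙_     = λ { (g , p) (h , q) → g ∙ h , ∙∈ p q }
      ; ε       = ε , ε∈
      ; _⁻¹     = λ { (g , p) → g ⁻¹ , ⁻¹∈ p }
      ; isGroup = record
        { isMonoid = record
          { isSemigroup = record
            { isMagma = record
              { isEquivalence = record
                { refl  = FiniteGroup.refl W
                ; sym   = FiniteGroup.sym W
                ; trans = FiniteGroup.trans W
                }
              ; ∙-cong = ∙-cong
              }
            ; assoc = λ x y z → assoc (proj₁ x) (proj₁ y) (proj₁ z)
            }
          ; identity = (λ x → identityˡ (proj₁ x)) , (λ x → identityʳ (proj₁ x))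
          }
        ; inverse = (λ x → inverseˡ (proj₁ x)) , (λ x → inverseʳ (proj₁ x))
        ; ⁻¹-cong = ⁻¹-cong
        }
      }
    ; _≟_      = λ g h → proj₁ g ≟ proj₁ h
    ; elements = members elements
    ; complete = λ { (g , p) → find p (complete g) }
    }
    where
    find : ∀ {g gs} → Mem g → Any.Any (g ≈_) gs → Any.Any (λ x → g ≈ proj₁ x) (members gs)
    find {gs = h ∷ gs} p (here g≈h) with mem? h
    ... | yes q = here g≈h
    ... | no ¬q = contradiction (resp g≈h p) ¬q
    find {gs = h ∷ gs} p (there g∈gs) with mem? h
    ... | yes q = there (find p g∈gs)
    ... | no ¬q = find p g∈gs

record Rep (W : FiniteGroup) : Set where
  open FiniteGroup W
  field
    dim    : ℕ
    ρ      : Carrier → Matrix dim dim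
    ρ-cong : ∀ {g h} → g ≈ h → ρ g ≋ ρ h
    ρ-ε    : ρ ε ≋ 𝟙 dim
    ρ-∙    : ∀ g h → ρ (g ∙ h) ≋ ρ g ⊠ ρ h

infix 4 _≅_
record _≅_ {W : FiniteGroup} (V U : Rep W) : Set where
  module V = Rep V
  module U = Rep U
  field
    to         : Matrix U.dim V.dim
    from       : Matrix V.dim U.dim
    to-from    : to ⊠ from ≋ 𝟙 U.dim
    from-to    : from ⊠ to ≋ 𝟙 V.dim
    intertwine : ∀ g → to ⊠ V.ρ g ≋ U.ρ g ⊠ to

zeroRep : (W : FiniteGroup) → Rep W
zeroRep W = record
  { dim = 0 ; ρ = λ _ → 𝟙 0 ; ρ-cong = λ _ → ≋-refl ; ρ-ε = ≋-refl ; ρ-∙ = λ _ _ () }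

trivialRep : (W : FiniteGroup) → Rep W
trivialRep W = record
  { dim    = 1
  ; ρ      = λ _ → 𝟙 1
  ; ρ-cong = λ _ → ≋-refl
  ; ρ-ε    = ≋-refl
  ; ρ-∙    = λ _ _ → ≋-sym (⊠-identityˡ (𝟙 1))
  }

infixr 6 _⊕_
_⊕_ : {W : FiniteGroup} → Rep W → Rep W → Rep W
V ⊕ U = record
  { dim    = V.dim ℕ.+ U.dim
  ; ρ      = λ g → V.ρ g ⊕ᴹ U.ρ g
  ; ρ-cong = λ p → ⊕ᴹ-cong (V.ρ-cong p) (U.ρ-cong p)
  ; ρ-ε    = ≋-trans (⊕ᴹ-cong V.ρ-ε U.ρ-ε) (⊕ᴹ-𝟙 V.dim U.dim)
  ; ρ-∙    = λ g h → ≋-trans (⊕ᴹ-cong (V.ρ-∙ g h) (U.ρ-∙ g h))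
                             (⊕ᴹ-⊠ (V.ρ g) (V.ρ h) (U.ρ g) (U.ρ h))
  }
  where
  module V = Rep V
  module U = Rep U

infixr 7 _⊗_
_⊗_ : {G H : FiniteGroup} → Rep G → Rep H → Rep (G ×ᴳ H)
V ⊗ U = record
  { dim    = V.dim ℕ.* U.dim
  ; ρ      = λ { (g , h) → V.ρ g ⊗ᴹ U.ρ h }
  ; ρ-cong = λ { (p , q) → ⊗ᴹ-cong (V.ρ-cong p) (U.ρ-cong q) }
  ; ρ-ε    = ≋-trans (⊗ᴹ-cong V.ρ-ε U.ρ-ε) (⊗ᴹ-𝟙 V.dim U.dim)
  ; ρ-∙    = λ { (g , h) (g′ , h′) →
               ≋-trans (⊗ᴹ-cong (V.ρ-∙ g g′) (U.ρ-∙ h h′))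
                       (⊗ᴹ-⊠ (V.ρ g) (V.ρ g′) (U.ρ h) (U.ρ h′)) }
  }
  where
  module V = Rep V
  module U = Rep U

-- Induction from a subgroup H.  With t₁, …, tₖ representatives of the left
-- cosets of H, Ind V = ⊕ᵢ tᵢ V, and g sends tᵢ V to tⱼ V by tⱼ⁻¹ g tᵢ when that
-- element lies in H.

module Induction {W : FiniteGroup} (H : Subgroup W) (V : Rep (Subgroup.finiteGroup H)) where
  open FiniteGroup W renaming (refl to ≈-refl; sym to ≈-sym; trans to ≈-trans)
  open Subgroup H
  open Rep V
  open import Relation.Binary.Reasoning.Setoid setoid

  SameCoset : Carrier → Carrier → Set
  SameCoset s t = Mem (s ⁻¹ ∙ t)

  sameCoset? : Decidable₂ SameCoset
  sameCoset? s t = mem? (s ⁻¹ ∙ t)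

  cancel : ∀ s t u → (s ⁻¹ ∙ t) ∙ (t ⁻¹ ∙ u) ≈ s ⁻¹ ∙ u
  cancel s t u = begin
    (s ⁻¹ ∙ t) ∙ (t ⁻¹ ∙ u) ≈⟨ assoc _ _ _ ⟩
    s ⁻¹ ∙ (t ∙ (t ⁻¹ ∙ u)) ≈⟨ ∙-congˡ (assoc _ _ _) ⟨
    s ⁻¹ ∙ ((t ∙ t ⁻¹) ∙ u) ≈⟨ ∙-congˡ (∙-congʳ (inverseʳ t)) ⟩
    s ⁻¹ ∙ (ε ∙ u)          ≈⟨ ∙-congˡ (identityˡ u) ⟩
    s ⁻¹ ∙ u                ∎

  flip⁻¹ : ∀ s t → (s ⁻¹ ∙ t) ⁻¹ ≈ t ⁻¹ ∙ s
  flip⁻¹ s t = ≈-trans (⁻¹-anti-homo-∙ _ _) (∙-congˡ (⁻¹-involutive s))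

  cosets : DecSetoid 0ℓ 0ℓ
  cosets = record
    { Carrier = Carrier
    ; _≈_     = SameCoset
    ; isDecEquivalence = record
      { isEquivalence = record
        { refl  = λ {s} → resp (≈-sym (inverseˡ s)) ε∈
        ; sym   = λ {s} {t} p → resp (flip⁻¹ s t) (⁻¹∈ p)
        ; trans = λ {s} {t} {u} p q → resp (cancel s t u) (∙∈ p q)
        }
      ; _≟_ = sameCoset?
      }
    }
  module cosets = DecSetoid cosets

  representatives : List Carrier
  representatives = deduplicate sameCoset? elements

  index : ℕ
  index = length representatives

  rep : Fin index → Carrier
  rep = List.lookup representatives

  locate : ∀ g → ∃ λ i → SameCoset g (rep i)
  locate g = Any.index g∈ , Anyₚ.lookup-index g∈
    where
    g∈ : Any.Any (SameCoset g) representatives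
    g∈ = Enumerates.deduplicate⁺ cosets
           (λ x → Any.map (λ {y} x≈y → resp (≈-trans (≈-sym (inverseˡ x)) (∙-congˡ x≈y)) ε∈) (complete x)) g

  lookup-unique : ∀ {xs} → UniqueS.Unique cosets.setoid xs →
                  ∀ i j → SameCoset (List.lookup xs i) (List.lookup xs j) → i ≡ j
  lookup-unique (_ ∷ _)  zero    zero    _ = refl
  lookup-unique (x∉ ∷ _) zero    (suc j) p = contradiction p (All.lookup x∉ (Membershipₚ.∈-lookup j))
  lookup-unique (x∉ ∷ _) (suc i) zero    p =
    contradiction (cosets.sym p) (All.lookup x∉ (Membershipₚ.∈-lookup i))
  lookup-unique (_ ∷ u)  (suc i) (suc j) p = cong suc (lookup-unique u i j p)

  rep-unique : ∀ i j → SameCoset (rep i) (rep j) → i ≡ j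
  rep-unique = lookup-unique (UniqueDS.deduplicate-! cosets elements)

  ρ₀ : Carrier → Matrix dim dim
  ρ₀ w with mem? w
  ... | yes p = ρ (w , p)
  ... | no  _ = 𝟘 dim dim

  ρ₀-∈ : ∀ {w} (p : Mem w) → ρ₀ w ≋ ρ (w , p)
  ρ₀-∈ {w} p with mem? w
  ... | yes q = ρ-cong ≈-refl
  ... | no ¬p = contradiction p ¬p

  ρ₀-∉ : ∀ {w} → ¬ Mem w → ρ₀ w ≋ 𝟘 dim dim
  ρ₀-∉ {w} ¬p with mem? w
  ... | yes p = contradiction p ¬p
  ... | no _  = ≋-refl

  ρ₀-cong : ∀ {w w′} → w ≈ w′ → ρ₀ w ≋ ρ₀ w′
  ρ₀-cong {w} {w′} eq with mem? w
  ... | yes p = ≋-trans (ρ-cong eq) (≋-sym (ρ₀-∈ (resp eq p)))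
  ... | no ¬p = ≋-sym (ρ₀-∉ (¬p ∘ resp (≈-sym eq)))

  ρ₀-∙ : ∀ w {h} → Mem h → ρ₀ (w ∙ h) ≋ ρ₀ w ⊠ ρ₀ h
  ρ₀-∙ w {h} q with mem? w
  ... | yes p = ≋-trans (ρ₀-∈ (∙∈ p q))
                        (≋-trans (ρ-∙ (w , p) (h , q)) (⊠-cong {A = ρ (w , p)} ≋-refl (≋-sym (ρ₀-∈ q))))
  ... | no ¬p = ≋-trans (ρ₀-∉ (λ wh → ¬p (resp wh∙h⁻¹ (∙∈ wh (⁻¹∈ q)))))
                        (λ i j → sym (sum-zero {dim} _ (λ l → ℚR.zeroˡ (ρ₀ h l j))))
    where
    wh∙h⁻¹ : (w ∙ h) ∙ h ⁻¹ ≈ w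
    wh∙h⁻¹ = ≈-trans (assoc _ _ _) (≈-trans (∙-congˡ (inverseʳ h)) (identityʳ w))

  entry : Carrier → Fin index × Fin dim → Fin index × Fin dim → ℚ
  entry g (j , a) (i , b) = ρ₀ ((rep j ⁻¹ ∙ g) ∙ rep i) a b

  split : Fin (index ℕ.* dim) → Fin index × Fin dim
  split = remQuot {index} dim

  ρInd : Carrier → Matrix (index ℕ.* dim) (index ℕ.* dim)
  ρInd g x y = entry g (split x) (split y)

  entry-ε : ∀ x y → entry ε (split x) (split y) ≡ δ x y
  entry-ε x y = aux (x Fin.≟ y)
    where
    j = proj₁ (split x)
    a = proj₂ (split x)
    i = proj₁ (split y)
    b = proj₂ (split y)
    simp : (rep j ⁻¹ ∙ ε) ∙ rep i ≈ rep j ⁻¹ ∙ rep i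
    simp = ∙-congʳ (identityʳ _)
    aux : Dec (x ≡ y) → entry ε (j , a) (i , b) ≡ δ x y
    aux (yes refl) = trans (ρ₀-cong (≈-trans simp (inverseˡ _)) a a)
      (trans (ρ₀-∈ ε∈ a a) (trans (ρ-ε a a) (trans (δ-refl a) (sym (δ-refl x)))))
    aux (no x≢y) with j Fin.≟ i
    ... | no j≢i = trans (ρ₀-∉ (λ p → j≢i (rep-unique j i (resp simp p))) a b) (sym (δ-≢ x≢y))
    ... | yes j≡i = trans (ρ₀-cong (≈-trans simp (≈-trans (∙-congˡ (reflexive (cong rep (sym j≡i)))) (inverseˡ _))) a b)
      (trans (ρ₀-∈ ε∈ a b) (trans (ρ-ε a b)
        (trans (δ-≢ (λ a≡b → x≢y (remQuot-injective index (cong₂ _,_ j≡i a≡b)))) (sym (δ-≢ x≢y)))))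

  entry-∙ : ∀ g h x y → entry (g ∙ h) x y ≡
            Σℚ.sum (λ l → Σℚ.sum (λ c → entry g x (l , c) ℚ.* entry h (l , c) y))
  entry-∙ g h (j , a) (i , b) = sym (trans (sum-single (λ l → Σℚ.sum (λ c → entry g (j , a) (l , c) ℚ.* entry h (l , c) (i , b))) l₀ vanish) (sym main))
    where
    l₀ : Fin index
    l₀ = proj₁ (locate (h ∙ rep i))
    fac : ∀ l → (rep l ⁻¹ ∙ h) ∙ rep i ≈ rep l ⁻¹ ∙ (h ∙ rep i)
    fac l = assoc _ _ _
    in-H : Mem ((rep l₀ ⁻¹ ∙ h) ∙ rep i)
    in-H = resp (≈-sym (fac l₀)) (cosets.sym {h ∙ rep i} (proj₂ (locate (h ∙ rep i))))
    vanish : ∀ l → l ≢ l₀ → Σℚ.sum (λ c → entry g (j , a) (l , c) ℚ.* entry h (l , c) (i , b)) ≡ 0ℚ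
    vanish l l≢l₀ = sum-zero {dim} _ (λ c → trans
      (cong (entry g (j , a) (l , c) ℚ.*_)
        (ρ₀-∉ (λ p → l≢l₀ (rep-unique l l₀
          (cosets.trans {rep l} {h ∙ rep i} (resp (fac l) p) (proj₂ (locate (h ∙ rep i)))))) c b))
      (ℚR.zeroʳ (entry g (j , a) (l , c))))
    prod : (rep j ⁻¹ ∙ (g ∙ h)) ∙ rep i ≈ ((rep j ⁻¹ ∙ g) ∙ rep l₀) ∙ ((rep l₀ ⁻¹ ∙ h) ∙ rep i)
    prod = begin
      (rep j ⁻¹ ∙ (g ∙ h)) ∙ rep i   ≈⟨ ∙-congʳ (assoc _ _ _) ⟨
      ((rep j ⁻¹ ∙ g) ∙ h) ∙ rep i   ≈⟨ assoc _ _ _ ⟩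
      (rep j ⁻¹ ∙ g) ∙ (h ∙ rep i)   ≈⟨ ∙-congˡ (identityˡ _) ⟨
      (rep j ⁻¹ ∙ g) ∙ (ε ∙ (h ∙ rep i)) ≈⟨ ∙-congˡ (∙-congʳ (inverseʳ (rep l₀))) ⟨
      (rep j ⁻¹ ∙ g) ∙ ((rep l₀ ∙ rep l₀ ⁻¹) ∙ (h ∙ rep i)) ≈⟨ ∙-congˡ (assoc _ _ _) ⟩
      (rep j ⁻¹ ∙ g) ∙ (rep l₀ ∙ (rep l₀ ⁻¹ ∙ (h ∙ rep i))) ≈⟨ assoc _ _ _ ⟨
      ((rep j ⁻¹ ∙ g) ∙ rep l₀) ∙ (rep l₀ ⁻¹ ∙ (h ∙ rep i)) ≈⟨ ∙-congˡ (fac l₀) ⟨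
      ((rep j ⁻¹ ∙ g) ∙ rep l₀) ∙ ((rep l₀ ⁻¹ ∙ h) ∙ rep i) ∎
    main : entry (g ∙ h) (j , a) (i , b) ≡
           Σℚ.sum (λ c → entry g (j , a) (l₀ , c) ℚ.* entry h (l₀ , c) (i , b))
    main = trans (ρ₀-cong prod a b) (ρ₀-∙ _ in-H a b)

  ind : Rep W
  ind = record
    { dim    = index ℕ.* dim
    ; ρ      = ρInd
    ; ρ-cong = λ p x y → ρ₀-cong (∙-congʳ (∙-congˡ p)) _ _
    ; ρ-ε    = entry-ε
    ; ρ-∙    = λ g h x y → trans (entry-∙ g h (split x) (split y))
        (trans (Σℚ.sum-cong-≗ {index} (λ l → Σℚ.sum-cong-≗ {dim}
                 {λ c → entry g (split x) (l , c) ℚ.* entry h (l , c) (split y)}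
                 {λ c → ρInd g x (combine l c) ℚ.* ρInd h (combine l c) y}
                 (λ c → cong (λ z → entry g (split x) z ℚ.* entry h z (split y))
                             (sym (Fin.remQuot-combine {index} {dim} l c)))))
               (sym (sum-* index {dim} (λ z → ρInd g x z ℚ.* ρInd h z y))))
    }

open Induction using (ind) public

-- Virtual representations: formal differences of representations, two of them
-- being equal in the Grothendieck group when they agree after adding some K

infix 5 _⊖_
record VRep (W : FiniteGroup) : Set where
  constructor _⊖_
  field
    pos neg : Rep W
open VRep public

infix 4 _≈ᵛ_
record _≈ᵛ_ {W : FiniteGroup} (X Y : VRep W) : Set where
  field
    K   : Rep W
    iso : (pos X ⊕ neg Y) ⊕ K ≅ (pos Y ⊕ neg X) ⊕ K

module _ {W : FiniteGroup} where

  0ᵛ : VRep W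
  0ᵛ = zeroRep W ⊖ zeroRep W

  1ᵛ : VRep W
  1ᵛ = trivialRep W ⊖ zeroRep W

  infixl 6 _+ᵛ_
  _+ᵛ_ : VRep W → VRep W → VRep W
  X +ᵛ Y = (pos X ⊕ pos Y) ⊖ (neg X ⊕ neg Y)

  -ᵛ_ : VRep W → VRep W
  -ᵛ X = neg X ⊖ pos X

infixr 7 _⊗ᵛ_
_⊗ᵛ_ : {G H : FiniteGroup} → VRep G → VRep H → VRep (G ×ᴳ H)
X ⊗ᵛ Y = (pos X ⊗ pos Y ⊕ neg X ⊗ neg Y) ⊖ (pos X ⊗ neg Y ⊕ neg X ⊗ pos Y)

indᵛ : {W : FiniteGroup} (H : Subgroup W) → VRep (Subgroup.finiteGroup H) → VRep W
indᵛ H X = ind H (pos X) ⊖ ind H (neg X)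

-- Graded virtual representations: a list is the polynomial with those
-- coefficients, constant term first

grVRep : FiniteGroup → Set
grVRep W = List (VRep W)

module _ {W : FiniteGroup} where

  coeff : grVRep W → ℕ → VRep W
  coeff []       _       = 0ᵛ
  coeff (X ∷ p)  zero    = X
  coeff (X ∷ p)  (suc i) = coeff p i

  infix 4 _≈ᵍ_
  _≈ᵍ_ : grVRep W → grVRep W → Set
  p ≈ᵍ q = ∀ i → coeff p i ≈ᵛ coeff q i

  0ᵍ : grVRep W
  0ᵍ = []

  1ᵍ : grVRep W
  1ᵍ = 1ᵛ ∷ []

  infixl 6 _+ᵍ_ _-ᵍ_
  _+ᵍ_ : grVRep W → grVRep W → grVRep W
  []      +ᵍ q       = q
  (X ∷ p) +ᵍ []      = X ∷ p
  (X ∷ p) +ᵍ (Y ∷ q) = (X +ᵛ Y) ∷ (p +ᵍ q)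

  _-ᵍ_ : grVRep W → grVRep W → grVRep W
  p -ᵍ q = p +ᵍ List.map -ᵛ_ q

  sumᵍ : List (grVRep W) → grVRep W
  sumᵍ = foldr _+ᵍ_ 0ᵍ

  infixr 8 x^_·_
  x^_·_ : ℕ → grVRep W → grVRep W
  x^ zero  · p = p
  x^ suc k · p = 0ᵛ ∷ (x^ k · p)

  PalindromicOfDegree : ℕ → grVRep W → Set
  PalindromicOfDegree d p =
    (∀ j → j ≤ d → coeff p j ≈ᵛ coeff p (d ∸ j)) × (∀ j → d < j → coeff p j ≈ᵛ 0ᵛ)

infixr 7 _⊗ᵍ_
_⊗ᵍ_ : {G H : FiniteGroup} → grVRep G → grVRep H → grVRep (G ×ᴳ H)
[]      ⊗ᵍ q = 0ᵍ
(X ∷ p) ⊗ᵍ q = List.map (X ⊗ᵛ_) q +ᵍ x^ 1 · (p ⊗ᵍ q)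

indᵍ : {W : FiniteGroup} (H : Subgroup W) → grVRep (Subgroup.finiteGroup H) → grVRep W
indᵍ H = List.map (indᵛ H)

subsets : ∀ n → List (Subset n)
subsets zero    = [] ∷ []
subsets (suc n) = List.map (inside ∷_) (subsets n) ++ List.map (outside ∷_) (subsets n)

private
  variable
    A B C D F I J S T : Subset n
    x y : Fin n

∪-lub : A ⊆ C → B ⊆ C → A ∪ B ⊆ C
∪-lub {A = A} {B = B} p q x∈ with x∈p∪q⁻ A B x∈
... | inj₁ x∈A = p x∈A
... | inj₂ x∈B = q x∈B

∪-mono : A ⊆ C → B ⊆ D → A ∪ B ⊆ C ∪ D
∪-mono p q = ∪-lub (λ x∈ → x∈p∪q⁺ (inj₁ (p x∈))) (λ x∈ → x∈p∪q⁺ (inj₂ (q x∈)))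

⁅⁆⊆ : x ∈ S → ⁅ x ⁆ ⊆ S
⁅⁆⊆ {x = x} x∈S y∈ rewrite x∈⁅y⁆⇒x≡y x y∈ = x∈S

x∈p─q⇒x∉q : ∀ (A B : Subset n) → x ∈ A ─ B → x ∉ B
x∈p─q⇒x∉q (a ∷ A) (outside ∷ B) Vec.here      ()
x∈p─q⇒x∉q (a ∷ A) (b ∷ B)       (Vec.there p) (Vec.there q) = x∈p─q⇒x∉q A B p q

∣∪⁅⁆∣≤ : ∀ (A : Subset n) x → ∣ A ∪ ⁅ x ⁆ ∣ ≤ suc ∣ A ∣
∣∪⁅⁆∣≤ (inside  ∷ A) zero    rewrite ∪-identityʳ A = ℕ.n≤1+n _
∣∪⁅⁆∣≤ (outside ∷ A) zero    rewrite ∪-identityʳ A = ℕ.≤-refl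
∣∪⁅⁆∣≤ (inside  ∷ A) (suc x) = s≤s (∣∪⁅⁆∣≤ A x)
∣∪⁅⁆∣≤ (outside ∷ A) (suc x) = ∣∪⁅⁆∣≤ A x

x∉A⇒∣A∣<∣A∪x∣ : x ∉ A → ∣ A ∣ < ∣ A ∪ ⁅ x ⁆ ∣
x∉A⇒∣A∣<∣A∪x∣ {x = x} {A = A} x∉A =
  p⊂q⇒∣p∣<∣q∣ (p⊆p∪q ⁅ x ⁆ , x , x∈p∪q⁺ (inj₂ (x∈⁅x⁆ x)) , x∉A)

∣A∪B∣ : (A B : Subset n) → (∀ x → x ∈ A → x ∉ B) → ∣ A ∪ B ∣ ≡ ∣ A ∣ ℕ.+ ∣ B ∣
∣A∪B∣ []            []            d = refl
∣A∪B∣ (inside  ∷ A) (inside  ∷ B) d = contradiction Vec.here (d zero Vec.here)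
∣A∪B∣ (inside  ∷ A) (outside ∷ B) d = cong suc (∣A∪B∣ A B (λ x p q → d (suc x) (Vec.there p) (Vec.there q)))
∣A∪B∣ (outside ∷ A) (inside  ∷ B) d =
  trans (cong suc (∣A∪B∣ A B (λ x p q → d (suc x) (Vec.there p) (Vec.there q)))) (sym (ℕ.+-suc ∣ A ∣ ∣ B ∣))
∣A∪B∣ (outside ∷ A) (outside ∷ B) d = ∣A∪B∣ A B (λ x p q → d (suc x) (Vec.there p) (Vec.there q))

∃-∈-∉ : (I J : Subset n) → ∣ I ∣ < ∣ J ∣ → ∃ λ x → x ∈ J × x ∉ I
∃-∈-∉ I J ∣I∣<∣J∣ with Fin.any? (λ x → x ∈? J ×-dec ¬? (x ∈? I))
... | yes found = found
... | no  none  = contradiction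
  (p⊆q⇒∣p∣≤∣q∣ {p = J} {I} (λ {x} x∈J → decidable-stable (x ∈? I) (λ x∉I → none (x , x∈J , x∉I))))
  (ℕ.<⇒≱ ∣I∣<∣J∣)

-- The ambient Fin n is shared by a matroid, its contractions and its cycles; only the
-- subset ground belongs to the matroid.
record Matroid (n : ℕ) : Set₁ where
  field
    ground   : Subset n
    Indep    : Pred (Subset n) 0ℓ
    indep?   : Decidable Indep
    ⊆ground  : Indep I → I ⊆ ground
    empty    : Indep ⊥
    heredity : I ⊆ J → Indep J → Indep I
    augment  : Indep I → Indep J → ∣ I ∣ < ∣ J ∣ → ∃ λ x → x ∈ J × x ∉ I × Indep (I ∪ ⁅ x ⁆)

  record IsBasisOf (S B : Subset n) : Set where
    field
      indep   : Indep B
      subset  : B ⊆ S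
      maximal : x ∈ S → Indep (B ∪ ⁅ x ⁆) → x ∈ B

  IsBasis : Pred (Subset n) 0ℓ
  IsBasis = IsBasisOf ground

  IsLoop : Pred (Fin n) 0ℓ
  IsLoop x = x ∈ ground × ¬ Indep ⁅ x ⁆

  HasLoop Loopless : Set
  HasLoop  = ∃ IsLoop
  Loopless = ∀ x → ¬ IsLoop x

  rank : Subset n → ℕ
  rank S = max 0 (List.map ∣_∣ (filter (λ I → indep? I ×-dec (I ⊆? S)) (subsets n)))

  rk : ℕ
  rk = rank ground

  IsFlat : Pred (Subset n) 0ℓ
  IsFlat F = F ⊆ ground × (∀ x → x ∈ ground → x ∉ F → rank F < rank (F ∪ ⁅ x ⁆))

  isFlat? : Decidable IsFlat
  isFlat? F = (F ⊆? ground) ×-dec Fin.all? λ x →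
    (x ∈? ground) →-dec ¬? (x ∈? F) →-dec (rank F ℕ.<? rank (F ∪ ⁅ x ⁆))

  isBasisOf? : ∀ S → Decidable (IsBasisOf S)
  isBasisOf? S B = map′ to from (indep? B ×-dec (B ⊆? S) ×-dec Fin.all? λ x →
      (x ∈? S) →-dec indep? (B ∪ ⁅ x ⁆) →-dec (x ∈? B))
    where
    Explicit : Set
    Explicit = Indep B × B ⊆ S × (∀ x → x ∈ S → Indep (B ∪ ⁅ x ⁆) → x ∈ B)
    to : Explicit → IsBasisOf S B
    to (p , q , r) = record { indep = p ; subset = q ; maximal = λ {x} → r x }
    from : IsBasisOf S B → Explicit
    from b = IsBasisOf.indep b , IsBasisOf.subset b , λ x → IsBasisOf.maximal b

  extend : Indep I → I ⊆ S → ∃ λ B → I ⊆ B × IsBasisOf S B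
  extend {I = I} {S} = go n I (ℕ.m≤m+n n ∣ I ∣)
    where
    go : ∀ k I → n ≤ k ℕ.+ ∣ I ∣ → Indep I → I ⊆ S → ∃ λ B → I ⊆ B × IsBasisOf S B
    go k I bound indI I⊆S with Fin.any? (λ x → (x ∈? S) ×-dec ¬? (x ∈? I) ×-dec indep? (I ∪ ⁅ x ⁆))
    go k I bound indI I⊆S | no none = I , (λ p → p) , record
      { indep   = indI
      ; subset  = I⊆S
      ; maximal = λ {x} x∈S ind → decidable-stable (x ∈? I) (λ x∉I → none (x , x∈S , x∉I , ind))
      }
    go zero I bound indI I⊆S | yes (x , x∈S , x∉I , ind) =
      contradiction (ℕ.≤-trans (x∉A⇒∣A∣<∣A∪x∣ x∉I) (∣p∣≤n (I ∪ ⁅ x ⁆))) (ℕ.≤⇒≯ bound)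
    go (suc k) I bound indI I⊆S | yes (x , x∈S , x∉I , ind)
      with B , I⊆B , b ← go k (I ∪ ⁅ x ⁆)
             (ℕ.≤-trans bound (ℕ.≤-trans (ℕ.≤-reflexive (sym (ℕ.+-suc k ∣ I ∣)))
                                         (ℕ.+-monoʳ-≤ k (x∉A⇒∣A∣<∣A∪x∣ x∉I))))
             ind (∪-lub I⊆S (⁅⁆⊆ x∈S))
      = B , (λ p → I⊆B (p⊆p∪q ⁅ x ⁆ p)) , b

  basis-≤ : IsBasisOf S A → IsBasisOf S B → ∣ B ∣ ≤ ∣ A ∣
  basis-≤ {A = A} {B} a b with ∣ B ∣ ℕ.≤? ∣ A ∣
  ... | yes p = p
  ... | no ¬p with x , x∈B , x∉A , ind ← augment (IsBasisOf.indep a) (IsBasisOf.indep b) (ℕ.≰⇒> ¬p) =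
    contradiction (IsBasisOf.maximal a (IsBasisOf.subset b x∈B) ind) x∉A

-- The choice of the basis J of F is immaterial.
infixl 6 _/_
_/_ : Matroid n → Subset n → Matroid n
_/_ {n} M F = record
  { ground   = ground ─ F
  ; Indep    = Indep/
  ; indep?   = λ I → (I ⊆? ground ─ F) ×-dec anySubset? (λ J → isBasisOf? F J ×-dec indep? (I ∪ J))
  ; ⊆ground  = λ { (p , _) → p }
  ; empty    = emp
  ; heredity = λ I⊆J (p , K , b , ind) →
      (λ x∈I → p (I⊆J x∈I)) , K , b , heredity (∪-mono I⊆J (λ p → p)) ind
  ; augment  = aug
  }
  where
  open Matroid M
  Indep/ : Pred (Subset n) 0ℓ
  Indep/ I = I ⊆ ground ─ F × ∃ λ J → IsBasisOf F J × Indep (I ∪ J)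
  emp : Indep/ ⊥
  emp with B , _ , b ← extend {S = F} empty ⊥⊆ = ⊥⊆ , B , b , subst Indep (sym (∪-identityˡ B)) (IsBasisOf.indep b)
  aug : ∀ {I J} → Indep/ I → Indep/ J → ∣ I ∣ < ∣ J ∣ → ∃ λ x → x ∈ J × x ∉ I × Indep/ (I ∪ ⁅ x ⁆)
  aug {I} {J} (I⊆ , K , bK , indI) (J⊆ , L , bL , indJ) I<J = pick (augment indI indJ bigger)
    where
    disjoint : ∀ {X Y} → X ⊆ ground ─ F → Y ⊆ F → ∀ x → x ∈ X → x ∉ Y
    disjoint p q x x∈X x∈Y = x∈p─q⇒x∉q ground F (p x∈X) (q x∈Y)
    bigger : ∣ I ∪ K ∣ < ∣ J ∪ L ∣
    bigger rewrite ∣A∪B∣ I K (disjoint I⊆ (IsBasisOf.subset bK)) | ∣A∪B∣ J L (disjoint J⊆ (IsBasisOf.subset bL))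
      = ℕ.+-mono-<-≤ I<J (basis-≤ bL bK)
    pick : (∃ λ x → x ∈ J ∪ L × x ∉ I ∪ K × Indep ((I ∪ K) ∪ ⁅ x ⁆)) →
           ∃ λ x → x ∈ J × x ∉ I × Indep/ (I ∪ ⁅ x ⁆)
    pick (x , x∈ , x∉ , ind) with x∈p∪q⁻ J L x∈
    ... | inj₁ x∈J = x , x∈J , (λ p → x∉ (p⊆p∪q K p)) , ∪-lub I⊆ (⁅⁆⊆ (J⊆ x∈J)) , K , bK ,
      heredity (∪-lub (∪-mono (p⊆p∪q K) (λ p → p)) (λ p → p⊆p∪q ⁅ x ⁆ (q⊆p∪q I K p))) ind
    ... | inj₂ x∈L = contradiction
      (q⊆p∪q I K (IsBasisOf.maximal bK (IsBasisOf.subset bL x∈L) (heredity (∪-mono (q⊆p∪q I K) (λ p → p)) ind)))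
      x∉

uniform : ℕ → Subset n → Matroid n
uniform {n} r S = record
  { ground   = S
  ; Indep    = λ I → I ⊆ S × ∣ I ∣ ≤ r
  ; indep?   = λ I → (I ⊆? S) ×-dec (∣ I ∣ ℕ.≤? r)
  ; ⊆ground  = λ { (p , _) → p }
  ; empty    = ⊥⊆ , ℕ.≤-trans (ℕ.≤-reflexive (∣⊥∣≡0 n)) z≤n
  ; heredity = λ I⊆J (p , q) → (λ x∈I → p (I⊆J x∈I)) , ℕ.≤-trans (p⊆q⇒∣p∣≤∣q∣ I⊆J) q
  ; augment  = λ {I} {J} (I⊆S , _) (J⊆S , ∣J∣≤r) I<J →
      let x , x∈J , x∉I = ∃-∈-∉ I J I<J in
      x , x∈J , x∉I , ∪-lub I⊆S (⁅⁆⊆ (J⊆S x∈J)) , ℕ.≤-trans (∣∪⁅⁆∣≤ I x) (ℕ.≤-trans I<J ∣J∣≤r)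
  }

-- The cycle matroid for nonempty S only: C[ ⊥ ] is the empty matroid.
C[_] : Subset n → Matroid n
C[ S ] = uniform (∣ S ∣ ∸ 1) S

module Σℕ = SemiringSum ℕ.+-*-semiring

bit : Side → ℕ
bit s = if s then 1 else 0

size-tabulate : (f : Fin n → Side) → ∣ tabulate f ∣ ≡ Σℕ.sum (bit ∘ f)
size-tabulate {zero}  f = refl
size-tabulate {suc n} f with f zero
... | inside  = cong suc (size-tabulate (f ∘ suc))
... | outside = size-tabulate (f ∘ suc)

record Action (W : FiniteGroup) (n : ℕ) : Set where
  open FiniteGroup W using (Carrier; _≈_; _∙_; ε; _⁻¹; inverseˡ; inverseʳ; ⁻¹-cong; ⁻¹-anti-homo-∙; ε⁻¹≈ε; elements; complete)
  field
    act      : Carrier → Fin n → Fin n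
    act-cong : ∀ {g h} → g ≈ h → ∀ x → act g x ≡ act h x
    act-ε    : ∀ x → act ε x ≡ x
    act-∙    : ∀ g h x → act (g ∙ h) x ≡ act g (act h x)

  infixr 7 _·_
  _·_ : Carrier → Subset n → Subset n
  g · S = tabulate (λ x → lookup S (act (g ⁻¹) x))

  act-invˡ : ∀ g x → act (g ⁻¹) (act g x) ≡ x
  act-invˡ g x = trans (sym (act-∙ (g ⁻¹) g x)) (trans (act-cong (inverseˡ g) x) (act-ε x))

  act-invʳ : ∀ g x → act g (act (g ⁻¹) x) ≡ x
  act-invʳ g x = trans (sym (act-∙ g (g ⁻¹) x)) (trans (act-cong (inverseʳ g) x) (act-ε x))

  ·-lookup : ∀ g S x → lookup (g · S) x ≡ lookup S (act (g ⁻¹) x)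
  ·-lookup g S x = Vec.lookup∘tabulate _ x

  ∈·⁻ : ∀ g {S x} → x ∈ g · S → act (g ⁻¹) x ∈ S
  ∈·⁻ g {S} {x} p = Vec.lookup⇒[]= _ S (trans (sym (·-lookup g S x)) (Vec.[]=⇒lookup p))

  ∈·⁺ : ∀ g {S x} → act (g ⁻¹) x ∈ S → x ∈ g · S
  ∈·⁺ g {S} {x} p = Vec.lookup⇒[]= x (g · S) (trans (·-lookup g S x) (Vec.[]=⇒lookup p))

  act-∈· : ∀ g {S x} → x ∈ S → act g x ∈ g · S
  act-∈· g {S} {x} p = ∈·⁺ g (subst (_∈ S) (sym (act-invˡ g x)) p)

  ·-mono : ∀ g {S T} → S ⊆ T → g · S ⊆ g · T
  ·-mono g p x∈ = ∈·⁺ g (p (∈·⁻ g x∈))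

  ·-cong : ∀ {g h} → g ≈ h → ∀ S → g · S ≡ h · S
  ·-cong p S = Vec.tabulate-cong (λ x → cong (lookup S) (act-cong (⁻¹-cong p) x))

  ·-ε : ∀ S → ε · S ≡ S
  ·-ε S = trans (Vec.tabulate-cong (λ x → cong (lookup S) (trans (act-cong ε⁻¹≈ε x) (act-ε x))))
                (Vec.tabulate∘lookup S)

  ·-∙ : ∀ g h S → (g ∙ h) · S ≡ g · h · S
  ·-∙ g h S = Vec.tabulate-cong (λ x →
    trans (cong (lookup S) (trans (act-cong (⁻¹-anti-homo-∙ g h) x) (act-∙ (h ⁻¹) (g ⁻¹) x)))
          (sym (·-lookup h S (act (g ⁻¹) x))))

  ·-invˡ : ∀ g S → g ⁻¹ · g · S ≡ S
  ·-invˡ g S = trans (sym (·-∙ (g ⁻¹) g S)) (trans (·-cong (inverseˡ g) S) (·-ε S))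

  ·-invʳ : ∀ g S → g · g ⁻¹ · S ≡ S
  ·-invʳ g S = trans (sym (·-∙ g (g ⁻¹) S)) (trans (·-cong (inverseʳ g) S) (·-ε S))

  ·-fix : ∀ {g S} → g · S ≡ S → g ⁻¹ · S ≡ S
  ·-fix {g} {S} p = trans (cong (g ⁻¹ ·_) (sym p)) (·-invˡ g S)

  SameOrbit : Subset n → Subset n → Set
  SameOrbit S T = ∃ λ g → g · S ≡ T

  sameOrbit? : Decidable₂ SameOrbit
  sameOrbit? S T = map′ Any.satisfied
    (λ { (g , p) → Any.map (λ g≈h → trans (sym (·-cong g≈h S)) p) (complete g) })
    (Any.any? (λ g → Vec.≡-dec Bool._≟_ (g · S) T) elements)

  stabilizer : Subset n → Subgroup W
  stabilizer S = record
    { Mem  = λ g → g · S ≡ S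
    ; mem? = λ g → Vec.≡-dec Bool._≟_ (g · S) S
    ; resp = λ g≈h p → trans (sym (·-cong g≈h S)) p
    ; ε∈   = ·-ε S
    ; ∙∈   = λ {g} {h} p q → trans (·-∙ g h S) (trans (cong (g ·_) q) p)
    ; ⁻¹∈  = ·-fix
    }

  restrict : (H : Subgroup W) → Action (Subgroup.finiteGroup H) n
  restrict H = record
    { act      = λ g → act (proj₁ g)
    ; act-cong = act-cong
    ; act-ε    = act-ε
    ; act-∙    = λ g h → act-∙ (proj₁ g) (proj₁ h)
    }

  permOf : FiniteGroup.Carrier W → Permutation′ n
  permOf g = permutation (act g) (act (g ⁻¹)) (act-invʳ g) (act-invˡ g)

  ∣·∣ : ∀ g S → ∣ g · S ∣ ≡ ∣ S ∣
  ∣·∣ g S = trans (size-tabulate (λ x → lookup S (act (g ⁻¹) x)))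
    (trans (sym (Σℕ.sum-permute (bit ∘ lookup S) (permOf (g ⁻¹))))
    (trans (sym (size-tabulate (lookup S))) (cong ∣_∣ (Vec.tabulate∘lookup S))))

-- An action on the ground set, extended in some way to all of Fin n; the points
-- outside the ground set carry no condition.
record MatroidAction (W : FiniteGroup) (M : Matroid n) : Set where
  open FiniteGroup W using (Carrier)
  open Matroid M
  field
    action : Action W n
  open Action action public
  field
    ground-invariant : ∀ g {x} → x ∈ ground → act g x ∈ ground
    basis-invariant  : ∀ g {B} → IsBasis B → IsBasis (g · B)

module _ {W : FiniteGroup} (M : Matroid n) (a : Action W n) where
  open FiniteGroup W using (Carrier; _⁻¹)
  open Matroid M
  open Action a

  IndepInvariant : Set
  IndepInvariant = ∀ g {I} → Indep I → Indep (g · I)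

  basisOf-image : IndepInvariant → ∀ g {S B} → IsBasisOf S B → IsBasisOf (g · S) (g · B)
  basisOf-image inv g {S} {B} b = record
    { indep   = inv g b.indep
    ; subset  = ·-mono g b.subset
    ; maximal = λ {x} x∈ ind → ∈·⁺ g (b.maximal (∈·⁻ g x∈)
        (heredity (back x) (inv (g ⁻¹) ind)))
    }
    where
    module b = IsBasisOf b
    back : ∀ x → B ∪ ⁅ act (g ⁻¹) x ⁆ ⊆ g ⁻¹ · (g · B ∪ ⁅ x ⁆)
    back x = ∪-lub
      (λ {y} y∈B → subst (_∈ g ⁻¹ · (g · B ∪ ⁅ x ⁆)) (act-invˡ g y)
        (act-∈· (g ⁻¹) (p⊆p∪q ⁅ x ⁆ (act-∈· g y∈B))))
      (⁅⁆⊆ (act-∈· (g ⁻¹) (q⊆p∪q (g · B) ⁅ x ⁆ (x∈⁅x⁆ x))))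

  invariant⇒fixed : ∀ {S} → (∀ g {x} → x ∈ S → act g x ∈ S) → ∀ g → g · S ≡ S
  invariant⇒fixed {S} inv g = ⊆-antisym
    (λ {x} x∈ → subst (_∈ S) (act-invʳ g x) (inv g (∈·⁻ g x∈)))
    (λ x∈ → ∈·⁺ g (inv (g ⁻¹) x∈))

  fromIndep : (∀ g {x} → x ∈ ground → act g x ∈ ground) → IndepInvariant → MatroidAction W M
  fromIndep ginv inv = record
    { action           = a
    ; ground-invariant = ginv
    ; basis-invariant  = λ g {B} b →
        subst (λ E → IsBasisOf E (g · B)) (invariant⇒fixed ginv g) (basisOf-image inv g b)
    }

indepInvariant : {W : FiniteGroup} {M : Matroid n} (a : MatroidAction W M) →
                 IndepInvariant M (MatroidAction.action a)
indepInvariant {M = M} a g ind with B , I⊆B , b ← Matroid.extend M ind (Matroid.⊆ground M ind) =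
  Matroid.heredity M (MatroidAction.·-mono a g I⊆B)
    (Matroid.IsBasisOf.indep (MatroidAction.basis-invariant a g b))

infixl 6 _/ᴬ_
_/ᴬ_ : {W : FiniteGroup} {M : Matroid n} (a : MatroidAction W M) (F : Subset n) →
       MatroidAction (Subgroup.finiteGroup (MatroidAction.stabilizer a F)) (M / F)
_/ᴬ_ {W = W} {M} a F = fromIndep (M / F) (restrict (stabilizer F)) ginv inv
  where
  open FiniteGroup W using (_⁻¹)
  open Matroid M
  open MatroidAction a
  ginv : ∀ g {x} → x ∈ ground ─ F → act (proj₁ g) x ∈ ground ─ F
  ginv (g , gF≡F) {x} x∈ = x∈p∧x∉q⇒x∈p─q (ground-invariant g (p─q⊆p ground F x∈))
    (λ gx∈F → x∈p─q⇒x∉q ground F x∈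
      (subst (_∈ F) (act-invˡ g x) (∈·⁻ g (subst (act g x ∈_) (sym gF≡F) gx∈F))))
  inv : IndepInvariant (M / F) (restrict (stabilizer F))
  inv (g , gF≡F) {I} (I⊆ , J , b , ind) =
    (λ {x} x∈ → subst (_∈ ground ─ F) (act-invʳ g x) (ginv (g , gF≡F) (I⊆ (∈·⁻ g x∈)))) ,
    g · J ,
    subst (λ S → IsBasisOf S (g · J)) gF≡F (basisOf-image M action (indepInvariant a) g b) ,
    heredity (∪-lub (·-mono g {I} {I ∪ J} (p⊆p∪q J)) (·-mono g {J} {I ∪ J} (q⊆p∪q I J))) (indepInvariant a g ind)

-- deduplicate keeps one flat of each orbit; another choice would give isomorphic
-- summands in Z-formula.
nonemptyFlatOrbits : {W : FiniteGroup} {M : Matroid n} → MatroidAction W M → List (Subset n)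
nonemptyFlatOrbits {n} {M = M} a =
  deduplicate (MatroidAction.sameOrbit? a) (filter (λ F → isFlat? F ×-dec nonempty? F) (subsets n))
  where open Matroid M

Assignment : Set₁
Assignment = ∀ {n} (M : Matroid n) (W : FiniteGroup) → MatroidAction W M → grVRep W

-- In Z-formula the flat ∅ of the loopless matroid M is split off: it is an orbit
-- by itself, M/∅ = M and W_∅ = W, so its summand is P_M^W.  Writing that summand
-- through _/_ and stabilizer would give an isomorphic but not identical triple.
record KLConditions (P Z : Assignment) {n} {M : Matroid n} {W : FiniteGroup} (a : MatroidAction W M) : Set where
  open Matroid M
  open MatroidAction a
  field
    P-loop        : HasLoop → P M W a ≈ᵍ 0ᵍ
    P-rank-0      : Loopless → rk ≡ 0 → P M W a ≈ᵍ 1ᵍ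
    Z-rank-0      : Loopless → rk ≡ 0 → Z M W a ≈ᵍ 1ᵍ
    P-degree      : Loopless → 0 < rk → ∀ i → rk ≤ 2 ℕ.* i → coeff (P M W a) i ≈ᵛ 0ᵛ
    Z-formula     : Loopless → Z M W a ≈ᵍ
      P M W a +ᵍ sumᵍ (List.map
        (λ F → x^ rank F · indᵍ (stabilizer F) (P (M / F) (Subgroup.finiteGroup (stabilizer F)) (a /ᴬ F)))
        (nonemptyFlatOrbits a))
    Z-palindromic : Loopless → PalindromicOfDegree rk (Z M W a)

record EquivariantKL : Set₁ where
  field
    P Z        : Assignment
    conditions : ∀ {n} {M : Matroid n} {W : FiniteGroup} (a : MatroidAction W M) → KLConditions P Z a

-- 𝔖_S, as the permutations of Fin n that fix every point outside S.
record SymElement (S : Subset n) : Set where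
  constructor _,_
  field
    perm  : Permutation′ n
    fixes : ∀ x → x ∉ S → perm ⟨$⟩ʳ x ≡ x

  preserves : x ∈ S → perm ⟨$⟩ʳ x ∈ S
  preserves {x} x∈S with (perm ⟨$⟩ʳ x) ∈? S
  ... | yes p = p
  ... | no ¬p = contradiction (subst (_∈ S) (sym σx≡x) x∈S) ¬p
    where
    σx≡x : perm ⟨$⟩ʳ x ≡ x
    σx≡x = trans (sym (Perm.inverseˡ perm))
                 (trans (cong (perm ⟨$⟩ˡ_) (fixes _ ¬p)) (Perm.inverseˡ perm))

module SymEnumeration (S : Subset n) where

  functions : ∀ m → List (Vec (Fin n) m)
  functions zero    = [] ∷ []
  functions (suc m) = cartesianProductWith _∷_ (allFin n) (functions m)

  functions-complete : ∀ {m} (v : Vec (Fin n) m) → v ∈ₗ functions m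
  functions-complete []      = here refl
  functions-complete (x ∷ v) =
    Membershipₚ.∈-cartesianProductWith⁺ _∷_ (Membershipₚ.∈-allFin x) (functions-complete v)

  Valid : Vec (Fin n) n × Vec (Fin n) n → Set
  Valid (v , w) = (∀ i → lookup v (lookup w i) ≡ i) × (∀ i → lookup w (lookup v i) ≡ i)
                × (∀ i → i ∉ S → lookup v i ≡ i)

  valid? : Decidable Valid
  valid? (v , w) = Fin.all? (λ i → lookup v (lookup w i) Fin.≟ i)
             ×-dec Fin.all? (λ i → lookup w (lookup v i) Fin.≟ i)
             ×-dec Fin.all? (λ i → ¬? (i ∈? S) →-dec (lookup v i Fin.≟ i))

  toElement : ∀ {p} → Valid p → SymElement S
  toElement {v , w} (l , r , f) = permutation (lookup v) (lookup w) l r , f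

  elementsFrom : List (Vec (Fin n) n × Vec (Fin n) n) → List (SymElement S)
  elementsFrom []       = []
  elementsFrom (p ∷ ps) with valid? p
  ... | yes ok = toElement {p} ok ∷ elementsFrom ps
  ... | no  _  = elementsFrom ps

  elements : List (SymElement S)
  elements = elementsFrom (cartesianProduct (functions n) (functions n))

  _≈_ : SymElement S → SymElement S → Set
  (σ , _) ≈ (τ , _) = σ Perm.≈ τ

  complete : ∀ σ → Any.Any (σ ≈_) elements
  complete (σ , f) = find (Membershipₚ.∈-cartesianProduct⁺ (functions-complete v) (functions-complete w))
    where
    v w : Vec (Fin n) n
    v = tabulate (σ ⟨$⟩ʳ_)
    w = tabulate (σ ⟨$⟩ˡ_)
    ok : Valid (v , w)
    v-lookup : ∀ i → lookup v i ≡ σ ⟨$⟩ʳ i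
    v-lookup = Vec.lookup∘tabulate (σ ⟨$⟩ʳ_)
    w-lookup : ∀ i → lookup w i ≡ σ ⟨$⟩ˡ i
    w-lookup = Vec.lookup∘tabulate (σ ⟨$⟩ˡ_)
    ok = (λ i → trans (v-lookup (lookup w i)) (trans (cong (σ ⟨$⟩ʳ_) (w-lookup i)) (Perm.inverseʳ σ)))
       , (λ i → trans (w-lookup (lookup v i)) (trans (cong (σ ⟨$⟩ˡ_) (v-lookup i)) (Perm.inverseˡ σ)))
       , (λ i i∉S → trans (v-lookup i) (f i i∉S))
    find : ∀ {ps} → (v , w) ∈ₗ ps → Any.Any ((σ , f) ≈_) (elementsFrom ps)
    find {p ∷ ps} q with valid? p
    find {p ∷ ps} (here refl) | yes _  = here (λ i → sym (v-lookup i))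
    find {p ∷ ps} (here refl) | no ¬ok = contradiction ok ¬ok
    find {p ∷ ps} (there q)   | yes _  = there (find q)
    find {p ∷ ps} (there q)   | no _   = find q

Sym : Subset n → FiniteGroup
Sym S = record
  { group = record
    { Carrier = SymElement S
    ; _≈_     = _≈_
    ; _∙_     = λ { (σ , f) (τ , g) → τ Perm.∘ₚ σ , λ x x∉S → trans (cong (σ ⟨$⟩ʳ_) (g x x∉S)) (f x x∉S) }
    ; ε       = Perm.id , λ _ _ → refl
    ; _⁻¹     = λ { (σ , f) → Perm.flip σ ,
                   λ x x∉S → trans (cong (σ ⟨$⟩ˡ_) (sym (f x x∉S))) (Perm.inverseˡ σ) }
    ; isGroup = record
      { isMonoid = record
        { isSemigroup = record
          { isMagma = record
            { isEquivalence = record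
              { refl  = λ _ → refl
              ; sym   = λ p x → sym (p x)
              ; trans = λ p q x → trans (p x) (q x)
              }
            ; ∙-cong = λ { {σ , _} {σ′ , _} {τ , _} {τ′ , _} p q x → trans (cong (σ ⟨$⟩ʳ_) (q x)) (p _) }
            }
          ; assoc = λ _ _ _ _ → refl
          }
        ; identity = (λ _ _ → refl) , (λ _ _ → refl)
        }
      ; inverse = (λ { (σ , _) x → Perm.inverseˡ σ }) , (λ { (σ , _) x → Perm.inverseʳ σ })
      ; ⁻¹-cong = λ { {σ , _} {τ , _} p x →
          trans (cong (σ ⟨$⟩ˡ_) (trans (sym (Perm.inverseʳ τ)) (sym (p _)))) (Perm.inverseˡ σ) }
      }
    }
  ; _≟_      = λ { (σ , _) (τ , _) → Fin.all? (λ i → (σ ⟨$⟩ʳ i) Fin.≟ (τ ⟨$⟩ʳ i)) }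
  ; elements = elements
  ; complete = complete
  }
  where open SymEnumeration S

symAction : (S : Subset n) → Action (Sym S) n
symAction S = record
  { act      = λ σ x → SymElement.perm σ ⟨$⟩ʳ x
  ; act-cong = λ p → p
  ; act-ε    = λ _ → refl
  ; act-∙    = λ _ _ _ → refl
  }

sym×symAction : (S T : Subset n) → (∀ x → x ∈ S → x ∉ T) → Action (Sym S ×ᴳ Sym T) n
sym×symAction S T disjoint = record
  { act      = λ { (σ , τ) x → perm σ ⟨$⟩ʳ (perm τ ⟨$⟩ʳ x) }
  ; act-cong = λ { {σ , τ} {σ′ , τ′} (p , q) x → trans (cong (perm σ ⟨$⟩ʳ_) (q x)) (p _) }
  ; act-ε    = λ _ → refl
  ; act-∙    = λ { (σ , τ) (σ′ , τ′) x → cong (perm σ ⟨$⟩ʳ_) (commute σ′ τ (perm τ′ ⟨$⟩ʳ x)) }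
  }
  where
  open SymElement
  commute : (σ : SymElement S) (τ : SymElement T) → ∀ x →
            perm σ ⟨$⟩ʳ (perm τ ⟨$⟩ʳ x) ≡ perm τ ⟨$⟩ʳ (perm σ ⟨$⟩ʳ x)
  commute σ τ x with x ∈? S
  ... | yes x∈S = trans (cong (perm σ ⟨$⟩ʳ_) (fixes τ x (disjoint x x∈S)))
                        (sym (fixes τ _ (disjoint _ (preserves σ x∈S))))
  ... | no x∉S with x ∈? T
  ...   | yes x∈T = trans (fixes σ _ (λ p → disjoint _ p (preserves τ x∈T)))
                          (cong (perm τ ⟨$⟩ʳ_) (sym (fixes σ x x∉S)))
  ...   | no x∉T  = trans (cong (perm σ ⟨$⟩ʳ_) (fixes τ x x∉T))
                          (trans (fixes σ x x∉S) (sym (trans (cong (perm τ ⟨$⟩ʳ_) (fixes σ x x∉S)) (fixes τ x x∉T))))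

sym-invariant : S ⊆ T → (σ : SymElement S) → x ∈ T → SymElement.perm σ ⟨$⟩ʳ x ∈ T
sym-invariant {S = S} {T} {x} S⊆T σ x∈T with x ∈? S
... | yes x∈S = S⊆T (SymElement.preserves σ x∈S)
... | no x∉S  = subst (_∈ T) (sym (SymElement.fixes σ x x∉S)) x∈T

uniformAction : {W : FiniteGroup} (a : Action W n) {S : Subset n} → (∀ g {x} → x ∈ S → Action.act a g x ∈ S) →
                ∀ r → MatroidAction W (uniform r S)
uniformAction a {S} inv r = fromIndep (uniform r S) a inv
  (λ g {I} (I⊆S , ∣I∣≤r) →
    (λ {x} x∈ → subst (_∈ S) (act-invʳ g x) (inv g (I⊆S (∈·⁻ g x∈)))) ,
    ℕ.≤-trans (ℕ.≤-reflexive (∣·∣ g I)) ∣I∣≤r)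
  where open Action a

symOnCycle : (S : Subset n) → MatroidAction (Sym S) C[ S ]
symOnCycle S = uniformAction (symAction S) SymElement.preserves (∣ S ∣ ∸ 1)

module Gluing (A B : Subset n) (e : Fin n) (2≤∣A∣ : 2 ≤ ∣ A ∣) (2≤∣B∣ : 2 ≤ ∣ B ∣)
              (A∩B≡e : A ∩ B ≡ ⁅ e ⁆) where

  E : Subset n
  E = A ∪ B

  circuits : List (Subset n)
  circuits = A ∷ B ∷ (E - e) ∷ []

  e∈A : e ∈ A
  e∈A = proj₁ (x∈p∩q⁻ A B (subst (e ∈_) (sym A∩B≡e) (x∈⁅x⁆ e)))

  e∈B : e ∈ B
  e∈B = proj₂ (x∈p∩q⁻ A B (subst (e ∈_) (sym A∩B≡e) (x∈⁅x⁆ e)))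

  A∩B⇒e : ∀ {x} → x ∈ A → x ∈ B → x ≡ e
  A∩B⇒e x∈A x∈B = x∈⁅y⁆⇒x≡y e (subst (_ ∈_) A∩B≡e (x∈p∩q⁺ (x∈A , x∈B)))

  ∈-e⁻ : ∀ {S x} → x ∈ S - e → x ≢ e
  ∈-e⁻ {S} p refl = x∈p─q⇒x∉q S ⁅ e ⁆ p (x∈⁅x⁆ e)

  -- The edge sets of the three cycles of the glued graph are its circuits, so the
  -- independent sets of its graphic matroid are the edge sets containing none of them.
  Independent : Pred (Subset n) 0ℓ
  Independent I = I ⊆ E × All (λ C → C ⊈ I) circuits

  ⊈-witness : ∀ {S T : Subset n} → S ⊈ T → ∃ λ x → x ∈ S × x ∉ T
  ⊈-witness {S} {T} ¬p with Fin.any? (λ x → (x ∈? S) ×-dec ¬? (x ∈? T))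
  ... | yes w   = w
  ... | no none = contradiction (λ {x} x∈S → decidable-stable (x ∈? T) (λ x∉T → none (x , x∈S , x∉T))) ¬p

  circuit-⊆E : ∀ {C} → C ∈ₗ circuits → C ⊆ E
  circuit-⊆E (here refl)                 = p⊆p∪q B
  circuit-⊆E (there (here refl))         = q⊆p∪q A B
  circuit-⊆E (there (there (here refl))) = p─q⊆p E ⁅ e ⁆

  cover-e : ∀ {S} → e ∈ S → E ⊆ S ∪ (E - e)
  cover-e {S} e∈S {x} x∈E with x Fin.≟ e
  ... | yes refl = p⊆p∪q (E - e) e∈S
  ... | no x≢e   = q⊆p∪q S (E - e) (x∈p∧x≢y⇒x∈p-y x∈E x≢e)

  swap : ∀ {S T : Subset n} → E ⊆ S ∪ T → E ⊆ T ∪ S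
  swap {S} {T} p x∈E = subst (_ ∈_) (∪-comm S T) (p x∈E)

  cover : ∀ {C D} → C ∈ₗ circuits → D ∈ₗ circuits → C ≡ D ⊎ E ⊆ C ∪ D
  cover (here refl) (here refl)                                 = inj₁ refl
  cover (here refl) (there (here refl))                         = inj₂ (λ p → p)
  cover (here refl) (there (there (here refl)))                 = inj₂ (cover-e e∈A)
  cover (there (here refl)) (here refl)                         = inj₂ (swap {A} {B} (λ p → p))
  cover (there (here refl)) (there (here refl))                 = inj₁ refl
  cover (there (here refl)) (there (there (here refl)))         = inj₂ (cover-e e∈B)
  cover (there (there (here refl))) (here refl)                 = inj₂ (swap {A} (cover-e e∈A))
  cover (there (there (here refl))) (there (here refl))         = inj₂ (swap {B} (cover-e e∈B))
  cover (there (there (here refl))) (there (there (here refl))) = inj₁ refl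

  independent? : Decidable Independent
  independent? I = (I ⊆? E) ×-dec All.all? (λ C → ¬? (C ⊆? I)) circuits

  independent-⊥ : Independent ⊥
  independent-⊥ = ⊥⊆ , (λ p → ∉⊥ (p e∈A)) ∷ (λ p → ∉⊥ (p e∈B)) ∷ third ∷ []
    where
    third : E - e ⊈ ⊥
    third p with ∃-∈-∉ ⁅ e ⁆ A (subst (_< ∣ A ∣) (sym (∣⁅x⁆∣≡1 e)) 2≤∣A∣)
    ... | x , x∈A , x∉e = ∉⊥ (p (x∈p∧x∉q⇒x∈p─q (p⊆p∪q B x∈A) x∉e))

  dependent⇒circuit : ∀ {I x} → x ∈ E → I ⊆ E → ¬ Independent (I ∪ ⁅ x ⁆) →
                      ∃ λ C → C ∈ₗ circuits × C ⊆ I ∪ ⁅ x ⁆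
  dependent⇒circuit {I} {x} x∈E I⊆E ¬ind with Any.any? (λ C → C ⊆? I ∪ ⁅ x ⁆) circuits
  ... | yes p = MembershipP.find p
  ... | no ¬p = contradiction (∪-lub I⊆E (⁅⁆⊆ x∈E) , Allₚ.¬Any⇒All¬ circuits ¬p) ¬ind

  ∪⁅⁆⁻ : ∀ {I : Subset n} {x y} → x ∈ I ∪ ⁅ y ⁆ → x ∉ I → x ≡ y
  ∪⁅⁆⁻ {I} {y = y} p x∉I with x∈p∪q⁻ I ⁅ y ⁆ p
  ... | inj₁ q = contradiction q x∉I
  ... | inj₂ q = x∈⁅y⁆⇒x≡y y q

  remove< : ∀ {I : Subset n} {x k} → x ∈ I → ∣ I ∣ ≤ suc k → ∣ I - x ∣ ≤ k
  remove< x∈I p = ℕ.≤-pred (ℕ.≤-trans (x∈p⇒∣p-x∣<∣p∣ x∈I) p)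

  independent-augment : ∀ {I J} → Independent I → Independent J → ∣ I ∣ < ∣ J ∣ →
                        ∃ λ x → x ∈ J × x ∉ I × Independent (I ∪ ⁅ x ⁆)
  independent-augment {I} {J} (I⊆E , cI) (J⊆E , cJ) I<J
    with Fin.any? (λ x → (x ∈? J) ×-dec ¬? (x ∈? I) ×-dec independent? (I ∪ ⁅ x ⁆))
  ... | yes found = found
  ... | no none = contradiction two-missing (ℕ.<⇒≱ I<J)
    where
    circuit-at : ∀ x → x ∈ J → x ∉ I → ∃ λ C → C ∈ₗ circuits × C ⊆ I ∪ ⁅ x ⁆
    circuit-at x x∈J x∉I = dependent⇒circuit (J⊆E x∈J) I⊆E (λ ind → none (x , x∈J , x∉I , ind))

    -- J gains only x and y over I, and omits two elements p, q of I
    bound : ∀ x y p q → (∀ {z} → z ∈ E → z ∉ I → z ≡ x ⊎ z ≡ y) →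
            p ∈ I → p ∉ J → q ∈ I → q ∉ J → q ≢ p → ∣ J ∣ ≤ ∣ I ∣
    bound x y p q gain p∈I p∉J q∈I q∉J q≢p = begin
      ∣ J ∣                               ≤⟨ p⊆q⇒∣p∣≤∣q∣ J⊆ ⟩
      ∣ (I - p - q) ∪ ⁅ x ⁆ ∪ ⁅ y ⁆ ∣     ≡⟨ cong ∣_∣ (sym (∪-assoc (I - p - q) ⁅ x ⁆ ⁅ y ⁆)) ⟩
      ∣ ((I - p - q) ∪ ⁅ x ⁆) ∪ ⁅ y ⁆ ∣   ≤⟨ ∣∪⁅⁆∣≤ ((I - p - q) ∪ ⁅ x ⁆) y ⟩
      suc ∣ (I - p - q) ∪ ⁅ x ⁆ ∣         ≤⟨ s≤s (∣∪⁅⁆∣≤ (I - p - q) x) ⟩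
      suc (suc ∣ I - p - q ∣)             ≤⟨ s≤s (x∈p⇒∣p-x∣<∣p∣ (x∈p∧x≢y⇒x∈p-y q∈I q≢p)) ⟩
      suc ∣ I - p ∣                       ≤⟨ x∈p⇒∣p-x∣<∣p∣ p∈I ⟩
      ∣ I ∣                               ∎
      where
      open ℕ.≤-Reasoning
      J⊆ : J ⊆ (I - p - q) ∪ ⁅ x ⁆ ∪ ⁅ y ⁆
      J⊆ {z} z∈J with z ∈? I
      ... | yes z∈I = x∈p∪q⁺ (inj₁ (x∈p∧x≢y⇒x∈p-y (x∈p∧x≢y⇒x∈p-y z∈I
                        (λ { refl → p∉J z∈J })) (λ { refl → q∉J z∈J })))
      ... | no z∉I with gain (J⊆E z∈J) z∉I
      ...   | inj₁ refl = x∈p∪q⁺ (inj₂ (x∈p∪q⁺ (inj₁ (x∈⁅x⁆ z))))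
      ...   | inj₂ refl = x∈p∪q⁺ (inj₂ (x∈p∪q⁺ (inj₂ (x∈⁅x⁆ z))))

    two-missing : ∣ J ∣ ≤ ∣ I ∣
    two-missing
      with x , x∈J , x∉I ← ∃-∈-∉ I J I<J
      with C , C∈ , C⊆ ← circuit-at x x∈J x∉I
      with p , p∈C , p∉J ← ⊈-witness (All.lookup cJ C∈)
      with p∈I ← decidable-stable (p ∈? I) (λ p∉I → p∉J (subst (_∈ J) (sym (∪⁅⁆⁻ {I} (C⊆ p∈C) p∉I)) x∈J))
      with y , y∈J , y∉ ← ∃-∈-∉ ((I - p) ∪ ⁅ x ⁆) J
             (ℕ.≤-<-trans (ℕ.≤-trans (∣∪⁅⁆∣≤ (I - p) x) (x∈p⇒∣p-x∣<∣p∣ p∈I)) I<J)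
      with y∉I ← (λ (y∈I : y ∈ I) → y∉ (p⊆p∪q ⁅ x ⁆ (x∈p∧x≢y⇒x∈p-y y∈I (λ { refl → p∉J y∈J }))))
      with D , D∈ , D⊆ ← circuit-at y y∈J y∉I
      with cover C∈ D∈
    ... | inj₁ refl = contradiction
      (λ {z} z∈C → decidable-stable (z ∈? I) (λ z∉I → y∉ (q⊆p∪q (I - p) ⁅ x ⁆
        (subst (_∈ ⁅ x ⁆) (trans (sym (∪⁅⁆⁻ {I} (C⊆ z∈C) z∉I)) (∪⁅⁆⁻ {I} (D⊆ z∈C) z∉I)) (x∈⁅x⁆ x)))))
      (All.lookup cI C∈)
    ... | inj₂ E⊆C∪D = choose
      where
      gain : ∀ {z} → z ∈ E → z ∉ I → z ≡ x ⊎ z ≡ y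
      gain z∈E z∉I with x∈p∪q⁻ C D (E⊆C∪D z∈E)
      ... | inj₁ z∈C = inj₁ (∪⁅⁆⁻ {I} (C⊆ z∈C) z∉I)
      ... | inj₂ z∈D = inj₂ (∪⁅⁆⁻ {I} (D⊆ z∈D) z∉I)
      in-I : ∀ {z} → z ∈ E → z ∉ J → z ∈ I
      in-I {z} z∈E z∉J = decidable-stable (z ∈? I) λ z∉I → z∉J
        ([ (λ { refl → x∈J }) , (λ { refl → y∈J }) ]′ (gain z∈E z∉I))
      missing : ∀ {K} → K ∈ₗ circuits → ∃ λ z → z ∈ K × z ∈ I × z ∉ J
      missing K∈ with z , z∈K , z∉J ← ⊈-witness (All.lookup cJ K∈) =
        z , z∈K , in-I (circuit-⊆E K∈ z∈K) z∉J , z∉J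
      choose : ∣ J ∣ ≤ ∣ I ∣
      choose with a , a∈A , a∈I , a∉J ← missing (here refl)
             with b , b∈B , b∈I , b∉J ← missing (there (here refl))
             with c , c∈E-e , c∈I , c∉J ← missing (there (there (here refl)))
             with a Fin.≟ p | b Fin.≟ p | c Fin.≟ p
      ... | no a≢p   | _        | _        = bound x y p a gain p∈I p∉J a∈I a∉J a≢p
      ... | yes _    | no b≢p   | _        = bound x y p b gain p∈I p∉J b∈I b∉J b≢p
      ... | yes _    | yes _    | no c≢p   = bound x y p c gain p∈I p∉J c∈I c∉J c≢p
      ... | yes refl | yes refl | yes refl = contradiction (A∩B⇒e a∈A b∈B) (∈-e⁻ {E} c∈E-e)

  C⟨A,B⟩ : Matroid n
  C⟨A,B⟩ = record
    { ground   = E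
    ; Indep    = Independent
    ; indep?   = independent?
    ; ⊆ground  = λ { (p , _) → p }
    ; empty    = independent-⊥
    ; heredity = λ I⊆J (p , q) → (λ x∈I → p (I⊆J x∈I)) , All.map (λ C⊈J C⊆I → C⊈J (λ x∈C → I⊆J (C⊆I x∈C))) q
    ; augment  = independent-augment
    }

  W : FiniteGroup
  W = Sym (A - e) ×ᴳ Sym (B - e)

  W-action : Action W n
  W-action = sym×symAction (A - e) (B - e) λ x x∈A-e x∈B-e →
    ∈-e⁻ {A} x∈A-e (A∩B⇒e (p─q⊆p A ⁅ e ⁆ x∈A-e) (p─q⊆p B ⁅ e ⁆ x∈B-e))

  open Action W-action

  Invariant : Pred (Subset n) 0ℓ
  Invariant S = ∀ g {x} → x ∈ S → act g x ∈ S

  A-invariant : Invariant A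
  A-invariant (σ , τ) {x} x∈A = subst (λ z → SymElement.perm σ ⟨$⟩ʳ z ∈ A)
    (sym (SymElement.fixes τ x (λ x∈B-e → ∈-e⁻ {B} x∈B-e (A∩B⇒e x∈A (p─q⊆p B ⁅ e ⁆ x∈B-e)))))
    (sym-invariant (p─q⊆p A ⁅ e ⁆) σ x∈A)

  B-invariant : Invariant B
  B-invariant (σ , τ) x∈B = subst (_∈ B) (sym (SymElement.fixes σ _
      (λ y∈A-e → ∈-e⁻ {A} y∈A-e (A∩B⇒e (p─q⊆p A ⁅ e ⁆ y∈A-e) τx∈B))))
    τx∈B
    where τx∈B = sym-invariant (p─q⊆p B ⁅ e ⁆) τ x∈B

  E-invariant : Invariant E
  E-invariant g x∈E = [ (λ p → x∈p∪q⁺ (inj₁ (A-invariant g p))) , (λ p → x∈p∪q⁺ (inj₂ (B-invariant g p))) ]′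
                      (x∈p∪q⁻ A B x∈E)

  -e-mono : ∀ {S T} → S ⊆ T → S - e ⊆ T - e
  -e-mono {S} S⊆T x∈ = x∈p∧x≢y⇒x∈p-y (S⊆T (p─q⊆p S ⁅ e ⁆ x∈)) (∈-e⁻ {S} x∈)

  E-e-invariant : Invariant (E - e)
  E-e-invariant (σ , τ) x∈ = sym-invariant (-e-mono (p⊆p∪q B)) σ (sym-invariant (-e-mono (q⊆p∪q A B)) τ x∈)

  W-on-C[E-e] : MatroidAction W C[ E - e ]
  W-on-C[E-e] = uniformAction W-action E-e-invariant (∣ E - e ∣ ∸ 1)

  W-on-C⟨A,B⟩ : MatroidAction W C⟨A,B⟩
  W-on-C⟨A,B⟩ = fromIndep C⟨A,B⟩ W-action E-invariant λ { g (I⊆E , cA ∷ cB ∷ cE ∷ []) →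
    (λ {x} x∈ → subst (_∈ E) (act-invʳ g x) (E-invariant g (I⊆E (∈·⁻ g x∈)))) ,
    still A-invariant g cA ∷ still B-invariant g cB ∷ still E-e-invariant g cE ∷ [] }
    where
    still : ∀ {C I} → Invariant C → ∀ g → C ⊈ I → C ⊈ g · I
    still {I = I} inv g C⊈I C⊆gI = C⊈I (λ {x} x∈C → subst (_∈ I) (act-invˡ g x) (∈·⁻ g (C⊆gI (inv g x∈C))))

-- Over ℚ a virtual representation is determined by its character: if V ≠ 0 and U have equal characters,
-- the trace of the averaging idempotent on Hom(V , U) equals that on End(V), which is nonzero, so there is
-- a nonzero intertwiner, and by Maschke's theorem its image splits off both V and U.  It therefore suffices
-- to compare the polynomials evaluated at one group element g.  There the sum over orbits of induced
-- representations becomes Z_M = Σ x^{rk F} P_{M/F} over the subsets F fixed by g, and P is multiplicative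
-- on direct sums.
--
-- Let M = C_{A,B}, N = C_{E∖e}, and pair the subsets F and F ∪ e of E with e ∉ F.  If F contains neither
-- A∖e nor B∖e, then M/F is again of the form C_{A′,B′}, M/(F ∪ e) is the direct sum of the two cycles left
-- of A∖e and B∖e, and by induction the two terms add up to the term of F in Z_N (for F ≠ ∅).  Otherwise e
-- is a loop of M/F, while M/(F ∪ e) = N/F with the same rank.  So Z_M − Z_N = P_M + x P_{A∖e} P_{B∖e} − P_N,
-- which is palindromic of degree rk M but has degree less than rk M / 2, hence vanishes.

module Submission where

open import Level using (0ℓ)
import Algebra.Properties.Group as GroupProperties
import Data.Bool.Properties as Bool
open import Data.Fin.Base using (Fin; zero; suc; toℕ; opposite; splitAt; join; _↑ˡ_; _↑ʳ_; combine; remQuot)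
import Data.Fin.Properties as Fin
open import Data.Fin.Permutation as Perm using (permutation; _⟨$⟩ʳ_)
open import Data.Fin.Subset
open import Data.Fin.Subset.Properties
open import Data.List.Base as List using (List; []; _∷_; deduplicate; filter; length)
import Data.List.Extrema.Nat as Extrema
open import Data.List.Membership.Propositional using () renaming (_∈_ to _∈ₗ_)
import Data.List.Membership.Propositional.Properties as Membershipₚ
import Data.List.Membership.Setoid.Properties as MembershipSₚ
open import Data.List.Relation.Unary.All as All using ([]; _∷_)
import Data.List.Relation.Unary.All.Properties as Allₚ
open import Data.List.Relation.Unary.AllPairs using (_∷_)
open import Data.List.Relation.Unary.Any as Any using (here)
import Data.List.Relation.Unary.Any.Properties as Anyₚ
import Data.List.Relation.Unary.Enumerates.Setoid.Properties as Enumerates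
import Data.List.Relation.Unary.Unique.Setoid as UniqueS
import Data.List.Relation.Unary.Unique.DecSetoid.Properties as UniqueDS
open import Data.Nat.Base as ℕ using (ℕ; zero; suc; _≤_; _<_; z≤n; s≤s)
import Data.Nat.Properties as ℕ
import Data.Nat.Solver
open import Data.Product.Base using (∃; _×_; _,_; proj₁; proj₂)
open import Data.Rational.Base as ℚ using (ℚ; 0ℚ; 1ℚ)
import Data.Rational.Properties as ℚₚ
open import Data.Rational.Solver using (module +-*-Solver)
open import Data.Sum.Base using (_⊎_; inj₁; inj₂; [_,_]′)
open import Data.Vec.Base using ([]; _∷_; lookup)
import Data.Vec.Properties as Vec
open import Function.Base using (_∘_)
open import Relation.Binary.Bundles using (Setoid; DecSetoid)
open import Relation.Binary.PropositionalEquality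
  using (_≡_; _≢_; refl; sym; trans; cong; cong₂; subst; subst₂; module ≡-Reasoning)
import Relation.Binary.Reasoning.Setoid as SetoidReasoning
open import Relation.Nullary using (¬_; Dec; yes; no; contradiction)
open import Relation.Nullary.Decidable using (¬?; _×-dec_; decidable-stable)
open import Defs

-- Linear algebra over ℚ

-- Evaluating characters has a second use: at one group element only the permutation that it induces
-- on the ground set is visible, so matroids with actions of different groups (stabilizers,
-- conjugates, the two factors of `W`) become comparable. But `P` is only some assignment subject to
-- the conditions, and these do not say that isomorphic matroids receive equal values. Invariance
-- under isomorphism is therefore proved by the scheme that also gives multiplicativity and the
-- theorem: by induction, two palindromic polynomials of degree r agree in all terms except those at
-- the empty set, and what remains has degree less than r/2. The correction term just passes this
-- bound. If r₁ and r₂ are the ranks of the cycles on `A - e` and `B - e`, then r = r₁ + r₂ + 1, and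
-- the two strict bounds give degree at most 1 + (r₁ - 1)/2 + (r₂ - 1)/2 = (r₁ + r₂)/2. If |A| = 2,
-- the cycle on `A - e` is a loop and the correction term is zero. Over ℚ an irreducible
-- representation can have endomorphisms other than scalars, so traces do not give multiplicities
-- directly; what a nonzero trace does detect is a nonzero intertwiner.

sum-δ : ∀ {n} (f : Fin n → ℚ) j → Σℚ.sum (λ l → f l ℚ.* δ l j) ≡ f j
sum-δ f j = trans
  (sum-single _ j (λ l l≢j → trans (cong (f l ℚ.*_) (δ-≢ l≢j)) (ℚR.zeroʳ (f l))))
  (trans (cong (f j ℚ.*_) (δ-refl j)) (ℚR.*-identityʳ (f j)))

-- A record, so that the two matrices can be inferred from a proof of their equality.
infix 4 _≐_
record _≐_ {m n} (A B : Matrix m n) : Set where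
  constructor mk
  field
    at : A ≋ B
open _≐_

matrixSetoid : ℕ → ℕ → Setoid _ _
matrixSetoid m n = record
  { Carrier = Matrix m n
  ; _≈_ = _≐_
  ; isEquivalence = record
    { refl  = mk λ i j → refl
    ; sym   = λ p → mk λ i j → sym (at p i j)
    ; trans = λ p q → mk λ i j → trans (at p i j) (at q i j)
    }
  }

module ≐ {m n} = Setoid (matrixSetoid m n)
module ≐-Reasoning {m n} = SetoidReasoning (matrixSetoid m n)

private
  variable
    m n k l : ℕ

·-cong : {A A′ : Matrix m n} {B B′ : Matrix n k} → A ≐ A′ → B ≐ B′ → A ⊠ B ≐ A′ ⊠ B′
·-cong {A = A} {A′} {B} {B′} p q = mk (⊠-cong {A = A} {A′} {B} {B′} (at p) (at q))

·-congˡ : (A : Matrix m n) {B B′ : Matrix n k} → B ≐ B′ → A ⊠ B ≐ A ⊠ B′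
·-congˡ A {B} {B′} q = ·-cong {A = A} {A} {B} {B′} ≐.refl q

·-congʳ : {A A′ : Matrix m n} (B : Matrix n k) → A ≐ A′ → A ⊠ B ≐ A′ ⊠ B
·-congʳ {A = A} {A′} B p = ·-cong {A = A} {A′} {B} {B} p ≐.refl

·-idˡ : (A : Matrix m n) → 𝟙 m ⊠ A ≐ A
·-idˡ A = mk (⊠-identityˡ A)

·-idʳ : (A : Matrix m n) → A ⊠ 𝟙 n ≐ A
·-idʳ A = mk (λ i j → sum-δ (A i) j)

·-assoc : (A : Matrix m n) (B : Matrix n k) (C : Matrix k l) → (A ⊠ B) ⊠ C ≐ A ⊠ (B ⊠ C)
·-assoc A B C = mk λ i j → begin
  Σℚ.sum (λ b → Σℚ.sum (λ a → A i a ℚ.* B a b) ℚ.* C b j)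
    ≡⟨ Σℚ.sum-cong-≗ (λ b → Σℚ.*-distribʳ-sum (C b j) (λ a → A i a ℚ.* B a b)) ⟩
  Σℚ.sum (λ b → Σℚ.sum (λ a → A i a ℚ.* B a b ℚ.* C b j))
    ≡⟨ Σℚ.∑-comm (λ b a → A i a ℚ.* B a b ℚ.* C b j) ⟩
  Σℚ.sum (λ a → Σℚ.sum (λ b → A i a ℚ.* B a b ℚ.* C b j))
    ≡⟨ Σℚ.sum-cong-≗ (λ a → Σℚ.sum-cong-≗ (λ b → ℚR.*-assoc (A i a) (B a b) (C b j))) ⟩
  Σℚ.sum (λ a → Σℚ.sum (λ b → A i a ℚ.* (B a b ℚ.* C b j)))
    ≡⟨ Σℚ.sum-cong-≗ (λ a → Σℚ.*-distribˡ-sum (A i a) (λ b → B a b ℚ.* C b j)) ⟨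
  Σℚ.sum (λ a → A i a ℚ.* Σℚ.sum (λ b → B a b ℚ.* C b j)) ∎
  where open ≡-Reasoning

-- Rank factorization by Gaussian elimination

-- Here `r` is the rank of `A`. The one-sided inverses express that `B` is injective and `C`
-- surjective, so images and kernels are handled by matrix identities instead of subspaces.
record RankFactorization (A : Matrix m n) : Set where
  field
    r      : ℕ
    B      : Matrix m r
    C      : Matrix r n
    B⁻     : Matrix r m
    C⁻     : Matrix n r
    factor : A ≐ B ⊠ C
    left   : B⁻ ⊠ B ≐ 𝟙 r
    right  : C ⊠ C⁻ ≐ 𝟙 r

  B⁻A≐C : B⁻ ⊠ A ≐ C
  B⁻A≐C = begin
    B⁻ ⊠ A       ≈⟨ ·-congˡ B⁻ factor ⟩
    B⁻ ⊠ (B ⊠ C) ≈⟨ ·-assoc B⁻ B C ⟨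
    (B⁻ ⊠ B) ⊠ C ≈⟨ ·-congʳ C left ⟩
    𝟙 r ⊠ C      ≈⟨ ·-idˡ C ⟩
    C            ∎
    where open ≐-Reasoning

  AC⁻≐B : A ⊠ C⁻ ≐ B
  AC⁻≐B = begin
    A ⊠ C⁻       ≈⟨ ·-congʳ C⁻ factor ⟩
    (B ⊠ C) ⊠ C⁻ ≈⟨ ·-assoc B C C⁻ ⟩
    B ⊠ (C ⊠ C⁻) ≈⟨ ·-congˡ B right ⟩
    B ⊠ 𝟙 r      ≈⟨ ·-idʳ B ⟩
    B            ∎
    where open ≐-Reasoning

abstract
  inverse-of : ∀ {q} → q ≢ 0ℚ → ∃ λ c → q ℚ.* c ≡ 1ℚ
  inverse-of {q} q≢0 = ℚ.1/_ q {{nz}} , ℚₚ.*-inverseʳ q {{nz}}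
    where
    nz : ℚ.NonZero q
    nz = ℚ.≢-nonZero q≢0

+0*-sum : ∀ {m} x (f : Fin m → ℚ) → x ℚ.+ Σℚ.sum (λ i → 0ℚ ℚ.* f i) ≡ x
+0*-sum x f = trans (cong (x ℚ.+_) (sum-zero _ (λ i → ℚR.zeroˡ (f i)))) (ℚR.+-identityʳ x)

-- One elimination step with the top row `v`. A zero row leaves the rank unchanged; otherwise an
-- invertible entry `v j₀` clears column `j₀` in the remaining rows and the rank grows by one.
module Pivot {m n} (A : Matrix (suc m) n) where

  v : Fin n → ℚ
  v = A zero

  zero-row : (∀ j → v j ≡ 0ℚ) → RankFactorization (A ∘ suc) → RankFactorization A
  zero-row v≡0 F = record
    { r      = F.r
    ; B      = B
    ; C      = F.C
    ; B⁻     = B⁻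
    ; C⁻     = F.C⁻
    ; factor = mk λ where
        zero    j → trans (v≡0 j) (sym (sum-zero _ (λ l → ℚR.zeroˡ (F.C l j))))
        (suc i) j → at F.factor i j
    ; left   = mk λ i j → trans (ℚR.+-identityˡ _) (at F.left i j)
    ; right  = F.right
    }
    where
    module F = RankFactorization F
    B : Matrix (suc m) F.r
    B zero    _ = 0ℚ
    B (suc i) k = F.B i k
    B⁻ : Matrix F.r (suc m)
    B⁻ k zero    = 0ℚ
    B⁻ k (suc i) = F.B⁻ k i

  module _ (j₀ : Fin n) (c : ℚ) (inv : v j₀ ℚ.* c ≡ 1ℚ) where

    w : Fin m → ℚ
    w i = A (suc i) j₀ ℚ.* c

    reduced : Matrix m n
    reduced i j = A (suc i) j ℚ.- w i ℚ.* v j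

    reduced-j₀ : ∀ i → reduced i j₀ ≡ 0ℚ
    reduced-j₀ i = begin
      a ℚ.- a ℚ.* c ℚ.* v j₀   ≡⟨ solve 3 (λ a c v → a :- a :* c :* v := a :* (con 1ℚ :- v :* c)) refl a c (v j₀) ⟩
      a ℚ.* (1ℚ ℚ.- v j₀ ℚ.* c) ≡⟨ cong (λ z → a ℚ.* (1ℚ ℚ.- z)) inv ⟩
      a ℚ.* (1ℚ ℚ.- 1ℚ)         ≡⟨ ℚR.zeroʳ a ⟩
      0ℚ                        ∎
      where
      open ≡-Reasoning
      open +-*-Solver
      a = A (suc i) j₀

    pivot-row : RankFactorization reduced → RankFactorization A
    pivot-row F = record
      { r      = suc F.r
      ; B      = B
      ; C      = C
      ; B⁻     = B⁻
      ; C⁻     = C⁻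
      ; factor = mk λ where
          zero    j → sym (trans (+0*-sum (1ℚ ℚ.* v j) (λ l → F.C l j)) (ℚR.*-identityˡ (v j)))
          (suc i) j → sym (trans (cong (w i ℚ.* v j ℚ.+_) (sym (at F.factor i j)))
            (solve 2 (λ a x → x :+ (a :- x) := a) refl (A (suc i) j) (w i ℚ.* v j)))
      ; left   = mk left
      ; right  = mk right
      }
      where
      open +-*-Solver
      module F = RankFactorization F
      B : Matrix (suc m) (suc F.r)
      B zero    zero    = 1ℚ
      B zero    (suc k) = 0ℚ
      B (suc i) zero    = w i
      B (suc i) (suc k) = F.B i k
      C : Matrix (suc F.r) n
      C zero    j = v j
      C (suc k) j = F.C k j
      -- `B` is block triangular with rows (1, 0) and (`w`, `F.B`), so a left inverse has the rows
      -- (1, 0) and (-`F.B⁻` `w`, `F.B⁻`).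
      B⁻w : Fin F.r → ℚ
      B⁻w k = Σℚ.sum (λ i → F.B⁻ k i ℚ.* w i)
      B⁻ : Matrix (suc F.r) (suc m)
      B⁻ zero    zero    = 1ℚ
      B⁻ zero    (suc i) = 0ℚ
      B⁻ (suc k) zero    = ℚ.- B⁻w k
      B⁻ (suc k) (suc i) = F.B⁻ k i
      vC⁻ : Fin F.r → ℚ
      vC⁻ k = Σℚ.sum (λ l → v l ℚ.* F.C⁻ l k)
      -- Column zero is `c` times the unit vector at `j₀`, which pairs to 1 with `v`. The other
      -- columns are those of `F.C⁻`, corrected by a multiple of that unit vector so that `v`
      -- annihilates them. Neither change is seen by `F.C`, whose column `j₀` is zero because the
      -- column was cleared (`C-j₀`).
      C⁻ : Matrix n (suc F.r)
      C⁻ l zero    = δ l j₀ ℚ.* c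
      C⁻ l (suc k) = F.C⁻ l k ℚ.+ ℚ.- (c ℚ.* vC⁻ k) ℚ.* δ l j₀

      left : B⁻ ⊠ B ≋ 𝟙 (suc F.r)
      left zero    zero    = +0*-sum (1ℚ ℚ.* 1ℚ) w
      left zero    (suc j) = +0*-sum (1ℚ ℚ.* 0ℚ) (λ i → F.B i j)
      left (suc i) zero    = solve 1 (λ x → :- x :* con 1ℚ :+ x := con 0ℚ) refl (B⁻w i)
      left (suc i) (suc j) = trans (cong (ℚ._+ (F.B⁻ ⊠ F.B) i j) (ℚR.zeroʳ (ℚ.- B⁻w i)))
        (trans (ℚR.+-identityˡ _) (at F.left i j))

      C-j₀ : ∀ k → F.C k j₀ ≡ 0ℚ
      C-j₀ k = trans (sym (at F.B⁻A≐C k j₀))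
        (sum-zero _ (λ i → trans (cong (F.B⁻ k i ℚ.*_) (reduced-j₀ i)) (ℚR.zeroʳ (F.B⁻ k i))))

      pairing-zero : (u : Fin n → ℚ) → Σℚ.sum (λ l → u l ℚ.* C⁻ l zero) ≡ u j₀ ℚ.* c
      pairing-zero u = trans
        (Σℚ.sum-cong-≗ (λ l → solve 3 (λ u d c → u :* (d :* c) := u :* c :* d) refl (u l) (δ l j₀) c))
        (sum-δ (λ l → u l ℚ.* c) j₀)

      pairing-suc : (u : Fin n → ℚ) (k : Fin F.r) → Σℚ.sum (λ l → u l ℚ.* C⁻ l (suc k)) ≡
                    Σℚ.sum (λ l → u l ℚ.* F.C⁻ l k) ℚ.+ u j₀ ℚ.* ℚ.- (c ℚ.* vC⁻ k)
      pairing-suc u k = trans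
        (Σℚ.sum-cong-≗ (λ l → solve 4 (λ u a s d → u :* (a :+ s :* d) := u :* a :+ (u :* s) :* d) refl
          (u l) (F.C⁻ l k) (ℚ.- (c ℚ.* vC⁻ k)) (δ l j₀)))
        (trans (Σℚ.∑-distrib-+ (λ l → u l ℚ.* F.C⁻ l k) (λ l → (u l ℚ.* ℚ.- (c ℚ.* vC⁻ k)) ℚ.* δ l j₀))
          (cong (Σℚ.sum (λ l → u l ℚ.* F.C⁻ l k) ℚ.+_) (sum-δ (λ l → u l ℚ.* ℚ.- (c ℚ.* vC⁻ k)) j₀)))

      right : C ⊠ C⁻ ≋ 𝟙 (suc F.r)
      right zero    zero    = trans (pairing-zero v) inv
      right zero    (suc k) = trans (pairing-suc v k)
        (trans (solve 3 (λ x v c → x :+ v :* (:- (c :* x)) := x :* (con 1ℚ :- v :* c)) refl (vC⁻ k) (v j₀) c)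
          (trans (cong (λ z → vC⁻ k ℚ.* (1ℚ ℚ.- z)) inv) (ℚR.zeroʳ (vC⁻ k))))
      right (suc i) zero    = trans (pairing-zero (F.C i))
        (trans (cong (ℚ._* c) (C-j₀ i)) (ℚR.zeroˡ c))
      right (suc i) (suc j) = trans (pairing-suc (F.C i) j)
        (trans (cong (λ z → (F.C ⊠ F.C⁻) i j ℚ.+ z ℚ.* ℚ.- (c ℚ.* vC⁻ j)) (C-j₀ i))
          (trans (cong ((F.C ⊠ F.C⁻) i j ℚ.+_) (ℚR.zeroˡ (ℚ.- (c ℚ.* vC⁻ j))))
            (trans (ℚR.+-identityʳ _) (at F.right i j))))

abstract
  rankFactorization : (A : Matrix m n) → RankFactorization A
  rankFactorization {zero}  A = record
    { r = 0 ; B = λ () ; C = λ () ; B⁻ = λ () ; C⁻ = λ _ ()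
    ; factor = mk λ () ; left = mk λ () ; right = mk λ () }
  rankFactorization {suc m} A with Fin.any? (λ j → ¬? (A zero j ℚₚ.≟ 0ℚ))
  ... | no none = Pivot.zero-row A (λ j → decidable-stable (A zero j ℚₚ.≟ 0ℚ) (λ ≢0 → none (j , ≢0)))
                    (rankFactorization (A ∘ suc))
  ... | yes (j , ≢0) = Pivot.pivot-row A j (proj₁ (inverse-of ≢0)) (proj₂ (inverse-of ≢0)) (rankFactorization _)

module ℚ+ = GroupProperties ℚR.+-group

-- Averaging and Maschke's theorem

tr : Matrix n n → ℚ
tr A = Σℚ.sum (λ i → A i i)

tr-cong : {A B : Matrix n n} → A ≐ B → tr A ≡ tr B
tr-cong p = Σℚ.sum-cong-≗ (λ i → at p i i)

tr-comm : (A : Matrix m n) (B : Matrix n m) → tr (A ⊠ B) ≡ tr (B ⊠ A)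
tr-comm A B = trans (Σℚ.∑-comm (λ i j → A i j ℚ.* B j i))
  (Σℚ.sum-cong-≗ (λ j → Σℚ.sum-cong-≗ (λ i → ℚR.*-comm (A i j) (B j i))))

-- The image of `n` in ℚ, in the form in which the trace of the identity matrix produces it.
size : ℕ → ℚ
size n = Σℚ.sum {n} (λ _ → 1ℚ)

tr-𝟙 : ∀ n → tr (𝟙 n) ≡ size n
tr-𝟙 n = Σℚ.sum-cong-≗ (δ-refl {n})

0≤size : ∀ n → 0ℚ ℚ.≤ size n
0≤size zero    = ℚₚ.≤-refl
0≤size (suc n) = ℚₚ.≤-trans (ℚₚ.≤-reflexive (sym (ℚR.+-identityˡ 0ℚ))) (ℚₚ.+-mono-≤ (ℚₚ.nonNegative⁻¹ 1ℚ) (0≤size n))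

size-suc≢0 : ∀ n → size (suc n) ≢ 0ℚ
size-suc≢0 n p = ℚₚ.<⇒≢ (ℚₚ.<-≤-trans (ℚₚ.positive⁻¹ 1ℚ)
  (ℚₚ.≤-trans (ℚₚ.≤-reflexive (sym (ℚR.+-identityʳ 1ℚ))) (ℚₚ.+-monoʳ-≤ 1ℚ (0≤size n)))) (sym p)

size-injective : ∀ m n → size m ≡ size n → m ≡ n
size-injective zero    zero    p = refl
size-injective zero    (suc n) p = contradiction (sym p) (size-suc≢0 n)
size-injective (suc m) zero    p = contradiction p (size-suc≢0 m)
size-injective (suc m) (suc n) p = cong suc (size-injective m n (ℚ+.∙-cancelˡ 1ℚ (size m) (size n) p))

size-+ : ∀ m n → size (m ℕ.+ n) ≡ size m ℚ.+ size n
size-+ zero    n = sym (ℚR.+-identityˡ (size n))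
size-+ (suc m) n = trans (cong (1ℚ ℚ.+_) (size-+ m n)) (sym (ℚR.+-assoc 1ℚ (size m) (size n)))

infixl 6 _⊞_ _⊟_
_⊞_ _⊟_ : Matrix m n → Matrix m n → Matrix m n
(A ⊞ B) i j = A i j ℚ.+ B i j
(A ⊟ B) i j = A i j ℚ.- B i j

⊞-cong : {A A′ B B′ : Matrix m n} → A ≐ A′ → B ≐ B′ → A ⊞ B ≐ A′ ⊞ B′
⊞-cong p q = mk λ i j → cong₂ ℚ._+_ (at p i j) (at q i j)

⊟-cong : {A A′ B B′ : Matrix m n} → A ≐ A′ → B ≐ B′ → A ⊟ B ≐ A′ ⊟ B′
⊟-cong p q = mk λ i j → cong₂ ℚ._-_ (at p i j) (at q i j)

⊠-distribˡ-⊞ : (A : Matrix m n) (B C : Matrix n k) → A ⊠ (B ⊞ C) ≐ A ⊠ B ⊞ A ⊠ C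
⊠-distribˡ-⊞ A B C = mk λ i j → trans
  (Σℚ.sum-cong-≗ (λ l → ℚR.distribˡ (A i l) (B l j) (C l j)))
  (Σℚ.∑-distrib-+ (λ l → A i l ℚ.* B l j) (λ l → A i l ℚ.* C l j))

⊠-distribʳ-⊞ : (A : Matrix n k) (B C : Matrix m n) → (B ⊞ C) ⊠ A ≐ B ⊠ A ⊞ C ⊠ A
⊠-distribʳ-⊞ A B C = mk λ i j → trans
  (Σℚ.sum-cong-≗ (λ l → ℚR.distribʳ (A l j) (B i l) (C i l)))
  (Σℚ.∑-distrib-+ (λ l → B i l ℚ.* A l j) (λ l → C i l ℚ.* A l j))

⊞-⊟ : (A B : Matrix m n) → (A ⊟ B) ⊞ B ≐ A
⊞-⊟ A B = mk λ i j → solve 2 (λ a b → a :- b :+ b := a) refl (A i j) (B i j)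
  where open +-*-Solver

⊟-unique : {A B C : Matrix m n} → A ⊞ B ≐ C → A ≐ C ⊟ B
⊟-unique {A = A} {B} p = mk λ i j → trans
  (solve 2 (λ a b → a := a :+ b :- b) refl (A i j) (B i j)) (cong (ℚ._- B i j) (at p i j))
  where open +-*-Solver

⊠-distribˡ-⊟ : (A : Matrix m n) (B C : Matrix n k) → A ⊠ (B ⊟ C) ≐ A ⊠ B ⊟ A ⊠ C
⊠-distribˡ-⊟ A B C = ⊟-unique (≐.trans (≐.sym (⊠-distribˡ-⊞ A (B ⊟ C) C)) (·-congˡ A (⊞-⊟ B C)))

⊠-distribʳ-⊟ : (A : Matrix n k) (B C : Matrix m n) → (B ⊟ C) ⊠ A ≐ B ⊠ A ⊟ C ⊠ A
⊠-distribʳ-⊟ A B C = ⊟-unique (≐.trans (≐.sym (⊠-distribʳ-⊞ A (B ⊟ C) C)) (·-congʳ A (⊞-⊟ B C)))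

⊟-self : {A B : Matrix m n} → A ≐ B → A ⊟ B ≐ 𝟘 m n
⊟-self {A = A} {B} p = mk λ i j → trans (cong (ℚ._- B i j) (at p i j)) (ℚR.-‿inverseʳ (B i j))

⊟-𝟘 : {A B : Matrix m n} → B ≐ 𝟘 m n → A ⊟ B ≐ A
⊟-𝟘 {A = A} {B} p = mk λ i j → trans (cong (λ z → A i j ℚ.- z) (at p i j)) (ℚR.+-identityʳ (A i j))

⊠-𝟘ˡ : (A : Matrix n k) → 𝟘 m n ⊠ A ≐ 𝟘 m k
⊠-𝟘ˡ A = mk λ i j → sum-zero _ (λ l → ℚR.zeroˡ (A l j))

⊠-𝟘ʳ : (A : Matrix m n) → A ⊠ 𝟘 n k ≐ 𝟘 m k
⊠-𝟘ʳ A = mk λ i j → sum-zero _ (λ l → ℚR.zeroʳ (A i l))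

tr-⊞ : (A B : Matrix n n) → tr (A ⊞ B) ≡ tr A ℚ.+ tr B
tr-⊞ A B = Σℚ.∑-distrib-+ (λ i → A i i) (λ i → B i i)

module Idempotent (P : Matrix n n) (idem : P ⊠ P ≐ P) where
  open RankFactorization (rankFactorization P) public

  -- From P² = P one gets B(CB)C = BC; `B` cancels on the left and `C` on the right.
  CB≐𝟙 : C ⊠ B ≐ 𝟙 r
  CB≐𝟙 = begin
    C ⊠ B               ≈⟨ ·-cong (≐.sym B⁻A≐C) (≐.sym AC⁻≐B) ⟩
    (B⁻ ⊠ P) ⊠ (P ⊠ C⁻) ≈⟨ ·-assoc B⁻ P (P ⊠ C⁻) ⟩
    B⁻ ⊠ (P ⊠ (P ⊠ C⁻)) ≈⟨ ·-congˡ B⁻ (·-assoc P P C⁻) ⟨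
    B⁻ ⊠ ((P ⊠ P) ⊠ C⁻) ≈⟨ ·-congˡ B⁻ (·-congʳ C⁻ idem) ⟩
    B⁻ ⊠ (P ⊠ C⁻)       ≈⟨ ·-congˡ B⁻ AC⁻≐B ⟩
    B⁻ ⊠ B              ≈⟨ left ⟩
    𝟙 r                 ∎
    where open ≐-Reasoning

  -- The trace of an idempotent is its rank: tr(BC) = tr(CB), and CB is the identity.
  tr≡size : tr P ≡ size r
  tr≡size = trans (tr-cong factor) (trans (tr-comm B C) (trans (tr-cong CB≐𝟙) (tr-𝟙 r)))

rank-0 : {A : Matrix m n} (F : RankFactorization A) → RankFactorization.r F ≡ 0 → A ≐ 𝟘 m n
rank-0 record { r = .0 ; factor = factor } refl = factor

lookup-injective : (S : DecSetoid 0ℓ 0ℓ) → let open DecSetoid S in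
                   ∀ {xs} → UniqueS.Unique setoid xs → ∀ i j → List.lookup xs i ≈ List.lookup xs j → i ≡ j
lookup-injective S (_ ∷ _)  zero    zero    _ = refl
lookup-injective S (x∉ ∷ _) zero    (suc j) p = contradiction p (All.lookup x∉ (Membershipₚ.∈-lookup j))
lookup-injective S (x∉ ∷ _) (suc i) zero    p =
  contradiction (DecSetoid.sym S p) (All.lookup x∉ (Membershipₚ.∈-lookup i))
lookup-injective S (_ ∷ u)  (suc i) (suc j) p = cong suc (lookup-injective S u i j p)

module Average (W : FiniteGroup) where
  open FiniteGroup W renaming (refl to ≈-refl; sym to ≈-sym; trans to ≈-trans)

  decSetoid : DecSetoid 0ℓ 0ℓ
  decSetoid = record { isDecEquivalence = record { isEquivalence = isEquivalence ; _≟_ = _≟_ } }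

  -- `elements` may list a group element several times. Without repetitions, left translation is a
  -- permutation of the indices, as averaging requires.
  members : List Carrier
  members = deduplicate _≟_ elements

  order : ℕ
  order = length members

  el : Fin order → Carrier
  el = List.lookup members

  locate : ∀ g → ∃ λ i → g ≈ el i
  locate g = Any.index g∈ , Anyₚ.lookup-index g∈
    where g∈ = Enumerates.deduplicate⁺ decSetoid complete g

  el-injective : ∀ i j → el i ≈ el j → i ≡ j
  el-injective = lookup-injective decSetoid (UniqueDS.deduplicate-! decSetoid elements)

  translate : Carrier → Fin order → Fin order
  translate h i = proj₁ (locate (h ∙ el i))

  el-translate : ∀ h i → h ∙ el i ≈ el (translate h i)
  el-translate h i = proj₂ (locate (h ∙ el i))

  translate-inverse : ∀ {h h′} → h ∙ h′ ≈ ε → ∀ i → translate h (translate h′ i) ≡ i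
  translate-inverse {h} {h′} p i = el-injective _ _ (begin
    el (translate h (translate h′ i)) ≈⟨ el-translate h (translate h′ i) ⟨
    h ∙ el (translate h′ i)           ≈⟨ ∙-congˡ (el-translate h′ i) ⟨
    h ∙ (h′ ∙ el i)                   ≈⟨ assoc h h′ (el i) ⟨
    (h ∙ h′) ∙ el i                   ≈⟨ ∙-congʳ p ⟩
    ε ∙ el i                          ≈⟨ identityˡ (el i) ⟩
    el i                              ∎)
    where open SetoidReasoning setoid

  sum-translate : (f : Carrier → ℚ) → (∀ {g h} → g ≈ h → f g ≡ f h) → ∀ h →
                  Σℚ.sum (λ i → f (h ∙ el i)) ≡ Σℚ.sum (λ i → f (el i))
  sum-translate f f-cong h = trans (Σℚ.sum-cong-≗ (λ i → f-cong (el-translate h i)))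
    (sym (Σℚ.sum-permute (λ i → f (el i)) (permutation (translate h) (translate (h ⁻¹))
      (translate-inverse (inverseʳ h)) (translate-inverse (inverseˡ h)))))

  order≢0 : size order ≢ 0ℚ
  order≢0 = go order refl
    where
    go : ∀ k → order ≡ k → size order ≢ 0ℚ
    go zero    p _ with () ← subst Fin p (proj₁ (locate ε))
    go (suc k) p q = size-suc≢0 k (trans (cong size (sym p)) q)

  1/order : ℚ
  1/order = proj₁ (inverse-of order≢0)

  mean : (Fin order → Matrix m n) → Matrix m n
  mean F i j = 1/order ℚ.* Σℚ.sum (λ x → F x i j)

  mean-cong : {F G : Fin order → Matrix m n} → (∀ x → F x ≐ G x) → mean F ≐ mean G
  mean-cong p = mk λ i j → cong (1/order ℚ.*_) (Σℚ.sum-cong-≗ (λ x → at (p x) i j))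

  mean-const : (A : Matrix m n) → mean (λ _ → A) ≐ A
  mean-const A = mk λ i j → begin
    1/order ℚ.* Σℚ.sum {order} (λ _ → A i j)
      ≡⟨ cong (1/order ℚ.*_) (Σℚ.sum-cong-≗ {order} (λ _ → sym (ℚR.*-identityˡ (A i j)))) ⟩
    1/order ℚ.* Σℚ.sum {order} (λ _ → 1ℚ ℚ.* A i j)
      ≡⟨ cong (1/order ℚ.*_) (Σℚ.*-distribʳ-sum {order} (A i j) (λ _ → 1ℚ)) ⟨
    1/order ℚ.* (size order ℚ.* A i j)
      ≡⟨ solve 3 (λ c s a → c :* (s :* a) := (s :* c) :* a) refl 1/order (size order) (A i j) ⟩
    size order ℚ.* 1/order ℚ.* A i j ≡⟨ cong (ℚ._* A i j) (proj₂ (inverse-of order≢0)) ⟩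
    1ℚ ℚ.* A i j                     ≡⟨ ℚR.*-identityˡ (A i j) ⟩
    A i j                            ∎
    where
    open ≡-Reasoning
    open +-*-Solver

  mean-⊠ˡ : (A : Matrix k m) (F : Fin order → Matrix m n) → A ⊠ mean F ≐ mean (λ x → A ⊠ F x)
  mean-⊠ˡ A F = mk λ i j → begin
    Σℚ.sum (λ l → A i l ℚ.* (1/order ℚ.* Σℚ.sum (λ x → F x l j)))
      ≡⟨ Σℚ.sum-cong-≗ (λ l → trans
           (solve 3 (λ a c s → a :* (c :* s) := c :* (a :* s)) refl (A i l) 1/order (Σℚ.sum (λ x → F x l j)))
           (cong (1/order ℚ.*_) (Σℚ.*-distribˡ-sum (A i l) (λ x → F x l j)))) ⟩
    Σℚ.sum (λ l → 1/order ℚ.* Σℚ.sum (λ x → A i l ℚ.* F x l j))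
      ≡⟨ Σℚ.*-distribˡ-sum 1/order (λ l → Σℚ.sum (λ x → A i l ℚ.* F x l j)) ⟨
    1/order ℚ.* Σℚ.sum (λ l → Σℚ.sum (λ x → A i l ℚ.* F x l j))
      ≡⟨ cong (1/order ℚ.*_) (Σℚ.∑-comm (λ l x → A i l ℚ.* F x l j)) ⟩
    1/order ℚ.* Σℚ.sum (λ x → Σℚ.sum (λ l → A i l ℚ.* F x l j)) ∎
    where
    open ≡-Reasoning
    open +-*-Solver

  mean-⊠ʳ : (A : Matrix n k) (F : Fin order → Matrix m n) → mean F ⊠ A ≐ mean (λ x → F x ⊠ A)
  mean-⊠ʳ A F = mk λ i j → begin
    Σℚ.sum (λ l → (1/order ℚ.* Σℚ.sum (λ x → F x i l)) ℚ.* A l j)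
      ≡⟨ Σℚ.sum-cong-≗ (λ l → trans (ℚR.*-assoc 1/order (Σℚ.sum (λ x → F x i l)) (A l j))
           (cong (1/order ℚ.*_) (Σℚ.*-distribʳ-sum (A l j) (λ x → F x i l)))) ⟩
    Σℚ.sum (λ l → 1/order ℚ.* Σℚ.sum (λ x → F x i l ℚ.* A l j))
      ≡⟨ Σℚ.*-distribˡ-sum 1/order (λ l → Σℚ.sum (λ x → F x i l ℚ.* A l j)) ⟨
    1/order ℚ.* Σℚ.sum (λ l → Σℚ.sum (λ x → F x i l ℚ.* A l j))
      ≡⟨ cong (1/order ℚ.*_) (Σℚ.∑-comm (λ l x → F x i l ℚ.* A l j)) ⟩
    1/order ℚ.* Σℚ.sum (λ x → Σℚ.sum (λ l → F x i l ℚ.* A l j)) ∎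
    where open ≡-Reasoning

  mean-translate : (F : Carrier → Matrix m n) → (∀ {g h} → g ≈ h → F g ≐ F h) → ∀ h →
                   mean (λ x → F (h ∙ el x)) ≐ mean (λ x → F (el x))
  mean-translate F F-cong h = mk λ i j →
    cong (1/order ℚ.*_) (sum-translate (λ g → F g i j) (λ p → at (F-cong p) i j) h)

  tr-mean : (F : Fin order → Matrix n n) → tr (mean F) ≡ 1/order ℚ.* Σℚ.sum (λ x → tr (F x))
  tr-mean F = trans (sym (Σℚ.*-distribˡ-sum 1/order (λ i → Σℚ.sum (λ x → F x i i))))
    (cong (1/order ℚ.*_) (Σℚ.∑-comm (λ i x → F x i i)))

module _ {W : FiniteGroup} where
  open FiniteGroup W using (Carrier; _∙_; ε) renaming (_≈_ to _≈ᵂ_)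
  open Rep

  Intertwiner : (V U : Rep W) → Matrix (dim U) (dim V) → Set
  Intertwiner V U f = ∀ g → f ⊠ ρ V g ≐ ρ U g ⊠ f

  ρ-cong≐ : ∀ (V : Rep W) {g h} → g ≈ᵂ h → ρ V g ≐ ρ V h
  ρ-cong≐ V p = mk (ρ-cong V p)

  ρ-inverse : ∀ (V : Rep W) g h → g ∙ h ≈ᵂ ε → ρ V g ⊠ ρ V h ≐ 𝟙 (dim V)
  ρ-inverse V g h p = mk λ i j → trans (sym (ρ-∙ V g h i j)) (trans (ρ-cong V p i j) (ρ-ε V i j))

  char : Rep W → Carrier → ℚ
  char V g = tr (ρ V g)

  char-cong : ∀ V {g h} → g ≈ᵂ h → char V g ≡ char V h
  char-cong V p = tr-cong (ρ-cong≐ V p)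

  char-ε : ∀ V → char V ε ≡ size (dim V)
  char-ε V = trans (tr-cong (mk (ρ-ε V))) (tr-𝟙 (dim V))

  char-≅ : ∀ {V U} → V ≅ U → ∀ g → char V g ≡ char U g
  char-≅ {V} {U} i g = begin
    tr (ρ V g)                ≡⟨ tr-cong (≐.sym (·-idˡ (ρ V g))) ⟩
    tr (𝟙 (dim V) ⊠ ρ V g)    ≡⟨ tr-cong (≐.sym (·-congʳ (ρ V g) (mk from-to))) ⟩
    tr ((from ⊠ to) ⊠ ρ V g)  ≡⟨ tr-cong (·-assoc from to (ρ V g)) ⟩
    tr (from ⊠ (to ⊠ ρ V g))  ≡⟨ tr-comm from (to ⊠ ρ V g) ⟩
    tr ((to ⊠ ρ V g) ⊠ from)  ≡⟨ tr-cong (·-congʳ from (mk (intertwine g))) ⟩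
    tr ((ρ U g ⊠ to) ⊠ from)  ≡⟨ tr-cong (·-assoc (ρ U g) to from) ⟩
    tr (ρ U g ⊠ (to ⊠ from))  ≡⟨ tr-cong (·-congˡ (ρ U g) (mk to-from)) ⟩
    tr (ρ U g ⊠ 𝟙 (dim U))    ≡⟨ tr-cong (·-idʳ (ρ U g)) ⟩
    tr (ρ U g)                ∎
    where
    open ≡-Reasoning
    open _≅_ i using (to; from; to-from; from-to; intertwine)

  -- The columns of `B` span a subspace of `V` onto which `B ⊠ C` projects. The hypothesis `BCρ`
  -- says that this subspace is stable under W, and `σ` is the action on it in the basis `B`.
  module Summand (V : Rep W) {r} (B : Matrix (dim V) r) (C : Matrix r (dim V)) (CB : C ⊠ B ≐ 𝟙 r)
                 (BCρ : ∀ g → B ⊠ (C ⊠ (ρ V g ⊠ B)) ≐ ρ V g ⊠ B) where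

    σ : Carrier → Matrix r r
    σ g = C ⊠ (ρ V g ⊠ B)

    summand : Rep W
    summand = record
      { dim    = r
      ; ρ      = σ
      ; ρ-cong = λ p → at (·-congˡ C (·-congʳ B (ρ-cong≐ V p)))
      ; ρ-ε    = at (≐.trans (·-congˡ C (≐.trans (·-congʳ B (mk (ρ-ε V))) (·-idˡ B))) CB)
      ; ρ-∙    = λ g h → at (begin
          C ⊠ (ρ V (g ∙ h) ⊠ B)                 ≈⟨ ·-congˡ C (·-congʳ B (mk (ρ-∙ V g h))) ⟩
          C ⊠ ((ρ V g ⊠ ρ V h) ⊠ B)             ≈⟨ ·-congˡ C (·-assoc (ρ V g) (ρ V h) B) ⟩
          C ⊠ (ρ V g ⊠ (ρ V h ⊠ B))             ≈⟨ ·-congˡ C (·-congˡ (ρ V g) (BCρ h)) ⟨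
          C ⊠ (ρ V g ⊠ (B ⊠ σ h))               ≈⟨ ·-congˡ C (·-assoc (ρ V g) B (σ h)) ⟨
          C ⊠ ((ρ V g ⊠ B) ⊠ σ h)               ≈⟨ ·-assoc C (ρ V g ⊠ B) (σ h) ⟨
          σ g ⊠ σ h                             ∎)
      }
      where open ≐-Reasoning

    B-intertwines : Intertwiner summand V B
    B-intertwines = BCρ

    C-intertwines : (∀ g → B ⊠ (C ⊠ ρ V g) ≐ (ρ V g ⊠ B) ⊠ C) → Intertwiner V summand C
    C-intertwines p g = begin
      C ⊠ ρ V g                 ≈⟨ ·-idˡ (C ⊠ ρ V g) ⟨
      𝟙 r ⊠ (C ⊠ ρ V g)         ≈⟨ ·-congʳ (C ⊠ ρ V g) CB ⟨
      (C ⊠ B) ⊠ (C ⊠ ρ V g)     ≈⟨ ·-assoc C B (C ⊠ ρ V g) ⟩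
      C ⊠ (B ⊠ (C ⊠ ρ V g))     ≈⟨ ·-congˡ C (p g) ⟩
      C ⊠ ((ρ V g ⊠ B) ⊠ C)     ≈⟨ ·-assoc C (ρ V g ⊠ B) C ⟨
      σ g ⊠ C                   ∎
      where open ≐-Reasoning

  record Complement (V I : Rep W) (ι : Matrix (dim V) (dim I)) (π : Matrix (dim I) (dim V)) : Set where
    field
      K  : Rep W
      B  : Matrix (dim V) (dim K)
      C  : Matrix (dim K) (dim V)
      B-intertwines : Intertwiner K V B
      C-intertwines : Intertwiner V K C
      CB : C ⊠ B ≐ 𝟙 (dim K)
      πB : π ⊠ B ≐ 𝟘 (dim I) (dim K)
      Cι : C ⊠ ι ≐ 𝟘 (dim K) (dim I)
      split : ι ⊠ π ⊞ B ⊠ C ≐ 𝟙 (dim V)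

  module _ {V I : Rep W} {ι : Matrix (dim V) (dim I)} {π : Matrix (dim I) (dim V)}
           (ι-int : Intertwiner I V ι) (π-int : Intertwiner V I π) (πι : π ⊠ ι ≐ 𝟙 (dim I)) where

    private
      p q : Matrix (dim V) (dim V)
      p = ι ⊠ π
      -- The projection onto the kernel of `π` along the image of `ι`. It commutes with the action
      -- because `ι` and `π` are equivariant, so its image is a subrepresentation.
      q = 𝟙 (dim V) ⊟ p

      πq : π ⊠ q ≐ 𝟘 (dim I) (dim V)
      πq = begin
        π ⊠ q                      ≈⟨ ⊠-distribˡ-⊟ π (𝟙 (dim V)) p ⟩
        π ⊠ 𝟙 (dim V) ⊟ π ⊠ p      ≈⟨ ⊟-self (begin
          π ⊠ 𝟙 (dim V)   ≈⟨ ·-idʳ π ⟩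
          π               ≈⟨ ·-idˡ π ⟨
          𝟙 (dim I) ⊠ π   ≈⟨ ·-congʳ π πι ⟨
          (π ⊠ ι) ⊠ π     ≈⟨ ·-assoc π ι π ⟩
          π ⊠ p           ∎) ⟩
        𝟘 (dim I) (dim V)          ∎
        where open ≐-Reasoning

      qι : q ⊠ ι ≐ 𝟘 (dim V) (dim I)
      qι = begin
        q ⊠ ι                      ≈⟨ ⊠-distribʳ-⊟ ι (𝟙 (dim V)) p ⟩
        𝟙 (dim V) ⊠ ι ⊟ p ⊠ ι      ≈⟨ ⊟-self (begin
          𝟙 (dim V) ⊠ ι   ≈⟨ ·-idˡ ι ⟩
          ι               ≈⟨ ·-idʳ ι ⟨
          ι ⊠ 𝟙 (dim I)   ≈⟨ ·-congˡ ι πι ⟨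
          ι ⊠ (π ⊠ ι)     ≈⟨ ·-assoc ι π ι ⟨
          p ⊠ ι           ∎) ⟩
        𝟘 (dim V) (dim I)          ∎
        where open ≐-Reasoning

      qq : q ⊠ q ≐ q
      qq = begin
        q ⊠ q                      ≈⟨ ⊠-distribʳ-⊟ q (𝟙 (dim V)) p ⟩
        𝟙 (dim V) ⊠ q ⊟ p ⊠ q      ≈⟨ ⊟-𝟘 (≐.trans (·-assoc ι π q) (≐.trans (·-congˡ ι πq) (⊠-𝟘ʳ ι))) ⟩
        𝟙 (dim V) ⊠ q              ≈⟨ ·-idˡ q ⟩
        q                          ∎
        where open ≐-Reasoning

      qρ : ∀ g → q ⊠ ρ V g ≐ ρ V g ⊠ q
      qρ g = begin
        q ⊠ ρ V g                            ≈⟨ ⊠-distribʳ-⊟ (ρ V g) (𝟙 (dim V)) p ⟩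
        𝟙 (dim V) ⊠ ρ V g ⊟ p ⊠ ρ V g        ≈⟨ ⊟-cong (≐.trans (·-idˡ (ρ V g)) (≐.sym (·-idʳ (ρ V g)))) (begin
          p ⊠ ρ V g        ≈⟨ ·-assoc ι π (ρ V g) ⟩
          ι ⊠ (π ⊠ ρ V g)  ≈⟨ ·-congˡ ι (π-int g) ⟩
          ι ⊠ (ρ I g ⊠ π)  ≈⟨ ·-assoc ι (ρ I g) π ⟨
          (ι ⊠ ρ I g) ⊠ π  ≈⟨ ·-congʳ π (ι-int g) ⟩
          (ρ V g ⊠ ι) ⊠ π  ≈⟨ ·-assoc (ρ V g) ι π ⟩
          ρ V g ⊠ p        ∎) ⟩
        ρ V g ⊠ 𝟙 (dim V) ⊟ ρ V g ⊠ p        ≈⟨ ⊠-distribˡ-⊟ (ρ V g) (𝟙 (dim V)) p ⟨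
        ρ V g ⊠ q                            ∎
        where open ≐-Reasoning

      open Idempotent q qq

      qB : q ⊠ B ≐ B
      qB = begin
        q ⊠ B        ≈⟨ ·-congʳ B factor ⟩
        (B ⊠ C) ⊠ B  ≈⟨ ·-assoc B C B ⟩
        B ⊠ (C ⊠ B)  ≈⟨ ·-congˡ B CB≐𝟙 ⟩
        B ⊠ 𝟙 r      ≈⟨ ·-idʳ B ⟩
        B            ∎
        where open ≐-Reasoning

      BCρB : ∀ g → B ⊠ (C ⊠ (ρ V g ⊠ B)) ≐ ρ V g ⊠ B
      BCρB g = begin
        B ⊠ (C ⊠ (ρ V g ⊠ B)) ≈⟨ ·-assoc B C (ρ V g ⊠ B) ⟨
        (B ⊠ C) ⊠ (ρ V g ⊠ B) ≈⟨ ·-congʳ (ρ V g ⊠ B) factor ⟨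
        q ⊠ (ρ V g ⊠ B)       ≈⟨ ·-assoc q (ρ V g) B ⟨
        (q ⊠ ρ V g) ⊠ B       ≈⟨ ·-congʳ B (qρ g) ⟩
        (ρ V g ⊠ q) ⊠ B       ≈⟨ ·-assoc (ρ V g) q B ⟩
        ρ V g ⊠ (q ⊠ B)       ≈⟨ ·-congˡ (ρ V g) qB ⟩
        ρ V g ⊠ B             ∎
        where open ≐-Reasoning

      BCρ : ∀ g → B ⊠ (C ⊠ ρ V g) ≐ (ρ V g ⊠ B) ⊠ C
      BCρ g = begin
        B ⊠ (C ⊠ ρ V g) ≈⟨ ·-assoc B C (ρ V g) ⟨
        (B ⊠ C) ⊠ ρ V g ≈⟨ ·-congʳ (ρ V g) factor ⟨
        q ⊠ ρ V g       ≈⟨ qρ g ⟩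
        ρ V g ⊠ q       ≈⟨ ·-congˡ (ρ V g) factor ⟩
        ρ V g ⊠ (B ⊠ C) ≈⟨ ·-assoc (ρ V g) B C ⟨
        (ρ V g ⊠ B) ⊠ C ∎
        where open ≐-Reasoning

      module S = Summand V B C CB≐𝟙 BCρB

    complement : Complement V I ι π
    complement = record
      { K  = S.summand
      ; B  = B
      ; C  = C
      ; B-intertwines = S.B-intertwines
      ; C-intertwines = S.C-intertwines BCρ
      ; CB = CB≐𝟙
      ; πB = begin
          π ⊠ B         ≈⟨ ·-congˡ π AC⁻≐B ⟨
          π ⊠ (q ⊠ C⁻)  ≈⟨ ·-assoc π q C⁻ ⟨
          (π ⊠ q) ⊠ C⁻  ≈⟨ ·-congʳ C⁻ πq ⟩
          𝟘 _ _ ⊠ C⁻    ≈⟨ ⊠-𝟘ˡ C⁻ ⟩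
          𝟘 _ _         ∎
      ; Cι = begin
          C ⊠ ι         ≈⟨ ·-congʳ ι B⁻A≐C ⟨
          (B⁻ ⊠ q) ⊠ ι  ≈⟨ ·-assoc B⁻ q ι ⟩
          B⁻ ⊠ (q ⊠ ι)  ≈⟨ ·-congˡ B⁻ qι ⟩
          B⁻ ⊠ 𝟘 _ _    ≈⟨ ⊠-𝟘ʳ B⁻ ⟩
          𝟘 _ _         ∎
      ; split = mk λ i j → trans (cong (p i j ℚ.+_) (sym (at factor i j)))
          (solve 2 (λ a b → a :+ (b :- a) := b) refl (p i j) (δ i j))
      }
      where
      open ≐-Reasoning
      open +-*-Solver

  char-complement : ∀ {V I ι π} (c : Complement V I ι π) → Intertwiner I V ι → π ⊠ ι ≐ 𝟙 (dim I) →
                    ∀ g → char V g ≡ char I g ℚ.+ char (Complement.K c) g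
  char-complement {V} {I} {ι} {π} c ι-int πι g = begin
    tr (ρ V g)                                       ≡⟨ tr-cong (≐.sym (·-idʳ (ρ V g))) ⟩
    tr (ρ V g ⊠ 𝟙 (dim V))                           ≡⟨ tr-cong (≐.sym (·-congˡ (ρ V g) split)) ⟩
    tr (ρ V g ⊠ (ι ⊠ π ⊞ B ⊠ C))                     ≡⟨ tr-cong (⊠-distribˡ-⊞ (ρ V g) (ι ⊠ π) (B ⊠ C)) ⟩
    tr (ρ V g ⊠ (ι ⊠ π) ⊞ ρ V g ⊠ (B ⊠ C))           ≡⟨ tr-⊞ (ρ V g ⊠ (ι ⊠ π)) (ρ V g ⊠ (B ⊠ C)) ⟩
    tr (ρ V g ⊠ (ι ⊠ π)) ℚ.+ tr (ρ V g ⊠ (B ⊠ C))    ≡⟨ cong₂ ℚ._+_ (part {I} ι-int πι) (part {K} B-intertwines CB) ⟩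
    tr (ρ I g) ℚ.+ tr (ρ K g)                        ∎
    where
    open ≡-Reasoning
    open Complement c
    part : ∀ {J : Rep W} {i p} → Intertwiner J V i → p ⊠ i ≐ 𝟙 (dim J) → tr (ρ V g ⊠ (i ⊠ p)) ≡ tr (ρ J g)
    part {J} {i} {p} i-int pi = begin
      tr (ρ V g ⊠ (i ⊠ p)) ≡⟨ tr-cong (≐.sym (·-assoc (ρ V g) i p)) ⟩
      tr ((ρ V g ⊠ i) ⊠ p) ≡⟨ tr-cong (·-congʳ p (≐.sym (i-int g))) ⟩
      tr ((i ⊠ ρ J g) ⊠ p) ≡⟨ tr-comm (i ⊠ ρ J g) p ⟩
      tr (p ⊠ (i ⊠ ρ J g)) ≡⟨ tr-cong (≐.sym (·-assoc p i (ρ J g))) ⟩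
      tr ((p ⊠ i) ⊠ ρ J g) ≡⟨ tr-cong (≐.trans (·-congʳ (ρ J g) pi) (·-idˡ (ρ J g))) ⟩
      tr (ρ J g)           ∎

  -- If V = I ⊕ K and U = I ⊕ L, then an isomorphism K ≅ L extends to V ≅ U.
  glue : ∀ {V U I : Rep W} {ιV πV ιU πU} (c : Complement V I ιV πV) (d : Complement U I ιU πU) →
         Intertwiner I U ιU → Intertwiner V I πV → πV ⊠ ιV ≐ 𝟙 (dim I) → πU ⊠ ιU ≐ 𝟙 (dim I) →
         Complement.K c ≅ Complement.K d → V ≅ U
  glue {V} {U} {I} {ιV} {πV} {ιU} {πU} c d ιU-int πV-int πιV πιU iso = record
    { to = t c d πV ιU iso.to
    ; from = t d c πU ιV iso.from
    ; to-from = at (inverse c d πιV iso.to iso.from (mk iso.to-from))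
    ; from-to = at (inverse d c πιU iso.from iso.to (mk iso.from-to))
    ; intertwine = λ g → at (begin
        (ιU ⊠ πV ⊞ d.B ⊠ (iso.to ⊠ c.C)) ⊠ ρ V g
          ≈⟨ ⊠-distribʳ-⊞ (ρ V g) (ιU ⊠ πV) (d.B ⊠ (iso.to ⊠ c.C)) ⟩
        (ιU ⊠ πV) ⊠ ρ V g ⊞ (d.B ⊠ (iso.to ⊠ c.C)) ⊠ ρ V g
          ≈⟨ ⊞-cong (compose V I U πV ιU πV-int ιU-int g)
                    (compose V d.K U (iso.to ⊠ c.C) d.B
                      (compose V c.K d.K c.C iso.to c.C-intertwines (λ h → mk (iso.intertwine h))) d.B-intertwines g) ⟩
        ρ U g ⊠ (ιU ⊠ πV) ⊞ ρ U g ⊠ (d.B ⊠ (iso.to ⊠ c.C))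
          ≈⟨ ⊠-distribˡ-⊞ (ρ U g) (ιU ⊠ πV) (d.B ⊠ (iso.to ⊠ c.C)) ⟨
        ρ U g ⊠ (ιU ⊠ πV ⊞ d.B ⊠ (iso.to ⊠ c.C)) ∎)
    }
    where
    open ≐-Reasoning
    module c = Complement c
    module d = Complement d
    module iso = _≅_ iso

    t : ∀ {V U : Rep W} {ιV πV ιU πU} (c : Complement V I ιV πV) (d : Complement U I ιU πU) →
        Matrix (dim I) (dim V) → Matrix (dim U) (dim I) →
        Matrix (dim (Complement.K d)) (dim (Complement.K c)) → Matrix (dim U) (dim V)
    t c d πV ιU f = ιU ⊠ πV ⊞ Complement.B d ⊠ (f ⊠ Complement.C c)

    compose : ∀ (X Y Z : Rep W) f h → Intertwiner X Y f → Intertwiner Y Z h → Intertwiner X Z (h ⊠ f)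
    compose X Y Z f h f-int h-int g = begin
      (h ⊠ f) ⊠ ρ X g ≈⟨ ·-assoc h f (ρ X g) ⟩
      h ⊠ (f ⊠ ρ X g) ≈⟨ ·-congˡ h (f-int g) ⟩
      h ⊠ (ρ Y g ⊠ f) ≈⟨ ·-assoc h (ρ Y g) f ⟨
      (h ⊠ ρ Y g) ⊠ f ≈⟨ ·-congʳ f (h-int g) ⟩
      (ρ Z g ⊠ h) ⊠ f ≈⟨ ·-assoc (ρ Z g) h f ⟩
      ρ Z g ⊠ (h ⊠ f) ∎

    inner : ∀ {a b c d e} (P : Matrix a b) (Q : Matrix b c) (R : Matrix c d) (S : Matrix d e) {X : Matrix b d} →
            Q ⊠ R ≐ X → (P ⊠ Q) ⊠ (R ⊠ S) ≐ P ⊠ (X ⊠ S)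
    inner P Q R S {X} p = begin
      (P ⊠ Q) ⊠ (R ⊠ S) ≈⟨ ·-assoc P Q (R ⊠ S) ⟩
      P ⊠ (Q ⊠ (R ⊠ S)) ≈⟨ ·-congˡ P (·-assoc Q R S) ⟨
      P ⊠ ((Q ⊠ R) ⊠ S) ≈⟨ ·-congˡ P (·-congʳ S p) ⟩
      P ⊠ (X ⊠ S)       ∎

    inner-𝟘 : ∀ {a b c d e} (P : Matrix a b) (Q : Matrix b c) (R : Matrix c d) (S : Matrix d e) →
              Q ⊠ R ≐ 𝟘 b d → (P ⊠ Q) ⊠ (R ⊠ S) ≐ 𝟘 a e
    inner-𝟘 P Q R S p = ≐.trans (inner P Q R S p) (≐.trans (·-congˡ P (⊠-𝟘ˡ S)) (⊠-𝟘ʳ P))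

    -- Stated for an arbitrary pair of complements so that exchanging their roles also gives the
    -- other composite. The mixed products vanish because `πB` and `Cι` are zero.
    inverse : ∀ {V U : Rep W} {ιV πV ιU πU} (c : Complement V I ιV πV) (d : Complement U I ιU πU) →
              πV ⊠ ιV ≐ 𝟙 (dim I) →
              (f : Matrix (dim (Complement.K d)) (dim (Complement.K c)))
              (h : Matrix (dim (Complement.K c)) (dim (Complement.K d))) →
              f ⊠ h ≐ 𝟙 (dim (Complement.K d)) →
              t c d πV ιU f ⊠ t d c πU ιV h ≐ 𝟙 (dim U)
    inverse {V} {U} {ιV} {πV} {ιU} {πU} c d πιV f h fh = begin
      (a ⊞ b) ⊠ (a′ ⊞ b′)                       ≈⟨ ⊠-distribˡ-⊞ (a ⊞ b) a′ b′ ⟩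
      (a ⊞ b) ⊠ a′ ⊞ (a ⊞ b) ⊠ b′               ≈⟨ ⊞-cong (⊠-distribʳ-⊞ a′ a b) (⊠-distribʳ-⊞ b′ a b) ⟩
      (a ⊠ a′ ⊞ b ⊠ a′) ⊞ (a ⊠ b′ ⊞ b ⊠ b′)     ≈⟨ ⊞-cong (⊞-cong aa′ ba′) (⊞-cong ab′ bb′) ⟩
      (ιU ⊠ πU ⊞ 𝟘 _ _) ⊞ (𝟘 _ _ ⊞ D.B ⊠ D.C)
        ≈⟨ mk (λ i j → cong₂ ℚ._+_ (ℚR.+-identityʳ ((ιU ⊠ πU) i j)) (ℚR.+-identityˡ ((D.B ⊠ D.C) i j))) ⟩
      ιU ⊠ πU ⊞ D.B ⊠ D.C                       ≈⟨ D.split ⟩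
      𝟙 (dim U)                                 ∎
      where
      module C = Complement c
      module D = Complement d
      a b : Matrix (dim U) (dim V)
      a = ιU ⊠ πV
      b = D.B ⊠ (f ⊠ C.C)
      a′ b′ : Matrix (dim V) (dim U)
      a′ = ιV ⊠ πU
      b′ = C.B ⊠ (h ⊠ D.C)
      aa′ : a ⊠ a′ ≐ ιU ⊠ πU
      aa′ = ≐.trans (inner ιU πV ιV πU πιV) (·-congˡ ιU (·-idˡ πU))
      ba′ : b ⊠ a′ ≐ 𝟘 _ _
      ba′ = ≐.trans (·-congʳ a′ (≐.sym (·-assoc D.B f C.C))) (inner-𝟘 (D.B ⊠ f) C.C ιV πU C.Cι)
      ab′ : a ⊠ b′ ≐ 𝟘 _ _
      ab′ = inner-𝟘 ιU πV C.B (h ⊠ D.C) C.πB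
      bb′ : b ⊠ b′ ≐ D.B ⊠ D.C
      bb′ = begin
        b ⊠ b′                                  ≈⟨ ·-congʳ b′ (·-assoc D.B f C.C) ⟨
        ((D.B ⊠ f) ⊠ C.C) ⊠ (C.B ⊠ (h ⊠ D.C))   ≈⟨ inner (D.B ⊠ f) C.C C.B (h ⊠ D.C) C.CB ⟩
        (D.B ⊠ f) ⊠ (𝟙 _ ⊠ (h ⊠ D.C))           ≈⟨ ·-congˡ (D.B ⊠ f) (·-idˡ (h ⊠ D.C)) ⟩
        (D.B ⊠ f) ⊠ (h ⊠ D.C)                   ≈⟨ inner D.B f h D.C fh ⟩
        D.B ⊠ (𝟙 _ ⊠ D.C)                       ≈⟨ ·-congˡ D.B (·-idˡ D.C) ⟩
        D.B ⊠ D.C                               ∎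

_ᵗ : Matrix m n → Matrix n m
(A ᵗ) i j = A j i

ᵗ-⊠ : (A : Matrix m n) (B : Matrix n k) → (A ⊠ B) ᵗ ≐ B ᵗ ⊠ A ᵗ
ᵗ-⊠ A B = mk λ i j → Σℚ.sum-cong-≗ (λ l → ℚR.*-comm (A j l) (B l i))

tr-⊗ : (A : Matrix m m) (B : Matrix n n) → tr (A ⊗ᴹ B) ≡ tr A ℚ.* tr B
tr-⊗ {m} {n} A B = begin
  Σℚ.sum (λ x → (A ⊗ᴹ B) x x)
    ≡⟨ sum-* m {n} (λ x → (A ⊗ᴹ B) x x) ⟩
  Σℚ.sum (λ i → Σℚ.sum (λ j → (A ⊗ᴹ B) (combine {m} {n} i j) (combine {m} {n} i j)))
    ≡⟨ Σℚ.sum-cong-≗ {m} (λ i → Σℚ.sum-cong-≗ {n} (λ j →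
         cong (λ z → A (proj₁ z) (proj₁ z) ℚ.* B (proj₂ z) (proj₂ z)) (Fin.remQuot-combine {m} {n} i j))) ⟩
  Σℚ.sum (λ i → Σℚ.sum (λ j → A i i ℚ.* B j j))
    ≡⟨ Σℚ.sum-cong-≗ {m} (λ i → Σℚ.*-distribˡ-sum (A i i) (λ j → B j j)) ⟨
  Σℚ.sum (λ i → A i i ℚ.* tr B)
    ≡⟨ Σℚ.*-distribʳ-sum (tr B) (λ i → A i i) ⟨
  tr A ℚ.* tr B ∎
  where open ≡-Reasoning

-- Representations with equal characters are isomorphic

module _ {W : FiniteGroup} where
  open FiniteGroup W
    using (Carrier; _∙_; ε; _⁻¹; inverseˡ; inverseʳ; ∙-congˡ; ∙-congʳ; ⁻¹-cong; ⁻¹-anti-homo-∙; identityʳ)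
    renaming (_≈_ to _≈ᵂ_; trans to ≈-trans; assoc to ∙-assoc)
  open Average W
  open Rep

  module _ (V U : Rep W) where

    private
      conj : Matrix (dim U) (dim V) → Carrier → Matrix (dim U) (dim V)
      conj X g = ρ U g ⊠ (X ⊠ ρ V (g ⁻¹))

    symmetrize : Matrix (dim U) (dim V) → Matrix (dim U) (dim V)
    symmetrize X = mean (λ x → conj X (el x))

    symmetrize-intertwines : ∀ X → Intertwiner V U (symmetrize X)
    symmetrize-intertwines X h = begin
      symmetrize X ⊠ ρ V h                                     ≈⟨ mean-⊠ʳ (ρ V h) (λ x → conj X (el x)) ⟩
      mean (λ x → F (el x))                                    ≈⟨ mean-translate F F-cong h ⟨
      mean (λ x → F (h ∙ el x))                                ≈⟨ mean-cong (λ x → shift (el x)) ⟩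
      mean (λ x → ρ U h ⊠ conj X (el x))                       ≈⟨ mean-⊠ˡ (ρ U h) (λ x → conj X (el x)) ⟨
      ρ U h ⊠ symmetrize X                                     ∎
      where
      open ≐-Reasoning
      F : Carrier → Matrix (dim U) (dim V)
      F g = conj X g ⊠ ρ V h
      F-cong : ∀ {g g′} → g ≈ᵂ g′ → F g ≐ F g′
      F-cong p = ·-congʳ (ρ V h) (·-cong (ρ-cong≐ U p) (·-congˡ X (ρ-cong≐ V (⁻¹-cong p))))
      cancel : ∀ g → (h ∙ g) ⁻¹ ∙ h ≈ᵂ g ⁻¹
      cancel g = ≈-trans (∙-congʳ (⁻¹-anti-homo-∙ h g)) (≈-trans (∙-assoc _ _ _)
        (≈-trans (∙-congˡ (inverseˡ h)) (identityʳ _)))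
      shift : ∀ g → F (h ∙ g) ≐ ρ U h ⊠ conj X g
      shift g = begin
        (ρ U (h ∙ g) ⊠ (X ⊠ ρ V ((h ∙ g) ⁻¹))) ⊠ ρ V h
          ≈⟨ ·-assoc (ρ U (h ∙ g)) (X ⊠ ρ V ((h ∙ g) ⁻¹)) (ρ V h) ⟩
        ρ U (h ∙ g) ⊠ ((X ⊠ ρ V ((h ∙ g) ⁻¹)) ⊠ ρ V h)
          ≈⟨ ·-congˡ (ρ U (h ∙ g)) (·-assoc X (ρ V ((h ∙ g) ⁻¹)) (ρ V h)) ⟩
        ρ U (h ∙ g) ⊠ (X ⊠ (ρ V ((h ∙ g) ⁻¹) ⊠ ρ V h))
          ≈⟨ ·-cong (mk (ρ-∙ U h g)) (·-congˡ X (≐.trans (≐.sym (mk (ρ-∙ V ((h ∙ g) ⁻¹) h))) (ρ-cong≐ V (cancel g)))) ⟩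
        (ρ U h ⊠ ρ U g) ⊠ (X ⊠ ρ V (g ⁻¹))
          ≈⟨ ·-assoc (ρ U h) (ρ U g) (X ⊠ ρ V (g ⁻¹)) ⟩
        ρ U h ⊠ conj X g ∎

    -- Every conjugate of a section of the equivariant map `f` is again a section, hence so is their
    -- mean. This and its dual `symmetrize-retraction` are the content of Maschke's theorem.
    symmetrize-section : ∀ {f} → Intertwiner U V f → ∀ {X} → f ⊠ X ≐ 𝟙 (dim V) → f ⊠ symmetrize X ≐ 𝟙 (dim V)
    symmetrize-section {f} f-int {X} fX = begin
      f ⊠ symmetrize X                        ≈⟨ mean-⊠ˡ f (λ x → conj X (el x)) ⟩
      mean (λ x → f ⊠ conj X (el x))          ≈⟨ mean-cong (λ x → one (el x)) ⟩
      mean (λ _ → 𝟙 (dim V))                  ≈⟨ mean-const (𝟙 (dim V)) ⟩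
      𝟙 (dim V)                               ∎
      where
      open ≐-Reasoning
      one : ∀ g → f ⊠ conj X g ≐ 𝟙 (dim V)
      one g = begin
        f ⊠ (ρ U g ⊠ (X ⊠ ρ V (g ⁻¹))) ≈⟨ ·-assoc f (ρ U g) (X ⊠ ρ V (g ⁻¹)) ⟨
        (f ⊠ ρ U g) ⊠ (X ⊠ ρ V (g ⁻¹)) ≈⟨ ·-congʳ (X ⊠ ρ V (g ⁻¹)) (f-int g) ⟩
        (ρ V g ⊠ f) ⊠ (X ⊠ ρ V (g ⁻¹)) ≈⟨ ·-assoc (ρ V g) f (X ⊠ ρ V (g ⁻¹)) ⟩
        ρ V g ⊠ (f ⊠ (X ⊠ ρ V (g ⁻¹))) ≈⟨ ·-congˡ (ρ V g) (·-assoc f X (ρ V (g ⁻¹))) ⟨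
        ρ V g ⊠ ((f ⊠ X) ⊠ ρ V (g ⁻¹)) ≈⟨ ·-congˡ (ρ V g) (≐.trans (·-congʳ (ρ V (g ⁻¹)) fX) (·-idˡ (ρ V (g ⁻¹)))) ⟩
        ρ V g ⊠ ρ V (g ⁻¹)             ≈⟨ ρ-inverse V g (g ⁻¹) (inverseʳ g) ⟩
        𝟙 (dim V)                      ∎

    symmetrize-retraction : ∀ {f} → Intertwiner U V f → ∀ {X} → X ⊠ f ≐ 𝟙 (dim U) → symmetrize X ⊠ f ≐ 𝟙 (dim U)
    symmetrize-retraction {f} f-int {X} Xf = begin
      symmetrize X ⊠ f                        ≈⟨ mean-⊠ʳ f (λ x → conj X (el x)) ⟩
      mean (λ x → conj X (el x) ⊠ f)          ≈⟨ mean-cong (λ x → one (el x)) ⟩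
      mean (λ _ → 𝟙 (dim U))                  ≈⟨ mean-const (𝟙 (dim U)) ⟩
      𝟙 (dim U)                               ∎
      where
      open ≐-Reasoning
      one : ∀ g → conj X g ⊠ f ≐ 𝟙 (dim U)
      one g = begin
        (ρ U g ⊠ (X ⊠ ρ V (g ⁻¹))) ⊠ f ≈⟨ ·-assoc (ρ U g) (X ⊠ ρ V (g ⁻¹)) f ⟩
        ρ U g ⊠ ((X ⊠ ρ V (g ⁻¹)) ⊠ f) ≈⟨ ·-congˡ (ρ U g) (·-assoc X (ρ V (g ⁻¹)) f) ⟩
        ρ U g ⊠ (X ⊠ (ρ V (g ⁻¹) ⊠ f)) ≈⟨ ·-congˡ (ρ U g) (·-congˡ X (f-int (g ⁻¹))) ⟨
        ρ U g ⊠ (X ⊠ (f ⊠ ρ U (g ⁻¹))) ≈⟨ ·-congˡ (ρ U g) (·-assoc X f (ρ U (g ⁻¹))) ⟨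
        ρ U g ⊠ ((X ⊠ f) ⊠ ρ U (g ⁻¹)) ≈⟨ ·-congˡ (ρ U g) (≐.trans (·-congʳ (ρ U (g ⁻¹)) Xf) (·-idˡ (ρ U (g ⁻¹)))) ⟩
        ρ U g ⊠ ρ U (g ⁻¹)             ≈⟨ ρ-inverse U g (g ⁻¹) (inverseʳ g) ⟩
        𝟙 (dim U)                      ∎

  -- Matrices U ← V form the representation U ⊗ V*, with g acting as X ↦ ρ(g) X ρ(g⁻¹).
  module Hom (V U : Rep W) where

    T : Carrier → Matrix (dim U ℕ.* dim V) (dim U ℕ.* dim V)
    T g = ρ U g ⊗ᴹ (ρ V (g ⁻¹)) ᵗ

    T-cong : ∀ {g h} → g ≈ᵂ h → T g ≐ T h
    T-cong p = mk (⊗ᴹ-cong (ρ-cong U p) (λ i j → ρ-cong V (⁻¹-cong p) j i))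

    T-∙ : ∀ g h → T (g ∙ h) ≐ T g ⊠ T h
    T-∙ g h = ≐.trans
      (mk (⊗ᴹ-cong (ρ-∙ U g h) (at (begin
        (ρ V ((g ∙ h) ⁻¹)) ᵗ         ≈⟨ mk (λ i j → ρ-cong V (⁻¹-anti-homo-∙ g h) j i) ⟩
        (ρ V (h ⁻¹ ∙ g ⁻¹)) ᵗ        ≈⟨ mk (λ i j → ρ-∙ V (h ⁻¹) (g ⁻¹) j i) ⟩
        (ρ V (h ⁻¹) ⊠ ρ V (g ⁻¹)) ᵗ  ≈⟨ ᵗ-⊠ (ρ V (h ⁻¹)) (ρ V (g ⁻¹)) ⟩
        (ρ V (g ⁻¹)) ᵗ ⊠ (ρ V (h ⁻¹)) ᵗ ∎))))
      (mk (⊗ᴹ-⊠ (ρ U g) (ρ U h) ((ρ V (g ⁻¹)) ᵗ) ((ρ V (h ⁻¹)) ᵗ)))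
      where open ≐-Reasoning

    e : Matrix (dim U ℕ.* dim V) (dim U ℕ.* dim V)
    e = mean (λ x → T (el x))

    Te : ∀ h → T h ⊠ e ≐ e
    Te h = begin
      T h ⊠ e                       ≈⟨ mean-⊠ˡ (T h) (λ x → T (el x)) ⟩
      mean (λ x → T h ⊠ T (el x))   ≈⟨ mean-cong (λ x → ≐.sym (T-∙ h (el x))) ⟩
      mean (λ x → T (h ∙ el x))     ≈⟨ mean-translate T T-cong h ⟩
      e                             ∎
      where open ≐-Reasoning

    ee : e ⊠ e ≐ e
    ee = ≐.trans (mean-⊠ʳ e (λ x → T (el x))) (≐.trans (mean-cong (λ x → Te (el x))) (mean-const e))

    -- The right side involves the two characters only, which is what allows Hom(V , U) to be
    -- compared with End(V).
    tr-e : tr e ≡ 1/order ℚ.* Σℚ.sum (λ x → char U (el x) ℚ.* char V (el x ⁻¹))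
    tr-e = trans (tr-mean (λ x → T (el x)))
      (cong (1/order ℚ.*_) (Σℚ.sum-cong-≗ (λ x → tr-⊗ (ρ U (el x)) ((ρ V (el x ⁻¹)) ᵗ))))

    vec : Matrix (dim U) (dim V) → Fin (dim U ℕ.* dim V) → ℚ
    vec X z = X (proj₁ (remQuot {dim U} (dim V) z)) (proj₂ (remQuot {dim U} (dim V) z))

    T-vec : ∀ g (w : Fin (dim U ℕ.* dim V) → ℚ) i j →
            Σℚ.sum (λ z → T g (combine {dim U} {dim V} i j) z ℚ.* w z) ≡
            (ρ U g ⊠ ((λ k l → w (combine {dim U} {dim V} k l)) ⊠ ρ V (g ⁻¹))) i j
    T-vec g w i j = begin
      Σℚ.sum (λ z → T g (combine {dim U} {dim V} i j) z ℚ.* w z)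
        ≡⟨ sum-* (dim U) {dim V} (λ z → T g (combine {dim U} {dim V} i j) z ℚ.* w z) ⟩
      Σℚ.sum (λ k → Σℚ.sum (λ l → T g (combine {dim U} {dim V} i j) (combine {dim U} {dim V} k l) ℚ.* w (combine {dim U} {dim V} k l)))
        ≡⟨ Σℚ.sum-cong-≗ (λ k → Σℚ.sum-cong-≗ (λ l → trans
             (cong (ℚ._* w (combine {dim U} {dim V} k l)) (cong₂ (λ y z → ρ U g (proj₁ y) (proj₁ z) ℚ.* ρ V (g ⁻¹) (proj₂ z) (proj₂ y))
               (Fin.remQuot-combine {dim U} {dim V} i j) (Fin.remQuot-combine {dim U} {dim V} k l)))
             (solve 3 (λ a b x → (a :* b) :* x := a :* (x :* b)) refl (ρ U g i k) (ρ V (g ⁻¹) l j) (w (combine {dim U} {dim V} k l))))) ⟩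
      Σℚ.sum (λ k → Σℚ.sum (λ l → ρ U g i k ℚ.* (w (combine {dim U} {dim V} k l) ℚ.* ρ V (g ⁻¹) l j)))
        ≡⟨ Σℚ.sum-cong-≗ (λ k → Σℚ.*-distribˡ-sum (ρ U g i k) (λ l → w (combine {dim U} {dim V} k l) ℚ.* ρ V (g ⁻¹) l j)) ⟨
      Σℚ.sum (λ k → ρ U g i k ℚ.* Σℚ.sum (λ l → w (combine {dim U} {dim V} k l) ℚ.* ρ V (g ⁻¹) l j)) ∎
      where
      open ≡-Reasoning
      open +-*-Solver

    -- By `Te` the image of `e` consists of vectors fixed by every `T g`; a fixed vector, reshaped
    -- as a matrix, commutes with the action.
    column : ∀ z → Intertwiner V U (λ i j → e (combine {dim U} {dim V} i j) z)
    column z g = begin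
      X ⊠ ρ V g                                    ≈⟨ ·-congʳ (ρ V g) fixed ⟨
      (ρ U g ⊠ (X ⊠ ρ V (g ⁻¹))) ⊠ ρ V g           ≈⟨ ·-assoc (ρ U g) (X ⊠ ρ V (g ⁻¹)) (ρ V g) ⟩
      ρ U g ⊠ ((X ⊠ ρ V (g ⁻¹)) ⊠ ρ V g)           ≈⟨ ·-congˡ (ρ U g) (·-assoc X (ρ V (g ⁻¹)) (ρ V g)) ⟩
      ρ U g ⊠ (X ⊠ (ρ V (g ⁻¹) ⊠ ρ V g))
        ≈⟨ ·-congˡ (ρ U g) (≐.trans (·-congˡ X (ρ-inverse V (g ⁻¹) g (inverseˡ g))) (·-idʳ X)) ⟩
      ρ U g ⊠ X                                    ∎
      where
      open ≐-Reasoning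
      X : Matrix (dim U) (dim V)
      X i j = e (combine {dim U} {dim V} i j) z
      fixed : ρ U g ⊠ (X ⊠ ρ V (g ⁻¹)) ≐ X
      fixed = mk λ i j → trans (sym (T-vec g (λ y → e y z) i j)) (at (Te g) (combine {dim U} {dim V} i j) z)

  -- The identity matrix, read as the vector `w` in End(V), is fixed by `e`, so `e` is nonzero. In
  -- characteristic zero a nonzero idempotent has nonzero trace, since the trace is the rank.
  tr-e≢0 : ∀ (V : Rep W) → dim V ≢ 0 → tr (Hom.e V V) ≢ 0ℚ
  tr-e≢0 V d≢0 tr≡0 = d≢0 (vanish (dim V) refl)
    where
    open Hom V V
    open Idempotent e ee
    w : Fin (dim V ℕ.* dim V) → ℚ
    w = vec (𝟙 (dim V))
    w-combine : ∀ i j → w (combine {dim V} {dim V} i j) ≡ δ i j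
    w-combine i j = cong (λ z → δ (proj₁ z) (proj₂ z)) (Fin.remQuot-combine {dim V} {dim V} i j)
    w-fixed : ∀ g i j → Σℚ.sum (λ z → T g (combine {dim V} {dim V} i j) z ℚ.* w z) ≡ δ i j
    w-fixed g i j = trans (T-vec g w i j) (at (begin
      ρ V g ⊠ ((λ k l → w (combine k l)) ⊠ ρ V (g ⁻¹))
        ≈⟨ ·-congˡ (ρ V g) (≐.trans (·-congʳ (ρ V (g ⁻¹)) (mk w-combine)) (·-idˡ (ρ V (g ⁻¹)))) ⟩
      ρ V g ⊠ ρ V (g ⁻¹)             ≈⟨ ρ-inverse V g (g ⁻¹) (inverseʳ g) ⟩
      𝟙 (dim V)                      ∎) i j)
      where open ≐-Reasoning
    column-vector : Matrix (dim V ℕ.* dim V) 1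
    column-vector z _ = w z
    ew : ∀ i j → (e ⊠ column-vector) (combine {dim V} {dim V} i j) zero ≡ δ i j
    ew i j = trans (at (mean-⊠ʳ column-vector (λ x → T (el x))) (combine {dim V} {dim V} i j) zero)
      (trans (cong (1/order ℚ.*_) (Σℚ.sum-cong-≗ (λ x → w-fixed (el x) i j)))
        (at (mean-const (𝟙 (dim V))) i j))
    rank≡0 : ∀ k → size k ≡ 0ℚ → k ≡ 0
    rank≡0 k p = size-injective k 0 p
    e≐0 : e ≐ 𝟘 _ _
    e≐0 = rank-0 (rankFactorization e) (rank≡0 r (trans (sym tr≡size) tr≡0))
    ew≡0 : ∀ z → (e ⊠ column-vector) z zero ≡ 0ℚ
    ew≡0 z = trans (at (·-congʳ column-vector e≐0) z zero) (at (⊠-𝟘ˡ column-vector) z zero)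
    contra : Fin (dim V) → 1ℚ ≡ 0ℚ
    contra i = trans (sym (δ-refl i)) (trans (sym (ew i i)) (ew≡0 (combine {dim V} {dim V} i i)))
    vanish : ∀ d → dim V ≡ d → dim V ≡ 0
    vanish zero    p = p
    vanish (suc d) p = contradiction (contra (subst Fin (sym p) zero)) ℚₚ.1≢0

  -- If the diagonal of `e` on Hom(V , U) were zero, its trace would be zero, and so would the equal
  -- trace on End(V). A nonzero diagonal entry singles out a nonzero column, which is an
  -- intertwiner.
  nonzero-intertwiner : ∀ (V U : Rep W) → (∀ g → char V g ≡ char U g) → dim V ≢ 0 →
                        ∃ λ f → Intertwiner V U f × ¬ f ≐ 𝟘 (dim U) (dim V)
  nonzero-intertwiner V U χ≡ d≢0 with Fin.any? (λ x → ¬? (Hom.e V U x x ℚₚ.≟ 0ℚ))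
  ... | yes (x , ≢0) = _ , Hom.column V U x , λ p → ≢0 (trans
      (cong (λ z → Hom.e V U z x) (sym (Fin.combine-remQuot {dim U} (dim V) x))) (at p _ _))
  ... | no none = contradiction
      (trans (trans (Hom.tr-e V V) (trans
        (cong (1/order ℚ.*_) (Σℚ.sum-cong-≗ (λ x → cong (ℚ._* char V (el x ⁻¹)) (χ≡ (el x)))))
        (sym (Hom.tr-e V U))))
        (sum-zero _ (λ x → decidable-stable (Hom.e V U x x ℚₚ.≟ 0ℚ) (λ ≢0 → none (x , ≢0)))))
      (tr-e≢0 V d≢0)

  dim-0-≅ : ∀ (V U : Rep W) → dim V ≡ 0 → dim U ≡ 0 → V ≅ U
  dim-0-≅ V U p q = record
    { to = λ _ _ → 0ℚ ; from = λ _ _ → 0ℚ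
    ; to-from = λ i → absurd q i ; from-to = λ i → absurd p i ; intertwine = λ g i → absurd q i }
    where
    absurd : ∀ {d} {A : Set} → d ≡ 0 → Fin d → A
    absurd refl ()

  -- After the common image is split off, the complements again have equal characters and smaller
  -- dimension, so the induction on the bound `k` continues. At dimension zero the character at `ε`
  -- forces `U` to have dimension zero as well.
  char⇒≅ : ∀ k (V U : Rep W) → dim V ≤ k → (∀ g → char V g ≡ char U g) → V ≅ U
  char⇒≅ k V U d≤k χ≡ with dim V ℕ.≟ 0
  ... | yes d≡0 = dim-0-≅ V U d≡0
        (size-injective _ 0 (trans (sym (char-ε U)) (trans (sym (χ≡ ε)) (trans (char-ε V) (cong size d≡0)))))
  char⇒≅ zero    V U d≤k χ≡ | no d≢0 = contradiction (ℕ.n≤0⇒n≡0 d≤k) d≢0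
  char⇒≅ (suc k) V U d≤k χ≡ | no d≢0 =
    glue cV cU B-int C-int Cs tB (char⇒≅ k cV.K cU.K smaller χK)
    where
    f = proj₁ (nonzero-intertwiner V U χ≡ d≢0)
    f-int = proj₁ (proj₂ (nonzero-intertwiner V U χ≡ d≢0))
    f≢0 = proj₂ (proj₂ (nonzero-intertwiner V U χ≡ d≢0))
    F : RankFactorization f
    F = rankFactorization f
    open RankFactorization F
    open ≐-Reasoning

    BCρ : ∀ g → B ⊠ (C ⊠ ρ V g) ≐ (ρ U g ⊠ B) ⊠ C
    BCρ g = begin
      B ⊠ (C ⊠ ρ V g)  ≈⟨ ·-assoc B C (ρ V g) ⟨
      (B ⊠ C) ⊠ ρ V g  ≈⟨ ·-congʳ (ρ V g) factor ⟨
      f ⊠ ρ V g        ≈⟨ f-int g ⟩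
      ρ U g ⊠ f        ≈⟨ ·-congˡ (ρ U g) factor ⟩
      ρ U g ⊠ (B ⊠ C)  ≈⟨ ·-assoc (ρ U g) B C ⟨
      (ρ U g ⊠ B) ⊠ C  ∎

    -- The image of `f` is stable: since f = BC is equivariant and `C` has a right inverse, ρ(g)B =
    -- BM for the matrix `M` below. The projection onto the image therefore fixes ρ(g)B.
    BB⁻ρ : ∀ g → B ⊠ (B⁻ ⊠ (ρ U g ⊠ B)) ≐ ρ U g ⊠ B
    BB⁻ρ g = begin
      B ⊠ (B⁻ ⊠ (ρ U g ⊠ B))             ≈⟨ ·-congˡ B (·-congˡ B⁻ lift) ⟨
      B ⊠ (B⁻ ⊠ (B ⊠ M))                 ≈⟨ ·-congˡ B (·-assoc B⁻ B M) ⟨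
      B ⊠ ((B⁻ ⊠ B) ⊠ M)                 ≈⟨ ·-congˡ B (≐.trans (·-congʳ M left) (·-idˡ M)) ⟩
      B ⊠ M                              ≈⟨ lift ⟩
      ρ U g ⊠ B                          ∎
      where
      M : Matrix r r
      M = (C ⊠ ρ V g) ⊠ C⁻
      lift : B ⊠ M ≐ ρ U g ⊠ B
      lift = begin
        B ⊠ ((C ⊠ ρ V g) ⊠ C⁻)  ≈⟨ ·-assoc B (C ⊠ ρ V g) C⁻ ⟨
        (B ⊠ (C ⊠ ρ V g)) ⊠ C⁻  ≈⟨ ·-congʳ C⁻ (BCρ g) ⟩
        ((ρ U g ⊠ B) ⊠ C) ⊠ C⁻  ≈⟨ ·-assoc (ρ U g ⊠ B) C C⁻ ⟩
        (ρ U g ⊠ B) ⊠ (C ⊠ C⁻)  ≈⟨ ·-congˡ (ρ U g ⊠ B) right ⟩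
        (ρ U g ⊠ B) ⊠ 𝟙 r       ≈⟨ ·-idʳ (ρ U g ⊠ B) ⟩
        ρ U g ⊠ B               ∎

    module S = Summand U B B⁻ left BB⁻ρ
    I : Rep W
    I = S.summand

    B-int : Intertwiner I U B
    B-int = S.B-intertwines

    C-int : Intertwiner V I C
    C-int g = begin
      C ⊠ ρ V g                  ≈⟨ ·-idˡ (C ⊠ ρ V g) ⟨
      𝟙 r ⊠ (C ⊠ ρ V g)          ≈⟨ ·-congʳ (C ⊠ ρ V g) left ⟨
      (B⁻ ⊠ B) ⊠ (C ⊠ ρ V g)     ≈⟨ ·-assoc B⁻ B (C ⊠ ρ V g) ⟩
      B⁻ ⊠ (B ⊠ (C ⊠ ρ V g))     ≈⟨ ·-congˡ B⁻ (BCρ g) ⟩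
      B⁻ ⊠ ((ρ U g ⊠ B) ⊠ C)     ≈⟨ ·-assoc B⁻ (ρ U g ⊠ B) C ⟨
      (B⁻ ⊠ (ρ U g ⊠ B)) ⊠ C     ∎

    -- `C⁻` and `B⁻` are one-sided inverses of matrices only; averaging makes them equivariant, so
    -- that the image `I` becomes a summand of both `V` and `U`.
    s : Matrix (dim V) r
    s = symmetrize I V C⁻
    Cs : C ⊠ s ≐ 𝟙 r
    Cs = symmetrize-section I V C-int {C⁻} right
    t : Matrix r (dim U)
    t = symmetrize U I B⁻
    tB : t ⊠ B ≐ 𝟙 r
    tB = symmetrize-retraction U I B-int {B⁻} left

    cV : Complement V I s C
    cV = complement (symmetrize-intertwines I V C⁻) C-int Cs
    cU : Complement U I B t
    cU = complement B-int (symmetrize-intertwines U I B⁻) tB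
    module cV = Complement cV
    module cU = Complement cU

    χV : ∀ g → char V g ≡ char I g ℚ.+ char cV.K g
    χV = char-complement cV (symmetrize-intertwines I V C⁻) Cs
    χU : ∀ g → char U g ≡ char I g ℚ.+ char cU.K g
    χU = char-complement cU B-int tB
    χK : ∀ g → char cV.K g ≡ char cU.K g
    χK g = ℚ+.∙-cancelˡ (char I g) _ _ (trans (sym (χV g)) (trans (χ≡ g) (χU g)))

    dims : dim V ≡ r ℕ.+ dim cV.K
    dims = size-injective _ _ (trans (sym (char-ε V)) (trans (χV ε)
      (trans (cong₂ ℚ._+_ (char-ε I) (char-ε cV.K)) (sym (size-+ r (dim cV.K))))))
    smaller : dim cV.K ≤ k
    smaller = go r refl
      where
      go : ∀ r′ → r ≡ r′ → dim cV.K ≤ k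
      go zero     p = contradiction (rank-0 F p) f≢0
      go (suc r′) p = ℕ.≤-pred (ℕ.≤-trans (s≤s (ℕ.m≤n+m (dim cV.K) r′))
        (ℕ.≤-trans (ℕ.≤-reflexive (sym (trans dims (cong (ℕ._+ dim cV.K) p)))) d≤k))

-- Virtual characters

tr-⊕ : (A : Matrix m m) (B : Matrix n n) → tr (A ⊕ᴹ B) ≡ tr A ℚ.+ tr B
tr-⊕ {m} {n} A B = trans (sum-+ m (λ x → (A ⊕ᴹ B) x x)) (cong₂ ℚ._+_
  (Σℚ.sum-cong-≗ (λ i → cong (λ z → blocks A B z z) (Fin.splitAt-↑ˡ m i n)))
  (Σℚ.sum-cong-≗ (λ j → cong (λ z → blocks A B z z) (Fin.splitAt-↑ʳ m n j))))

charᵛ : {W : FiniteGroup} → VRep W → FiniteGroup.Carrier W → ℚ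
charᵛ X g = char (pos X) g ℚ.- char (neg X) g

module _ {W : FiniteGroup} where
  open FiniteGroup W using (Carrier) renaming (_≈_ to _≈ᵂ_)
  open +-*-Solver

  charᵛ-cong : (X : VRep W) → ∀ {g h} → g ≈ᵂ h → charᵛ X g ≡ charᵛ X h
  charᵛ-cong X p = cong₂ ℚ._-_ (char-cong (pos X) p) (char-cong (neg X) p)

  char-⊕ : (V U : Rep W) → ∀ g → char (V ⊕ U) g ≡ char V g ℚ.+ char U g
  char-⊕ V U g = tr-⊕ (Rep.ρ V g) (Rep.ρ U g)

  ≈ᵛ⇒charᵛ : {X Y : VRep W} → X ≈ᵛ Y → ∀ g → charᵛ X g ≡ charᵛ Y g
  ≈ᵛ⇒charᵛ {X} {Y} p g = begin
    a ℚ.- b                       ≡⟨ solve 4 (λ a b d r → a :- b := ((a :+ d) :+ r) :- (b :+ d :+ r)) refl a b d r ⟩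
    ((a ℚ.+ d) ℚ.+ r) ℚ.- (b ℚ.+ d ℚ.+ r) ≡⟨ cong (ℚ._- (b ℚ.+ d ℚ.+ r)) sums ⟩
    ((c ℚ.+ b) ℚ.+ r) ℚ.- (b ℚ.+ d ℚ.+ r) ≡⟨ solve 4 (λ b c d r → ((c :+ b) :+ r) :- (b :+ d :+ r) := c :- d) refl b c d r ⟩
    c ℚ.- d                       ∎
    where
    open ≡-Reasoning
    open _≈ᵛ_ p
    a = char (pos X) g
    b = char (neg X) g
    c = char (pos Y) g
    d = char (neg Y) g
    r = char K g
    sums : (a ℚ.+ d) ℚ.+ r ≡ (c ℚ.+ b) ℚ.+ r
    sums = trans (sym (trans (char-⊕ (pos X ⊕ neg Y) K g) (cong (ℚ._+ r) (char-⊕ (pos X) (neg Y) g))))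
      (trans (char-≅ iso g) (trans (char-⊕ (pos Y ⊕ neg X) K g) (cong (ℚ._+ r) (char-⊕ (pos Y) (neg X) g))))

  charᵛ⇒≈ᵛ : {X Y : VRep W} → (∀ g → charᵛ X g ≡ charᵛ Y g) → X ≈ᵛ Y
  charᵛ⇒≈ᵛ {X} {Y} p = record { K = zeroRep W ; iso = char⇒≅ _ _ _ ℕ.≤-refl λ g → trans
    (trans (char-⊕ (pos X ⊕ neg Y) (zeroRep W) g) (cong (ℚ._+ 0ℚ) (char-⊕ (pos X) (neg Y) g)))
    (trans (sums g)
    (sym (trans (char-⊕ (pos Y ⊕ neg X) (zeroRep W) g) (cong (ℚ._+ 0ℚ) (char-⊕ (pos Y) (neg X) g))))) }
    where
    sums : ∀ g → char (pos X) g ℚ.+ char (neg Y) g ℚ.+ 0ℚ ≡ char (pos Y) g ℚ.+ char (neg X) g ℚ.+ 0ℚ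
    sums g = begin
      a ℚ.+ d ℚ.+ 0ℚ           ≡⟨ solve 3 (λ a b d → a :+ d :+ con 0ℚ := (a :- b) :+ (b :+ d)) refl a b d ⟩
      (a ℚ.- b) ℚ.+ (b ℚ.+ d)  ≡⟨ cong (ℚ._+ (b ℚ.+ d)) (p g) ⟩
      (c ℚ.- d) ℚ.+ (b ℚ.+ d)  ≡⟨ solve 3 (λ b c d → (c :- d) :+ (b :+ d) := c :+ b :+ con 0ℚ) refl b c d ⟩
      c ℚ.+ b ℚ.+ 0ℚ           ∎
      where
      open ≡-Reasoning
      a = char (pos X) g
      b = char (neg X) g
      c = char (pos Y) g
      d = char (neg Y) g

  charᵛ-+ : (X Y : VRep W) → ∀ g → charᵛ (X +ᵛ Y) g ≡ charᵛ X g ℚ.+ charᵛ Y g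
  charᵛ-+ X Y g = trans (cong₂ ℚ._-_ (char-⊕ (pos X) (pos Y) g) (char-⊕ (neg X) (neg Y) g))
    (solve 4 (λ a b c d → (a :+ c) :- (b :+ d) := (a :- b) :+ (c :- d)) refl
      (char (pos X) g) (char (neg X) g) (char (pos Y) g) (char (neg Y) g))

  charᵛ-neg : (X : VRep W) → ∀ g → charᵛ (-ᵛ X) g ≡ ℚ.- charᵛ X g
  charᵛ-neg X g = solve 2 (λ a b → b :- a := :- (a :- b)) refl (char (pos X) g) (char (neg X) g)

charᵛ-⊗ : {G H : FiniteGroup} (X : VRep G) (Y : VRep H) → ∀ g h →
          charᵛ (X ⊗ᵛ Y) (g , h) ≡ charᵛ X g ℚ.* charᵛ Y h
charᵛ-⊗ {G} {H} X Y g h = trans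
  (cong₂ ℚ._-_
    (trans (char-⊕ (pos X ⊗ pos Y) (neg X ⊗ neg Y) (g , h)) (cong₂ ℚ._+_ (tensor (pos X) (pos Y)) (tensor (neg X) (neg Y))))
    (trans (char-⊕ (pos X ⊗ neg Y) (neg X ⊗ pos Y) (g , h)) (cong₂ ℚ._+_ (tensor (pos X) (neg Y)) (tensor (neg X) (pos Y)))))
  (solve 4 (λ a b c d → (a :* c :+ b :* d) :- (a :* d :+ b :* c) := (a :- b) :* (c :- d)) refl
    (char (pos X) g) (char (neg X) g) (char (pos Y) h) (char (neg Y) h))
  where
  open +-*-Solver
  tensor : (V : Rep G) (U : Rep H) → char (V ⊗ U) (g , h) ≡ char V g ℚ.* char U h
  tensor V U = tr-⊗ (Rep.ρ V g) (Rep.ρ U h)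

-- Characters of induced representations

module InducedCharacter {W : FiniteGroup} (H : Subgroup W) where
  open FiniteGroup W using (Carrier; _∙_; _⁻¹)
  open Subgroup H using (Mem; mem?)

  -- The coset representatives do not depend on the representation being induced.
  open Induction H (zeroRep (Subgroup.finiteGroup H)) using (index; rep; locate; rep-unique) public

  char₀ : VRep (Subgroup.finiteGroup H) → Carrier → ℚ
  char₀ X w with mem? w
  ... | yes p = charᵛ X (w , p)
  ... | no  _ = 0ℚ

  -- Only the diagonal blocks contribute to the trace. As `ρ₀` is zero outside `H`, this is
  -- Frobenius's formula for an induced character.
  char-ind : (V : Rep (Subgroup.finiteGroup H)) → ∀ g →
             char (ind H V) g ≡ Σℚ.sum (λ j → tr (Induction.ρ₀ H V ((rep j ⁻¹ ∙ g) ∙ rep j)))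
  char-ind V g = trans (sum-* index {dim} (λ x → ρInd g x x)) (Σℚ.sum-cong-≗ {index} (λ j → Σℚ.sum-cong-≗ {dim}
    (λ a → cong (λ z → entry g z z) (Fin.remQuot-combine {index} {dim} j a))))
    where
    open Induction H V using (ρInd; entry)
    open Rep V using (dim)

  charᵛ-ind : (X : VRep (Subgroup.finiteGroup H)) → ∀ g →
              charᵛ (indᵛ H X) g ≡ Σℚ.sum (λ j → char₀ X ((rep j ⁻¹ ∙ g) ∙ rep j))
  charᵛ-ind X g = begin
    char (ind H (pos X)) g ℚ.- char (ind H (neg X)) g
      ≡⟨ cong₂ ℚ._-_ (char-ind (pos X) g) (char-ind (neg X) g) ⟩
    Σℚ.sum (λ j → χ⁺ (w j)) ℚ.- Σℚ.sum (λ j → χ⁻ (w j))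
      ≡⟨ cong (Σℚ.sum (λ j → χ⁺ (w j)) ℚ.+_) neg-sum ⟩
    Σℚ.sum (λ j → χ⁺ (w j)) ℚ.+ Σℚ.sum (λ j → ℚ.- χ⁻ (w j))
      ≡⟨ Σℚ.∑-distrib-+ (λ j → χ⁺ (w j)) (λ j → ℚ.- χ⁻ (w j)) ⟨
    Σℚ.sum (λ j → χ⁺ (w j) ℚ.- χ⁻ (w j))
      ≡⟨ Σℚ.sum-cong-≗ (λ j → pointwise (w j)) ⟩
    Σℚ.sum (λ j → char₀ X (w j)) ∎
    where
    open ≡-Reasoning
    open +-*-Solver
    w : Fin index → Carrier
    w j = (rep j ⁻¹ ∙ g) ∙ rep j
    χ⁺ χ⁻ : Carrier → ℚ
    χ⁺ h = tr (Induction.ρ₀ H (pos X) h)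
    χ⁻ h = tr (Induction.ρ₀ H (neg X) h)
    neg-sum : ℚ.- Σℚ.sum (λ j → χ⁻ (w j)) ≡ Σℚ.sum (λ j → ℚ.- χ⁻ (w j))
    neg-sum = trans (solve 1 (λ s → :- s := con (ℚ.- 1ℚ) :* s) refl (Σℚ.sum (λ j → χ⁻ (w j))))
      (trans (Σℚ.*-distribˡ-sum (ℚ.- 1ℚ) (λ j → χ⁻ (w j)))
        (Σℚ.sum-cong-≗ (λ j → solve 1 (λ s → con (ℚ.- 1ℚ) :* s := :- s) refl (χ⁻ (w j)))))
    pointwise : ∀ h → χ⁺ h ℚ.- χ⁻ h ≡ char₀ X h
    pointwise h with mem? h
    ... | yes p = refl
    ... | no  _ = trans (cong₂ ℚ._-_ (sum-zero {Rep.dim (pos X)} _ (λ _ → refl)) (sum-zero {Rep.dim (neg X)} _ (λ _ → refl)))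
      refl

-- Coefficient sequences of polynomials

-- Infinite sequences, so that coefficient lists which differ by trailing zeros give the same series
-- up to `≗ˢ`. Bounds on the degree are stated separately where they are used.
Series : Set
Series = ℕ → ℚ

infix 4 _≗ˢ_
_≗ˢ_ : Series → Series → Set
f ≗ˢ h = ∀ i → f i ≡ h i

0ˢ 1ˢ : Series
0ˢ _ = 0ℚ
1ˢ zero    = 1ℚ
1ˢ (suc _) = 0ℚ

infixl 6 _+ˢ_ _-ˢ_
_+ˢ_ _-ˢ_ : Series → Series → Series
(f +ˢ h) i = f i ℚ.+ h i
(f -ˢ h) i = f i ℚ.- h i

shift : ℕ → Series → Series
shift zero    f i       = f i
shift (suc k) f zero    = 0ℚ
shift (suc k) f (suc i) = shift k f i

infixl 7 _*ˢ_
-- The Cauchy product, by the recursion (f₀ + x f′) h = f₀ h + x f′ h.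
_*ˢ_ : Series → Series → Series
(f *ˢ h) zero    = f 0 ℚ.* h 0
(f *ˢ h) (suc i) = f 0 ℚ.* h (suc i) ℚ.+ ((f ∘ suc) *ˢ h) i

shift-cong : ∀ k {f h} → f ≗ˢ h → shift k f ≗ˢ shift k h
shift-cong zero    p i       = p i
shift-cong (suc k) p zero    = refl
shift-cong (suc k) p (suc i) = shift-cong k p i

shift-0 : ∀ k {f} → f ≗ˢ 0ˢ → shift k f ≗ˢ 0ˢ
shift-0 zero    p i       = p i
shift-0 (suc k) p zero    = refl
shift-0 (suc k) p (suc i) = shift-0 k p i

*ˢ-cong : ∀ {f f′ h h′} → f ≗ˢ f′ → h ≗ˢ h′ → f *ˢ h ≗ˢ f′ *ˢ h′
*ˢ-cong p q zero    = cong₂ ℚ._*_ (p 0) (q 0)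
*ˢ-cong p q (suc i) = cong₂ ℚ._+_ (cong₂ ℚ._*_ (p 0) (q (suc i))) (*ˢ-cong (p ∘ suc) q i)

*ˢ-0ˡ : ∀ {f} h → f ≗ˢ 0ˢ → f *ˢ h ≗ˢ 0ˢ
*ˢ-0ˡ h p zero    = trans (cong (ℚ._* h 0) (p 0)) (ℚR.zeroˡ (h 0))
*ˢ-0ˡ h p (suc i) = cong₂ ℚ._+_ (trans (cong (ℚ._* h (suc i)) (p 0)) (ℚR.zeroˡ (h (suc i)))) (*ˢ-0ˡ h (p ∘ suc) i)

*ˢ-0ʳ : ∀ f {h} → h ≗ˢ 0ˢ → f *ˢ h ≗ˢ 0ˢ
*ˢ-0ʳ f p zero    = trans (cong (f 0 ℚ.*_) (p 0)) (ℚR.zeroʳ (f 0))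
*ˢ-0ʳ f p (suc i) = cong₂ ℚ._+_ (trans (cong (f 0 ℚ.*_) (p (suc i))) (ℚR.zeroʳ (f 0))) (*ˢ-0ʳ (f ∘ suc) p i)

module _ {W : FiniteGroup} (g : FiniteGroup.Carrier W) where

  abstract
    charᵍ : grVRep W → Series
    charᵍ p i = charᵛ (coeff p i) g

    charᵍ-coeff : ∀ p i → charᵍ p i ≡ charᵛ (coeff p i) g
    charᵍ-coeff p i = refl

    charᵍ-+ : ∀ p q → charᵍ (p +ᵍ q) ≗ˢ charᵍ p +ˢ charᵍ q
    charᵍ-+ []      q       i       = sym (ℚR.+-identityˡ _)
    charᵍ-+ (X ∷ p) []      zero    = sym (ℚR.+-identityʳ _)
    charᵍ-+ (X ∷ p) []      (suc i) = sym (ℚR.+-identityʳ _)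
    charᵍ-+ (X ∷ p) (Y ∷ q) zero    = charᵛ-+ X Y g
    charᵍ-+ (X ∷ p) (Y ∷ q) (suc i) = charᵍ-+ p q i

    charᵍ-neg : ∀ p i → charᵍ (List.map -ᵛ_ p) i ≡ ℚ.- charᵍ p i
    charᵍ-neg []      i       = refl
    charᵍ-neg (X ∷ p) zero    = charᵛ-neg X g
    charᵍ-neg (X ∷ p) (suc i) = charᵍ-neg p i

    charᵍ-- : ∀ p q → charᵍ (p -ᵍ q) ≗ˢ charᵍ p -ˢ charᵍ q
    charᵍ-- p q i = trans (charᵍ-+ p (List.map -ᵛ_ q) i) (cong (charᵍ p i ℚ.+_) (charᵍ-neg q i))

    charᵍ-shift : ∀ k p → charᵍ (x^ k · p) ≗ˢ shift k (charᵍ p)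
    charᵍ-shift zero    p i       = refl
    charᵍ-shift (suc k) p zero    = refl
    charᵍ-shift (suc k) p (suc i) = charᵍ-shift k p i

    charᵍ-0 : charᵍ 0ᵍ ≗ˢ 0ˢ
    charᵍ-0 i = refl

    charᵍ-1 : charᵍ 1ᵍ ≗ˢ 1ˢ
    charᵍ-1 zero    = refl
    charᵍ-1 (suc i) = refl

    charᵍ-sum : ∀ {A : Set} (f : A → grVRep W) xs i →
                charᵍ (sumᵍ (List.map f xs)) i ≡ Σℚ.sum (λ k → charᵍ (f (List.lookup xs k)) i)
    charᵍ-sum f []       i = refl
    charᵍ-sum f (x ∷ xs) i = trans (charᵍ-+ (f x) (sumᵍ (List.map f xs)) i)
      (cong (charᵍ (f x) i ℚ.+_) (charᵍ-sum f xs i))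

    charᵍ-cong : ∀ {p q} → p ≈ᵍ q → charᵍ p ≗ˢ charᵍ q
    charᵍ-cong p≈q i = ≈ᵛ⇒charᵛ (p≈q i) g

abstract
  charᵍ-⊗ : {G H : FiniteGroup} (p : grVRep G) (q : grVRep H) → ∀ g h →
            charᵍ (g , h) (p ⊗ᵍ q) ≗ˢ charᵍ g p *ˢ charᵍ h q
  charᵍ-⊗ []      q g h i = sym (*ˢ-0ˡ (charᵍ h q) (λ _ → refl) i)
  charᵍ-⊗ {G} {H} (X ∷ p) q g h i = trans
    (charᵍ-+ (g , h) (List.map (X ⊗ᵛ_) q) (x^ 1 · (p ⊗ᵍ q)) i) (step i)
    where
    row : ∀ (q : grVRep H) i → charᵍ (g , h) (List.map (X ⊗ᵛ_) q) i ≡ charᵛ X g ℚ.* charᵍ h q i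
    row []      i       = sym (ℚR.zeroʳ (charᵛ X g))
    row (Y ∷ q) zero    = charᵛ-⊗ X Y g h
    row (Y ∷ q) (suc i) = row q i
    step : ∀ i → charᵍ {G ×ᴳ H} (g , h) (List.map (X ⊗ᵛ_) q) i ℚ.+ charᵍ (g , h) (x^ 1 · (p ⊗ᵍ q)) i ≡
                 (charᵍ g (X ∷ p) *ˢ charᵍ h q) i
    step zero    = trans (ℚR.+-identityʳ (charᵍ (g , h) (List.map (X ⊗ᵛ_) q) 0)) (row q 0)
    step (suc i) = cong₂ ℚ._+_ (row q (suc i)) (charᵍ-⊗ p q g h i)

abstract
  charᵍ-map : {G W : FiniteGroup} (g : FiniteGroup.Carrier W) (φ : VRep G → VRep W) (χ : VRep G → ℚ) →
              (∀ X → charᵛ (φ X) g ≡ χ X) → χ 0ᵛ ≡ 0ℚ →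
              ∀ p i → charᵍ {W} g (List.map φ p) i ≡ χ (coeff p i)
  charᵍ-map g φ χ eq χ0 []      i       = sym χ0
  charᵍ-map g φ χ eq χ0 (X ∷ p) zero    = eq X
  charᵍ-map g φ χ eq χ0 (X ∷ p) (suc i) = charᵍ-map g φ χ eq χ0 p i

module _ {W : FiniteGroup} (H : Subgroup W) where
  open FiniteGroup W using (Carrier; _∙_; _⁻¹)
  open InducedCharacter H

  abstract
    char₀ᵍ : grVRep (Subgroup.finiteGroup H) → Carrier → Series
    char₀ᵍ p w i = char₀ (coeff p i) w

    char₀ᵍ-∈ : ∀ p {w} (q : Subgroup.Mem H w) → char₀ᵍ p w ≗ˢ charᵍ (w , q) p
    char₀ᵍ-∈ p {w} q i with Subgroup.mem? H w
    ... | yes _ = charᵛ-cong (coeff p i) (FiniteGroup.refl W)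
    ... | no ¬q = contradiction q ¬q

    char₀ᵍ-∉ : ∀ p {w} → ¬ Subgroup.Mem H w → char₀ᵍ p w ≗ˢ 0ˢ
    char₀ᵍ-∉ p {w} ¬q i with Subgroup.mem? H w
    ... | yes q = contradiction q ¬q
    ... | no _  = refl

  ind-char : Carrier → VRep (Subgroup.finiteGroup H) → ℚ
  ind-char g X = Σℚ.sum (λ j → char₀ X ((rep j ⁻¹ ∙ g) ∙ rep j))

  ind-char-0 : ∀ g → ind-char g 0ᵛ ≡ 0ℚ
  ind-char-0 g = sum-zero {index} _ (λ j → zero-char ((rep j ⁻¹ ∙ g) ∙ rep j))
    where
    zero-char : ∀ w → char₀ 0ᵛ w ≡ 0ℚ
    zero-char w with Subgroup.mem? H w
    ... | yes _ = refl
    ... | no  _ = refl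

  abstract
    ind-char-coeff : ∀ g p i → ind-char g (coeff p i) ≡ Σℚ.sum (λ j → char₀ᵍ p ((rep j ⁻¹ ∙ g) ∙ rep j) i)
    ind-char-coeff g p i = refl

-- Finite sums and their reindexing

record Enumeration (X : Set) : Set where
  field
    card      : ℕ
    enum      : Fin card → X
    code      : X → Fin card
    enum-code : ∀ x → enum (code x) ≡ x
    code-enum : ∀ i → code (enum i) ≡ i

  ∑ : (X → ℚ) → ℚ
  ∑ f = Σℚ.sum (f ∘ enum)

  ∑-cong : ∀ {f h} → (∀ x → f x ≡ h x) → ∑ f ≡ ∑ h
  ∑-cong p = Σℚ.sum-cong-≗ (p ∘ enum)

  ∑-zero : ∀ f → (∀ x → f x ≡ 0ℚ) → ∑ f ≡ 0ℚ
  ∑-zero f p = sum-zero (f ∘ enum) (p ∘ enum)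

  ∑-+ : ∀ f h → ∑ (λ x → f x ℚ.+ h x) ≡ ∑ f ℚ.+ ∑ h
  ∑-+ f h = Σℚ.∑-distrib-+ (f ∘ enum) (h ∘ enum)

  ∑-*ˡ : ∀ c f → c ℚ.* ∑ f ≡ ∑ (λ x → c ℚ.* f x)
  ∑-*ˡ c f = Σℚ.*-distribˡ-sum c (f ∘ enum)

  ∑-*ʳ : ∀ c f → ∑ f ℚ.* c ≡ ∑ (λ x → f x ℚ.* c)
  ∑-*ʳ c f = Σℚ.*-distribʳ-sum c (f ∘ enum)

  ∑-- : ∀ f h → ∑ (λ x → f x ℚ.- h x) ≡ ∑ f ℚ.- ∑ h
  ∑-- f h = begin
    ∑ (λ x → f x ℚ.- h x)
      ≡⟨ solve 2 (λ d b → d := (d :+ b) :- b) refl (∑ (λ x → f x ℚ.- h x)) (∑ h) ⟩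
    (∑ (λ x → f x ℚ.- h x) ℚ.+ ∑ h) ℚ.- ∑ h
      ≡⟨ cong (ℚ._- ∑ h) (∑-+ (λ x → f x ℚ.- h x) h) ⟨
    ∑ (λ x → (f x ℚ.- h x) ℚ.+ h x) ℚ.- ∑ h
      ≡⟨ cong (ℚ._- ∑ h) (∑-cong (λ x → solve 2 (λ a b → (a :- b) :+ b := a) refl (f x) (h x))) ⟩
    ∑ f ℚ.- ∑ h ∎
    where
    open ≡-Reasoning
    open +-*-Solver

  ∑-single : ∀ f x → (∀ y → y ≢ x → f y ≡ 0ℚ) → ∑ f ≡ f x
  ∑-single f x p = trans
    (sum-single (f ∘ enum) (code x) (λ j j≢ → p (enum j) (λ q → j≢ (trans (sym (code-enum j)) (cong code q)))))
    (cong f (enum-code x))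

module _ {X Y : Set} (EX : Enumeration X) (EY : Enumeration Y) where
  private
    module X = Enumeration EX
    module Y = Enumeration EY

  ∑-comm : (f : X → Y → ℚ) → X.∑ (λ x → Y.∑ (f x)) ≡ Y.∑ (λ y → X.∑ (λ x → f x y))
  ∑-comm f = Σℚ.∑-comm (λ i j → f (X.enum i) (Y.enum j))

  -- Both sums equal the sum over all pairs (x , φ x) of a x.
  ∑-reindex : (a : X → ℚ) (b : Y → ℚ) (φ : X → Y) (ψ : Y → X) →
              (∀ x → a x ≢ 0ℚ → b (φ x) ≡ a x × ψ (φ x) ≡ x) →
              (∀ y → b y ≢ 0ℚ → a (ψ y) ≡ b y × φ (ψ y) ≡ y) →
              X.∑ a ≡ Y.∑ b
  ∑-reindex a b φ ψ to from = begin
    X.∑ a                                ≡⟨ X.∑-cong row ⟨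
    X.∑ (λ x → Y.∑ (λ y → cell x y))     ≡⟨ ∑-comm cell ⟩
    Y.∑ (λ y → X.∑ (λ x → cell x y))     ≡⟨ Y.∑-cong column ⟩
    Y.∑ b                                ∎
    where
    open ≡-Reasoning
    _≟_ : (y y′ : Y) → Dec (y ≡ y′)
    y ≟ y′ with Y.code y Fin.≟ Y.code y′
    ... | yes p = yes (trans (sym (Y.enum-code y)) (trans (cong Y.enum p) (Y.enum-code y′)))
    ... | no ¬p = no (¬p ∘ cong Y.code)
    cell : X → Y → ℚ
    cell x y with φ x ≟ y
    ... | yes _ = a x
    ... | no  _ = 0ℚ
    cell-≡ : ∀ {x y} → φ x ≡ y → cell x y ≡ a x
    cell-≡ {x} {y} p with φ x ≟ y
    ... | yes _ = refl
    ... | no ¬p = contradiction p ¬p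
    cell-≢ : ∀ {x y} → (φ x ≡ y → a x ≡ 0ℚ) → cell x y ≡ 0ℚ
    cell-≢ {x} {y} p with φ x ≟ y
    ... | yes q = p q
    ... | no  _ = refl
    row : ∀ x → Y.∑ (cell x) ≡ a x
    row x = trans (Y.∑-single (cell x) (φ x) (λ y y≢ → cell-≢ (λ q → contradiction (sym q) y≢))) (cell-≡ refl)
    column : ∀ y → X.∑ (λ x → cell x y) ≡ b y
    column y with b y ℚₚ.≟ 0ℚ
    ... | yes b≡0 = trans (X.∑-zero (λ x → cell x y) λ x → cell-≢ λ { refl → decidable-stable (a x ℚₚ.≟ 0ℚ)
                      (λ a≢0 → a≢0 (trans (sym (proj₁ (to x a≢0))) b≡0)) }) (sym b≡0)
    ... | no b≢0 = trans (X.∑-single (λ x → cell x y) (ψ y) λ x x≢ → cell-≢ λ { refl → decidable-stable (a x ℚₚ.≟ 0ℚ)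
                      (λ a≢0 → x≢ (sym (proj₂ (to x a≢0)))) })
                    (trans (cell-≡ (proj₂ (from y b≢0))) (proj₁ (from y b≢0)))

  pairs : Enumeration (X × Y)
  pairs = record
    { card = X.card ℕ.* Y.card
    ; enum = λ i → X.enum (proj₁ (remQuot {X.card} Y.card i)) , Y.enum (proj₂ (remQuot {X.card} Y.card i))
    ; code = λ { (x , y) → combine (X.code x) (Y.code y) }
    ; enum-code = λ { (x , y) → trans
        (cong (λ z → X.enum (proj₁ z) , Y.enum (proj₂ z)) (Fin.remQuot-combine (X.code x) (Y.code y)))
        (cong₂ _,_ (X.enum-code x) (Y.enum-code y)) }
    ; code-enum = λ i → trans (cong₂ combine (X.code-enum _) (Y.code-enum _)) (Fin.combine-remQuot {X.card} Y.card i)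
    }

  ∑-pairs : (f : X → Y → ℚ) → X.∑ (λ x → Y.∑ (f x)) ≡ Enumeration.∑ pairs (λ z → f (proj₁ z) (proj₂ z))
  ∑-pairs f = sym (trans (sum-* X.card {Y.card} _) (Σℚ.sum-cong-≗ {X.card} λ i → Σℚ.sum-cong-≗ {Y.card} λ j →
    cong (λ z → f (X.enum (proj₁ z)) (Y.enum (proj₂ z))) (Fin.remQuot-combine {X.card} {Y.card} i j)))

subsetEnumeration : ∀ n → Enumeration (Subset n)
subsetEnumeration zero = record
  { card = 1 ; enum = λ _ → [] ; code = λ _ → zero ; enum-code = λ { [] → refl } ; code-enum = λ { zero → refl } }
subsetEnumeration (suc n) = record
  { card = card ℕ.+ card
  ; enum = λ i → branch (splitAt card i)
  ; code = code′
  ; enum-code = λ where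
      (inside  ∷ S) → trans (cong branch (Fin.splitAt-↑ˡ card (code S) card)) (cong (inside ∷_) (enum-code S))
      (outside ∷ S) → trans (cong branch (Fin.splitAt-↑ʳ card card (code S))) (cong (outside ∷_) (enum-code S))
  ; code-enum = λ i → trans (code-branch (splitAt card i)) (Fin.join-splitAt card card i)
  }
  where
  open Enumeration (subsetEnumeration n)
  branch : Fin card ⊎ Fin card → Subset (suc n)
  branch (inj₁ i) = inside ∷ enum i
  branch (inj₂ i) = outside ∷ enum i
  code′ : Subset (suc n) → Fin (card ℕ.+ card)
  code′ (inside  ∷ S) = code S ↑ˡ card
  code′ (outside ∷ S) = card ↑ʳ code S
  code-branch : ∀ s → code′ (branch s) ≡ join card card s
  code-branch (inj₁ i) = cong (_↑ˡ card) (code-enum i)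
  code-branch (inj₂ i) = cong (card ↑ʳ_) (code-enum i)

module ∑ {n} = Enumeration (subsetEnumeration n)

∑ˢ : (Subset n → Series) → Series
∑ˢ f i = ∑.∑ (λ F → f F i)

∑ˢ-*ʳ : (f : Subset n → Series) (h : Series) → ∑ˢ f *ˢ h ≗ˢ ∑ˢ (λ F → f F *ˢ h)
∑ˢ-*ʳ f h zero    = ∑.∑-*ʳ (h 0) (λ F → f F 0)
∑ˢ-*ʳ f h (suc i) = trans
  (cong₂ ℚ._+_ (∑.∑-*ʳ (h (suc i)) (λ F → f F 0)) (∑ˢ-*ʳ (λ F → f F ∘ suc) h i))
  (sym (∑.∑-+ (λ F → f F 0 ℚ.* h (suc i)) (λ F → ((f F ∘ suc) *ˢ h) i)))

∑ˢ-*ˡ : (f : Series) (h : Subset n → Series) → f *ˢ ∑ˢ h ≗ˢ ∑ˢ (λ F → f *ˢ h F)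
∑ˢ-*ˡ f h zero    = ∑.∑-*ˡ (f 0) (λ F → h F 0)
∑ˢ-*ˡ f h (suc i) = trans
  (cong₂ ℚ._+_ (∑.∑-*ˡ (f 0) (λ F → h F (suc i))) (∑ˢ-*ˡ (f ∘ suc) h i))
  (sym (∑.∑-+ (λ F → f 0 ℚ.* h F (suc i)) (λ F → ((f ∘ suc) *ˢ h F) i)))

*ˢ-identityˡ : ∀ h → 1ˢ *ˢ h ≗ˢ h
*ˢ-identityˡ h zero    = ℚR.*-identityˡ (h 0)
*ˢ-identityˡ h (suc i) = trans (cong₂ ℚ._+_ (ℚR.*-identityˡ (h (suc i))) (*ˢ-0ˡ h (λ _ → refl) i)) (ℚR.+-identityʳ (h (suc i)))

*ˢ-identityʳ : ∀ f → f *ˢ 1ˢ ≗ˢ f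
*ˢ-identityʳ f zero    = ℚR.*-identityʳ (f 0)
*ˢ-identityʳ f (suc i) = trans (cong₂ ℚ._+_ (ℚR.zeroʳ (f 0)) (*ˢ-identityʳ (f ∘ suc) i)) (ℚR.+-identityˡ (f (suc i)))

shift-*ˡ : ∀ a f h → shift a f *ˢ h ≗ˢ shift a (f *ˢ h)
shift-*ˡ zero    f h i       = *ˢ-cong {shift 0 f} {f} {h} {h} (λ _ → refl) (λ _ → refl) i
shift-*ˡ (suc a) f h zero    = ℚR.zeroˡ (h 0)
shift-*ˡ (suc a) f h (suc i) = trans (cong (ℚ._+ (shift a f *ˢ h) i) (ℚR.zeroˡ (h (suc i))))
  (trans (ℚR.+-identityˡ _) (shift-*ˡ a f h i))

shift-shift : ∀ a b f → shift a (shift b f) ≗ˢ shift (a ℕ.+ b) f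
shift-shift zero    b f i       = refl
shift-shift (suc a) b f zero    = refl
shift-shift (suc a) b f (suc i) = shift-shift a b f i

shift-suc : ∀ a f → shift (suc a) f ≗ˢ shift 1 (shift a f)
shift-suc a f zero    = refl
shift-suc a f (suc i) = refl

shift-*ʳ : ∀ b f h → f *ˢ shift b h ≗ˢ shift b (f *ˢ h)
shift-*ʳ zero    f h i = *ˢ-cong {f} {f} {shift 0 h} {h} (λ _ → refl) (λ _ → refl) i
shift-*ʳ (suc b) f h i = trans (*ˢ-cong {f} {f} (λ _ → refl) (shift-suc b h) i)
  (trans (one f (shift b h) i) (trans (shift-cong 1 (shift-*ʳ b f h) i) (sym (shift-suc b (f *ˢ h) i))))
  where
  one : ∀ f h → f *ˢ shift 1 h ≗ˢ shift 1 (f *ˢ h)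
  one f h zero          = ℚR.zeroʳ (f 0)
  one f h (suc zero)    = trans (cong (f 0 ℚ.* h 0 ℚ.+_) (one (f ∘ suc) h zero)) (ℚR.+-identityʳ _)
  one f h (suc (suc i)) = cong (f 0 ℚ.* h (suc i) ℚ.+_) (one (f ∘ suc) h (suc i))

shift-*ˢ : ∀ a b f h → shift a f *ˢ shift b h ≗ˢ shift (a ℕ.+ b) (f *ˢ h)
shift-*ˢ a b f h i = trans (shift-*ˡ a f (shift b h) i)
  (trans (shift-cong a (shift-*ʳ b f h) i) (shift-shift a b (f *ˢ h) i))

shift-<  : ∀ {a k} f → k < a → shift a f k ≡ 0ℚ
shift-< {suc a} {zero}  f _         = refl
shift-< {suc a} {suc k} f (s≤s k<a) = shift-< f k<a

shift-+ : ∀ a k f → shift a f (a ℕ.+ k) ≡ f k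
shift-+ zero    k f = refl
shift-+ (suc a) k f = shift-+ a k f

*ˢ-vanish : ∀ f h k → (∀ i j → i ℕ.+ j ≡ k → f i ≡ 0ℚ ⊎ h j ≡ 0ℚ) → (f *ˢ h) k ≡ 0ℚ
*ˢ-vanish f h k p = go k f p
  where
  product : ∀ {x y} → x ≡ 0ℚ ⊎ y ≡ 0ℚ → x ℚ.* y ≡ 0ℚ
  product {y = y} (inj₁ refl) = ℚR.zeroˡ y
  product {x}     (inj₂ refl) = ℚR.zeroʳ x
  go : ∀ k f → (∀ i j → i ℕ.+ j ≡ k → f i ≡ 0ℚ ⊎ h j ≡ 0ℚ) → (f *ˢ h) k ≡ 0ℚ
  go zero    f p = product (p 0 0 refl)
  go (suc k) f p = cong₂ ℚ._+_ (product (p 0 (suc k) refl)) (go k (f ∘ suc) (λ i j q → p (suc i) j (cong suc q)))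

-- Degree bounds and palindromic polynomials

LowDegree : ℕ → Series → Set
LowDegree r f = ∀ i → r ≤ 2 ℕ.* i → f i ≡ 0ℚ

-- Twice the degrees of the factors are at most a - 1 and b - 1, so twice the degree of the product
-- is at most a + b - 2. The unit gained over the bound for a + b pays for the factor x in the
-- theorem.
*ˢ-lowDegree : ∀ {a b f h} → LowDegree a f → LowDegree b h → ∀ k → a ℕ.+ b ≤ suc (2 ℕ.* k) → (f *ˢ h) k ≡ 0ℚ
*ˢ-lowDegree {a} {b} {f} {h} p q k a+b≤ = *ˢ-vanish f h k λ i j i+j≡k → aux i j i+j≡k (a ℕ.≤? 2 ℕ.* i)
  where
  aux : ∀ i j → i ℕ.+ j ≡ k → Dec (a ≤ 2 ℕ.* i) → f i ≡ 0ℚ ⊎ h j ≡ 0ℚ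
  aux i j i+j≡k (yes a≤) = inj₁ (p i a≤)
  aux i j refl  (no a≰)  = inj₂ (q j (ℕ.+-cancelˡ-≤ (suc (2 ℕ.* i)) b (2 ℕ.* j) (begin
    suc (2 ℕ.* i) ℕ.+ b       ≤⟨ ℕ.+-monoˡ-≤ b (ℕ.≰⇒> a≰) ⟩
    a ℕ.+ b                   ≤⟨ a+b≤ ⟩
    suc (2 ℕ.* (i ℕ.+ j))     ≡⟨ cong suc (ℕ.*-distribˡ-+ 2 i j) ⟩
    suc (2 ℕ.* i) ℕ.+ 2 ℕ.* j ∎)))
    where open ℕ.≤-Reasoning

record Palindromic (d : ℕ) (f : Series) : Set where
  field
    symmetric : ∀ j → j ≤ d → f j ≡ f (d ℕ.∸ j)
    bounded   : ∀ j → d < j → f j ≡ 0ℚ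
open Palindromic

palindromic-cong : ∀ {d f h} → f ≗ˢ h → Palindromic d f → Palindromic d h
palindromic-cong {d} p f-pal = record
  { symmetric = λ j j≤d → trans (sym (p j)) (trans (symmetric f-pal j j≤d) (p (d ℕ.∸ j)))
  ; bounded   = λ j d<j → trans (sym (p j)) (bounded f-pal j d<j)
  }

palindromic-- : ∀ {d f h} → Palindromic d f → Palindromic d h → Palindromic d (f -ˢ h)
palindromic-- f-pal h-pal = record
  { symmetric = λ j j≤d → cong₂ ℚ._-_ (symmetric f-pal j j≤d) (symmetric h-pal j j≤d)
  ; bounded   = λ j d<j → cong₂ ℚ._-_ (bounded f-pal j d<j) (bounded h-pal j d<j)
  }

-- Of `j` and `r ∸ j`, one is at least r/2, and the two coefficients are equal. This closes each of
-- the inductions on Kazhdan-Lusztig polynomials below.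
palindromic-lowDegree : ∀ {r f} → Palindromic r f → LowDegree r f → f ≗ˢ 0ˢ
palindromic-lowDegree {r} {f} f-pal low j with r ℕ.≤? 2 ℕ.* j
... | yes r≤2j = low j r≤2j
... | no r≰2j = trans (symmetric f-pal j j≤r) (low (r ℕ.∸ j) r≤)
  where
  open ℕ.≤-Reasoning
  2j≤r : 2 ℕ.* j ≤ r
  2j≤r = ℕ.<⇒≤ (ℕ.≰⇒> r≰2j)
  j≤r : j ≤ r
  j≤r = ℕ.≤-trans (ℕ.m≤m+n j _) 2j≤r
  r≤ : r ≤ 2 ℕ.* (r ℕ.∸ j)
  r≤ = begin
    r                                   ≡⟨ ℕ.m+n∸n≡m r r ⟨
    r ℕ.+ r ℕ.∸ r                       ≤⟨ ℕ.∸-monoʳ-≤ (r ℕ.+ r) 2j≤r ⟩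
    r ℕ.+ r ℕ.∸ 2 ℕ.* j                 ≡⟨ cong (λ z → r ℕ.+ z ℕ.∸ 2 ℕ.* j) (sym (ℕ.+-identityʳ r)) ⟩
    2 ℕ.* r ℕ.∸ 2 ℕ.* j                 ≡⟨ ℕ.*-distribˡ-∸ 2 r j ⟨
    2 ℕ.* (r ℕ.∸ j)                     ∎

-- With `shift` supplying zeros, the convolution becomes a sum over a range that does not depend on
-- `k`; such a sum can be reversed, as the palindromicity of a product requires.
*ˢ-sum : ∀ N f h → (∀ i → N ≤ i → f i ≡ 0ℚ) → ∀ k →
         (f *ˢ h) k ≡ Σℚ.sum {N} (λ i → f (toℕ i) ℚ.* shift (toℕ i) h k)
*ˢ-sum zero    f h p k       = *ˢ-0ˡ h (λ i → p i z≤n) k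
*ˢ-sum (suc N) f h p zero    = sym (trans (cong (f 0 ℚ.* h 0 ℚ.+_)
  (sum-zero {N} _ (λ i → ℚR.zeroʳ (f (suc (toℕ i)))))) (ℚR.+-identityʳ _))
*ˢ-sum (suc N) f h p (suc k) = cong (f 0 ℚ.* h (suc k) ℚ.+_) (*ˢ-sum N (f ∘ suc) h (λ i N≤i → p (suc i) (s≤s N≤i)) k)

-- Reflecting x^i h in total degree i + c + e gives x^c h. When `k` is below `i` or above i + e, a
-- zero before the start of one series corresponds to a zero beyond the degree of the other.
shift-reflect : ∀ {e h} → Palindromic e h → ∀ i c k → k ≤ (i ℕ.+ c) ℕ.+ e →
                shift i h k ≡ shift c h ((i ℕ.+ c) ℕ.+ e ℕ.∸ k)
shift-reflect {e} {h} h-pal i c k k≤ with i ℕ.≤? k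
... | no i≰k with b , refl ← ℕ.m≤n⇒∃[o]m+o≡n (ℕ.≰⇒> i≰k) = trans (shift-< h (ℕ.≰⇒> i≰k))
      (sym (trans (cong (shift c h) target) (trans (shift-+ c (suc b ℕ.+ e) h) (bounded h-pal _ (s≤s (ℕ.m≤n+m e b))))))
  where
  open ≡-Reasoning
  target : (suc k ℕ.+ b ℕ.+ c) ℕ.+ e ℕ.∸ k ≡ c ℕ.+ (suc b ℕ.+ e)
  target = begin
    (suc k ℕ.+ b ℕ.+ c) ℕ.+ e ℕ.∸ k   ≡⟨ cong (ℕ._∸ k)
      (solve 4 (λ k b c e → (con 1 :+ k :+ b :+ c) :+ e := k :+ (c :+ (con 1 :+ b :+ e))) refl k b c e) ⟩
    k ℕ.+ (c ℕ.+ (suc b ℕ.+ e)) ℕ.∸ k ≡⟨ ℕ.m+n∸m≡n k _ ⟩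
    c ℕ.+ (suc b ℕ.+ e)               ∎
    where open Data.Nat.Solver.+-*-Solver
... | yes i≤k with m , refl ← ℕ.m≤n⇒∃[o]m+o≡n i≤k = trans (shift-+ i m h) (aux (m ℕ.≤? e))
  where
  open ≡-Reasoning
  target : (i ℕ.+ c) ℕ.+ e ℕ.∸ (i ℕ.+ m) ≡ c ℕ.+ e ℕ.∸ m
  target = trans (cong (ℕ._∸ (i ℕ.+ m)) (ℕ.+-assoc i c e)) (ℕ.[m+n]∸[m+o]≡n∸o i (c ℕ.+ e) m)
  m≤c+e : m ≤ c ℕ.+ e
  m≤c+e = ℕ.+-cancelˡ-≤ i m (c ℕ.+ e) (ℕ.≤-trans k≤ (ℕ.≤-reflexive (ℕ.+-assoc i c e)))
  aux : Dec (m ≤ e) → h m ≡ shift c h ((i ℕ.+ c) ℕ.+ e ℕ.∸ (i ℕ.+ m))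
  aux (yes m≤e) = begin
    h m                           ≡⟨ symmetric h-pal m m≤e ⟩
    h (e ℕ.∸ m)                   ≡⟨ shift-+ c (e ℕ.∸ m) h ⟨
    shift c h (c ℕ.+ (e ℕ.∸ m))   ≡⟨ cong (shift c h) (trans target (ℕ.+-∸-assoc c m≤e)) ⟨
    shift c h _                   ∎
  aux (no m≰e) = trans (bounded h-pal m (ℕ.≰⇒> m≰e)) (sym (trans (cong (shift c h) target) (shift-< h
    (ℕ.+-cancelʳ-< m _ c (ℕ.≤-trans (ℕ.≤-reflexive (cong suc (ℕ.m∸n+n≡m m≤c+e)))
      (ℕ.≤-trans (ℕ.≤-reflexive (sym (ℕ.+-suc c e))) (ℕ.+-monoʳ-≤ c (ℕ.≰⇒> m≰e))))))))

palindromic-* : ∀ {d e f h} → Palindromic d f → Palindromic e h → Palindromic (d ℕ.+ e) (f *ˢ h)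
palindromic-* {d} {e} {f} {h} f-pal h-pal = record
  { symmetric = λ k k≤ → begin
      (f *ˢ h) k
        ≡⟨ *ˢ-sum (suc d) f h (λ i → bounded f-pal i) k ⟩
      Σℚ.sum {suc d} (λ i → f (toℕ i) ℚ.* shift (toℕ i) h k)
        ≡⟨ Σℚ.sum-cong-≗ {suc d} (λ i → cong₂ ℚ._*_ (reflect-f i) (reflect-h i k k≤)) ⟩
      Σℚ.sum {suc d} (λ i → term (d ℕ.+ e ℕ.∸ k) (opposite i))
        ≡⟨ Σℚ.sum-permute (term (d ℕ.+ e ℕ.∸ k)) Perm.reverse ⟨
      Σℚ.sum {suc d} (term (d ℕ.+ e ℕ.∸ k))
        ≡⟨ *ˢ-sum (suc d) f h (λ i → bounded f-pal i) (d ℕ.+ e ℕ.∸ k) ⟨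
      (f *ˢ h) (d ℕ.+ e ℕ.∸ k) ∎
  ; bounded   = λ k d+e<k → *ˢ-vanish f h k λ i j i+j≡k → vanish i j k i+j≡k d+e<k (i ℕ.≤? d)
  }
  where
  open ≡-Reasoning
  term : ℕ → Fin (suc d) → ℚ
  term k i = f (toℕ i) ℚ.* shift (toℕ i) h k
  toℕ≤d : (i : Fin (suc d)) → toℕ i ≤ d
  toℕ≤d i = ℕ.≤-pred (Fin.toℕ<n i)
  reflect-f : ∀ i → f (toℕ i) ≡ f (toℕ (opposite i))
  reflect-f i = trans (symmetric f-pal (toℕ i) (toℕ≤d i)) (cong f (sym (Fin.opposite-prop i)))
  reflect-h : ∀ i k → k ≤ d ℕ.+ e → shift (toℕ i) h k ≡ shift (toℕ (opposite i)) h (d ℕ.+ e ℕ.∸ k)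
  reflect-h i k k≤ = trans
    (shift-reflect h-pal (toℕ i) (d ℕ.∸ toℕ i) k (ℕ.≤-trans k≤ (ℕ.≤-reflexive (cong (ℕ._+ e) (sym split)))))
    (cong₂ (λ c s → shift c h (s ℕ.+ e ℕ.∸ k)) (sym (Fin.opposite-prop i)) split)
    where
    split : toℕ i ℕ.+ (d ℕ.∸ toℕ i) ≡ d
    split = ℕ.m+[n∸m]≡n (toℕ≤d i)
  vanish : ∀ i j k → i ℕ.+ j ≡ k → d ℕ.+ e < k → Dec (i ≤ d) → f i ≡ 0ℚ ⊎ h j ≡ 0ℚ
  vanish i j k p d+e<k (no i≰d)  = inj₁ (bounded f-pal i (ℕ.≰⇒> i≰d))
  vanish i j k p d+e<k (yes i≤d) = inj₂ (bounded h-pal j (ℕ.+-cancelˡ-< d e j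
    (ℕ.<-≤-trans d+e<k (ℕ.≤-trans (ℕ.≤-reflexive (sym p)) (ℕ.+-monoˡ-≤ j i≤d)))))

private
  variable
    x y e : Fin n
    F F₁ F₂ I J K S T G₁ G₂ : Subset n

-- Rank, contraction and isomorphism of matroids

∈-subsets : (S : Subset n) → S ∈ₗ subsets n
∈-subsets []            = here refl
∈-subsets (inside  ∷ S) = Membershipₚ.∈-++⁺ˡ (Membershipₚ.∈-map⁺ (inside ∷_) (∈-subsets S))
∈-subsets {suc n} (outside ∷ S) =
  Membershipₚ.∈-++⁺ʳ (List.map (inside ∷_) (subsets n)) (Membershipₚ.∈-map⁺ (outside ∷_) (∈-subsets S))

∈-∪ˡ : x ∈ S → x ∈ S ∪ T
∈-∪ˡ p = x∈p∪q⁺ (inj₁ p)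

∈-∪ʳ : x ∈ T → x ∈ S ∪ T
∈-∪ʳ p = x∈p∪q⁺ (inj₂ p)

∪-elim : ∀ {P : Set} → (x ∈ S → P) → (x ∈ T → P) → x ∈ S ∪ T → P
∪-elim {S = S} {T} f h p = [ f , h ]′ (x∈p∪q⁻ S T p)

⊈⇒∃ : ¬ S ⊆ T → ∃ λ x → x ∈ S × x ∉ T
⊈⇒∃ {S = S} {T} ¬p with Fin.any? (λ x → (x ∈? S) ×-dec ¬? (x ∈? T))
... | yes w   = w
... | no none = contradiction (λ {x} x∈S → decidable-stable (x ∈? T) (λ x∉T → none (x , x∈S , x∉T))) ¬p

module Rank (M : Matroid n) where
  open Matroid M
  open IsBasisOf

  indep≤rank : Indep I → I ⊆ S → ∣ I ∣ ≤ rank S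
  indep≤rank {I = I} {S} ind I⊆S = Extrema.v≤max⁺ 0 _ (inj₂ (Any.map (λ { refl → ℕ.≤-refl })
    (Membershipₚ.∈-map⁺ ∣_∣ (Membershipₚ.∈-filter⁺ (λ I → indep? I ×-dec (I ⊆? S)) (∈-subsets I) (ind , I⊆S)))))

  indep≤basis : IsBasisOf S J → Indep I → I ⊆ S → ∣ I ∣ ≤ ∣ J ∣
  indep≤basis b ind I⊆S with K , I⊆K , c ← extend ind I⊆S = ℕ.≤-trans (p⊆q⇒∣p∣≤∣q∣ I⊆K) (basis-≤ b c)

  rank≡∣basis∣ : IsBasisOf S J → rank S ≡ ∣ J ∣
  rank≡∣basis∣ {S = S} {J} b = ℕ.≤-antisym
    (Extrema.max≤v⁺ z≤n (Allₚ.map⁺ (All.map (λ { (ind , I⊆S) → indep≤basis b ind I⊆S })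
      (Allₚ.all-filter (λ I → indep? I ×-dec (I ⊆? S)) (subsets n)))))
    (indep≤rank (indep b) (subset b))

  indep-rank : Indep I → rank I ≡ ∣ I ∣
  indep-rank ind = rank≡∣basis∣ record { indep = ind ; subset = λ p → p ; maximal = λ p _ → p }

  rank-⊥ : rank ⊥ ≡ 0
  rank-⊥ = trans (indep-rank empty) (∣⊥∣≡0 n)

  rank≤∣∣ : ∀ S → rank S ≤ ∣ S ∣
  rank≤∣∣ S with B , _ , b ← extend {S = S} empty ⊥⊆ =
    ℕ.≤-trans (ℕ.≤-reflexive (rank≡∣basis∣ b)) (p⊆q⇒∣p∣≤∣q∣ (subset b))

  basis-exists : ∀ S → ∃ (IsBasisOf S)
  basis-exists S = let B , _ , b = extend {S = S} empty ⊥⊆ in B , b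

  -- Extend K to a basis of K ∪ I; it contains all of I because it is as large as J ∪ I.
  basis-exchange : IsBasisOf F J → IsBasisOf F K → (∀ x → x ∈ I → x ∉ F) → Indep (I ∪ J) → Indep (I ∪ K)
  basis-exchange {F = F} {J} {K} {I} bJ bK I∩F ind
    with L , K⊆L , bL ← extend {S = I ∪ K} (indep bK) ∈-∪ʳ
    with ∣ I ∪ J ∣ ℕ.≤? ∣ L ∣
  ... | yes le = heredity ⊆L (indep bL)
    where
    I∪K≤L : ∣ I ∪ K ∣ ≤ ∣ L ∣
    I∪K≤L = begin
      ∣ I ∪ K ∣           ≡⟨ ∣A∪B∣ I K (λ x x∈I x∈K → I∩F x x∈I (subset bK x∈K)) ⟩
      ∣ I ∣ ℕ.+ ∣ K ∣     ≤⟨ ℕ.+-monoʳ-≤ ∣ I ∣ (basis-≤ bJ bK) ⟩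
      ∣ I ∣ ℕ.+ ∣ J ∣     ≡⟨ ∣A∪B∣ I J (λ x x∈I x∈J → I∩F x x∈I (subset bJ x∈J)) ⟨
      ∣ I ∪ J ∣           ≤⟨ le ⟩
      ∣ L ∣               ∎
      where open ℕ.≤-Reasoning
    ⊆L : I ∪ K ⊆ L
    ⊆L {x} x∈ = decidable-stable (x ∈? L) (λ x∉L →
      ℕ.<⇒≱ (p⊂q⇒∣p∣<∣q∣ ((λ {z} → subset bL {z}) , x , x∈ , x∉L)) I∪K≤L)
  ... | no ¬le with x , x∈ , x∉L , ind′ ← augment (indep bL) ind (ℕ.≰⇒> ¬le) = contradiction
        (∪-elim (λ x∈I → maximal bL (∈-∪ˡ x∈I) ind′)
                (λ x∈J → K⊆L (maximal bK (subset bJ x∈J) (heredity (∪-mono K⊆L (λ p → p)) ind′))) x∈) x∉L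

  indep/⁺ : IsBasisOf F J → I ⊆ ground ─ F → Indep (I ∪ J) → Matroid.Indep (M / F) I
  indep/⁺ {J = J} b I⊆ ind = I⊆ , J , b , ind

  -- Independence in `M / F` comes with some basis of `F`; by `basis-exchange` it can be replaced by
  -- any prescribed one.
  indep/⁻ : IsBasisOf F J → Matroid.Indep (M / F) I → Indep (I ∪ J)
  indep/⁻ {F = F} b (I⊆ , K , c , ind) = basis-exchange c b (λ x x∈I → x∈p─q⇒x∉q ground F (I⊆ x∈I)) ind

  -- A point outside `F` that does not raise the rank is spanned by `F`, and hence is a loop once
  -- `F` is contracted. This is what lets sums over flats run over all subsets.
  nonflat⇒loop : F ⊆ ground → ¬ IsFlat F → Matroid.HasLoop (M / F)
  nonflat⇒loop {F = F} F⊆ ¬flat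
    with Fin.any? (λ x → (x ∈? ground) ×-dec ¬? (x ∈? F) ×-dec ¬? (rank F ℕ.<? rank (F ∪ ⁅ x ⁆)))
  ... | no none = contradiction (F⊆ , λ x x∈ x∉ → decidable-stable (_ ℕ.<? _) (λ ¬< → none (x , x∈ , x∉ , ¬<))) ¬flat
  ... | yes (x , x∈ , x∉ , ¬<) with J , b ← basis-exists F = x , x∈p∧x∉q⇒x∈p─q x∈ x∉ , λ ind →
    let ind′ = indep/⁻ b ind in ¬< (ℕ.≤-trans
      (ℕ.≤-reflexive (trans (cong suc (rank≡∣basis∣ b)) (trans (cong (ℕ._+ ∣ J ∣) (sym (∣⁅x⁆∣≡1 x)))
        (sym (∣A∪B∣ ⁅ x ⁆ J (λ y y∈ y∈J → x∉ (subst (_∈ F) (x∈⁅y⁆⇒x≡y x y∈) (subset b y∈J))))))))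
      (indep≤rank ind′ (∪-elim (λ p → ∈-∪ʳ p) (λ p → ∈-∪ˡ (subset b p)))))

  loop? : Dec HasLoop
  loop? = Fin.any? (λ x → (x ∈? ground) ×-dec ¬? (indep? ⁅ x ⁆))

-- Relabellings are taken among all permutations of the ambient `Fin n`, so that the lemmas on
-- images of subsets under an action apply to them.
module 𝔖 {n} = Action (symAction {n} ⊤)

𝔖-inverse : SymElement {n} ⊤ → SymElement {n} ⊤
𝔖-inverse {n} = FiniteGroup._⁻¹ (Sym {n} ⊤)

record Iso (θ : SymElement {n} ⊤) (M M′ : Matroid n) : Set where
  private
    module M  = Matroid M
    module M′ = Matroid M′
  field
    ground⁺ : x ∈ M.ground → 𝔖.act θ x ∈ M′.ground
    ground⁻ : x ∈ M′.ground → 𝔖.act (𝔖-inverse θ) x ∈ M.ground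
    indep⁺  : M.Indep I → M′.Indep (θ 𝔖.· I)
    indep⁻  : M′.Indep I → M.Indep (𝔖-inverse θ 𝔖.· I)

  basis⁺ : M.IsBasisOf S J → M′.IsBasisOf (θ 𝔖.· S) (θ 𝔖.· J)
  basis⁺ {S = S} {J} b = record
    { indep   = indep⁺ b.indep
    ; subset  = 𝔖.·-mono θ b.subset
    ; maximal = λ {x} x∈ ind → 𝔖.∈·⁺ θ (b.maximal (𝔖.∈·⁻ θ x∈) (M.heredity (back x) (indep⁻ ind)))
    }
    where
    module b = M.IsBasisOf b
    back : ∀ x → J ∪ ⁅ 𝔖.act (𝔖-inverse θ) x ⁆ ⊆ 𝔖-inverse θ 𝔖.· (θ 𝔖.· J ∪ ⁅ x ⁆)
    back x = ∪-lub
      (λ {y} y∈J → subst (_∈ 𝔖-inverse θ 𝔖.· (θ 𝔖.· J ∪ ⁅ x ⁆)) (𝔖.act-invˡ θ y)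
        (𝔖.act-∈· (𝔖-inverse θ) (p⊆p∪q ⁅ x ⁆ (𝔖.act-∈· θ y∈J))))
      (⁅⁆⊆ (𝔖.act-∈· (𝔖-inverse θ) (q⊆p∪q (θ 𝔖.· J) ⁅ x ⁆ (x∈⁅x⁆ x))))

  rank-iso : ∀ S → M′.rank (θ 𝔖.· S) ≡ M.rank S
  rank-iso S with J , b ← Rank.basis-exists M S =
    trans (Rank.rank≡∣basis∣ M′ (basis⁺ b)) (trans (𝔖.∣·∣ θ J) (sym (Rank.rank≡∣basis∣ M b)))

  ground-image : θ 𝔖.· M.ground ≡ M′.ground
  ground-image = ⊆-antisym
    (λ {x} x∈ → subst (_∈ M′.ground) (𝔖.act-invʳ θ x) (ground⁺ (𝔖.∈·⁻ θ x∈)))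
    (λ x∈ → 𝔖.∈·⁺ θ (ground⁻ x∈))

  rk-iso : M′.rk ≡ M.rk
  rk-iso = trans (cong M′.rank (sym ground-image)) (rank-iso M.ground)

  loop⁺ : M.HasLoop → M′.HasLoop
  loop⁺ (x , x∈ , ¬ind) = 𝔖.act θ x , ground⁺ x∈ , λ ind → ¬ind
    (M.heredity (⁅⁆⊆ (𝔖.∈·⁺ (𝔖-inverse θ) (x∈⁅x⁆ _))) (indep⁻ ind))

iso-sym : ∀ {θ : SymElement {n} ⊤} {M M′ : Matroid n} → Iso θ M M′ → Iso (𝔖-inverse θ) M′ M
iso-sym i = record
  { ground⁺ = Iso.ground⁻ i ; ground⁻ = Iso.ground⁺ i ; indep⁺ = Iso.indep⁻ i ; indep⁻ = Iso.indep⁺ i }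

iso-/ : ∀ {θ : SymElement {n} ⊤} {M M′ : Matroid n} → Iso θ M M′ → ∀ F → Iso θ (M / F) (M′ / (θ 𝔖.· F))
iso-/ {n} {θ} {M} {M′} i F = record
  { ground⁺ = ground-∈ i F
  ; ground⁻ = λ {x} x∈ → subst (λ G → 𝔖.act (𝔖-inverse θ) x ∈ Matroid.ground M ─ G) (𝔖.·-invˡ θ F)
      (ground-∈ (iso-sym i) (θ 𝔖.· F) x∈)
  ; indep⁺  = indep-image i F
  ; indep⁻  = λ {I} p → subst (λ G → Matroid.Indep (M / G) (𝔖-inverse θ 𝔖.· I)) (𝔖.·-invˡ θ F)
      (indep-image (iso-sym i) (θ 𝔖.· F) p)
  }
  where
  ground-∈ : ∀ {θ : SymElement {n} ⊤} {M M′ : Matroid n} → Iso θ M M′ → ∀ F {x} →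
        x ∈ Matroid.ground M ─ F → 𝔖.act θ x ∈ Matroid.ground M′ ─ θ 𝔖.· F
  ground-∈ {θ} {M} i F {x} x∈ = x∈p∧x∉q⇒x∈p─q (Iso.ground⁺ i (p─q⊆p (Matroid.ground M) F x∈))
    (λ θx∈ → x∈p─q⇒x∉q (Matroid.ground M) F x∈ (subst (_∈ F) (𝔖.act-invˡ θ x) (𝔖.∈·⁻ θ θx∈)))
  indep-image : ∀ {θ : SymElement {n} ⊤} {M M′ : Matroid n} → Iso θ M M′ → ∀ F {I} →
        Matroid.Indep (M / F) I → Matroid.Indep (M′ / (θ 𝔖.· F)) (θ 𝔖.· I)
  indep-image {θ} {M} {M′} i F {I} (I⊆ , J , b , ind) =
    (λ {x} x∈ → subst (_∈ Matroid.ground M′ ─ θ 𝔖.· F) (𝔖.act-invʳ θ x) (ground-∈ i F (I⊆ (𝔖.∈·⁻ θ x∈)))) ,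
    θ 𝔖.· J , Iso.basis⁺ i b ,
    Matroid.heredity M′ (∪-lub (𝔖.·-mono θ {I} {I ∪ J} ∈-∪ˡ) (𝔖.·-mono θ {J} {I ∪ J} ∈-∪ʳ)) (Iso.indep⁺ i ind)

infix 4 _≃_
record _≃_ (M M′ : Matroid n) : Set where
  private
    module M  = Matroid M
    module M′ = Matroid M′
  field
    ground≡ : M.ground ≡ M′.ground
    to      : M.Indep I → M′.Indep I
    from    : M′.Indep I → M.Indep I

𝔖-id : SymElement {n} ⊤
𝔖-id {n} = FiniteGroup.ε (Sym {n} ⊤)

≃⇒Iso : {M M′ : Matroid n} → M ≃ M′ → Iso 𝔖-id M M′
≃⇒Iso {M = M} {M′} e = record
  { ground⁺ = λ {x} → subst (x ∈_) ground≡
  ; ground⁻ = λ {x} → subst (x ∈_) (sym ground≡)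
  ; indep⁺  = λ {I} ind → subst (Matroid.Indep M′) (sym (𝔖.·-ε I)) (to ind)
  ; indep⁻  = λ {I} ind → subst (Matroid.Indep M) (sym (𝔖.·-ε I)) (from ind)
  }
  where open _≃_ e

/⊥-≃ : (M : Matroid n) → (M / ⊥) ≃ M
/⊥-≃ M = record
  { ground≡ = p─⊥≡p ground
  ; to      = λ {I} ind → heredity ∈-∪ˡ (indep/⁻ ⊥-basis ind)
  ; from    = λ {I} ind → indep/⁺ ⊥-basis (λ x∈ → subst (_ ∈_) (sym (p─⊥≡p ground)) (⊆ground ind x∈))
                (heredity (∪-lub (λ p → p) ⊥⊆) ind)
  }
  where
  open Matroid M
  open Rank M
  ⊥-basis : IsBasisOf ⊥ ⊥
  ⊥-basis = record { indep = empty ; subset = λ p → p ; maximal = λ p _ → p }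

-- The pairs of an orbit representative F and a coset tW_F correspond to the members tF of the orbits.
module OrbitSum {W : FiniteGroup} (a : Action W n) (xs : List (Subset n)) where
  open FiniteGroup W using (Carrier; _∙_; ε; _⁻¹; inverseʳ) renaming (sym to ≈-sym)
  open Action a

  orbitSetoid : DecSetoid 0ℓ 0ℓ
  orbitSetoid = record
    { Carrier = Subset n
    ; _≈_ = SameOrbit
    ; isDecEquivalence = record
      { isEquivalence = record
        { refl  = λ {S} → ε , ·-ε S
        ; sym   = λ { {S} (g , refl) → g ⁻¹ , ·-invˡ g S }
        ; trans = λ { {S} (g , refl) (h , refl) → h ∙ g , ·-∙ h g S }
        }
      ; _≟_ = sameOrbit?
      }
    }
  private module O = DecSetoid orbitSetoid

  orbits : List (Subset n)
  orbits = deduplicate sameOrbit? xs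

  orbit : Fin (length orbits) → Subset n
  orbit = List.lookup orbits

  module Cosets k = InducedCharacter (stabilizer (orbit k))

  orbit-unique : ∀ k l → SameOrbit (orbit k) (orbit l) → k ≡ l
  orbit-unique = lookup-injective orbitSetoid (UniqueDS.deduplicate-! orbitSetoid xs)

  orbit-covers : ∀ {F} → F ∈ₗ xs → ∃ λ k → SameOrbit (orbit k) F
  orbit-covers {F} F∈ = Any.index F∈orbits , O.sym {F} (Anyₚ.lookup-index F∈orbits)
    where
    F∈orbits : Any.Any (SameOrbit F) orbits
    F∈orbits = MembershipSₚ.∈-deduplicate⁺ O.setoid sameOrbit?
      (λ {x} {y} {z} p q → O.trans {x} {y} {z} q (O.sym {z} {y} p)) {xs} {F}
      (Any.map (λ { refl → O.refl {F} }) F∈)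

  same-coset : ∀ g h {S} → g · S ≡ h · S → Subgroup.Mem (stabilizer S) (g ⁻¹ ∙ h)
  same-coset g h {S} p = trans (·-∙ (g ⁻¹) h S) (trans (cong (g ⁻¹ ·_) (sym p)) (·-invˡ g S))

  coset-same : ∀ g h {S} → Subgroup.Mem (stabilizer S) (g ⁻¹ ∙ h) → h · S ≡ g · S
  coset-same g h {S} p = trans (sym (·-invʳ g (h · S))) (cong (g ·_) (trans (sym (·-∙ (g ⁻¹) h S)) p))

  -- A subset where `φ` is nonzero is hit exactly once: the representative is determined by the
  -- orbit and the coset by the image. The hypothesis on the support guarantees that a
  -- representative exists.
  orbit-sum : (φ : Subset n → ℚ) → (∀ F → φ F ≢ 0ℚ → F ∈ₗ xs) →
              Σℚ.sum (λ k → Σℚ.sum (λ j → φ (Cosets.rep k j · orbit k))) ≡ ∑.∑ φ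
  orbit-sum φ support = begin
    Σℚ.sum (λ k → Σℚ.sum (λ j → φ (Cosets.rep k j · orbit k)))
      ≡⟨ Σℚ.sum-cong-≗ (λ k → Σℚ.sum-cong-≗ (λ j → sym (trans
           (∑.∑-single (cell k j) (Cosets.rep k j · orbit k) (λ F F≢ → cell-≢ (λ p → contradiction (sym p) F≢)))
           (cell-≡ refl)))) ⟩
    Σℚ.sum (λ k → Σℚ.sum (λ j → ∑.∑ (cell k j)))
      ≡⟨ Σℚ.sum-cong-≗ (λ k → Σℚ.∑-comm (λ j i → cell k j (∑.enum i))) ⟩
    Σℚ.sum (λ k → ∑.∑ (λ F → Σℚ.sum (λ j → cell k j F)))
      ≡⟨ Σℚ.∑-comm (λ k i → Σℚ.sum (λ j → cell k j (∑.enum i))) ⟩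
    ∑.∑ (λ F → Σℚ.sum (λ k → Σℚ.sum (λ j → cell k j F)))
      ≡⟨ ∑.∑-cong count ⟩
    ∑.∑ φ ∎
    where
    open ≡-Reasoning
    cell : ∀ k → Fin (Cosets.index k) → Subset n → ℚ
    cell k j F with Vec.≡-dec Bool._≟_ (Cosets.rep k j · orbit k) F
    ... | yes _ = φ F
    ... | no  _ = 0ℚ
    cell-≡ : ∀ {k j F} → Cosets.rep k j · orbit k ≡ F → cell k j F ≡ φ F
    cell-≡ {k} {j} {F} p with Vec.≡-dec Bool._≟_ (Cosets.rep k j · orbit k) F
    ... | yes _ = refl
    ... | no ¬p = contradiction p ¬p
    cell-≢ : ∀ {k j F} → (Cosets.rep k j · orbit k ≡ F → φ F ≡ 0ℚ) → cell k j F ≡ 0ℚ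
    cell-≢ {k} {j} {F} p with Vec.≡-dec Bool._≟_ (Cosets.rep k j · orbit k) F
    ... | yes q = p q
    ... | no  _ = refl
    count : ∀ F → Σℚ.sum (λ k → Σℚ.sum (λ j → cell k j F)) ≡ φ F
    count F with φ F ℚₚ.≟ 0ℚ
    ... | yes φ≡0 = trans (sum-zero _ (λ k → sum-zero _ (λ j → cell-≢ {k} {j} (λ _ → φ≡0)))) (sym φ≡0)
    ... | no φ≢0 with k , g , gF≡ ← orbit-covers (support F φ≢0) = trans
      (sum-single _ k (λ l l≢k → sum-zero _ (λ j → cell-≢ {l} {j} (λ p → contradiction
        (orbit-unique l k (O.trans {orbit l} {F} {orbit k} (Cosets.rep l j , p) (O.sym {orbit k} {F} (g , gF≡)))) l≢k))))
      (trans (sum-single _ j₀ (λ j j≢ → cell-≢ {k} {j} (λ p → contradiction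
        (Cosets.rep-unique k j j₀ (same-coset (Cosets.rep k j) (Cosets.rep k j₀) (trans p (sym at-j₀)))) j≢)))
        (cell-≡ {k} {j₀} at-j₀))
      where
      j₀ : Fin (Cosets.index k)
      j₀ = proj₁ (Cosets.locate k g)
      at-j₀ : Cosets.rep k j₀ · orbit k ≡ F
      at-j₀ = trans (coset-same g (Cosets.rep k j₀) (proj₂ (Cosets.locate k g))) gF≡

-- Matroids with a chosen group element

record Pointed (n : ℕ) : Set₁ where
  field
    {matroid}     : Matroid n
    {group}       : FiniteGroup
    matroidAction : MatroidAction group matroid
    element       : FiniteGroup.Carrier group
  open Matroid matroid public
  open MatroidAction matroidAction public

  σ : Fin n → Fin n
  σ = act element

  Fixed : Subset n → Set
  Fixed F = element · F ≡ F

  fixed? : ∀ F → Dec (Fixed F)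
  fixed? F = Vec.≡-dec Bool._≟_ (element · F) F

  contract : ∀ F → Fixed F → Pointed n
  contract F fix = record { matroidAction = matroidAction /ᴬ F ; element = element , fix }

  σ-fixed⁺ : ∀ {F} → Fixed F → ∀ {x} → x ∈ F → σ x ∈ F
  σ-fixed⁺ fix x∈ = subst (_ ∈_) fix (act-∈· element x∈)

  -- The image of `F` lies in `F` and has the same cardinality, so the two are equal.
  fixed : ∀ {F} → (∀ {x} → x ∈ F → σ x ∈ F) → Fixed F
  fixed {F} p = sym (p⊆q∧∣q∣≤∣p∣⇒≡
    (λ {x} x∈ → ∈·⁺ element (back x x∈)) (ℕ.≤-reflexive (∣·∣ element F)))
    where
    open FiniteGroup group using (_⁻¹)
    p⊆q∧∣q∣≤∣p∣⇒≡ : ∀ {p q : Subset n} → p ⊆ q → ∣ q ∣ ≤ ∣ p ∣ → p ≡ q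
    p⊆q∧∣q∣≤∣p∣⇒≡ {p} {q} p⊆q le = ⊆-antisym p⊆q (λ {x} x∈q → decidable-stable (x ∈? p)
      (λ x∉p → ℕ.<⇒≱ (p⊂q⇒∣p∣<∣q∣ (p⊆q , x , x∈q , x∉p)) le))
    g·F⊆F : element · F ⊆ F
    g·F⊆F {x} x∈ = subst (_∈ F) (act-invʳ element x) (p (∈·⁻ element x∈))
    back : ∀ x → x ∈ F → act (element ⁻¹) x ∈ F
    back x x∈ = ∈·⁻ element (subst (x ∈_) (sym (p⊆q∧∣q∣≤∣p∣⇒≡ g·F⊆F (ℕ.≤-reflexive (sym (∣·∣ element F))))) x∈)

-- The two groups may differ; only the permutations by which the chosen elements act on the ground
-- sets are compared. That characters of `P` depend on nothing more is shown in `p-invariant`.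
record PointedIso (θ : SymElement {n} ⊤) (X Y : Pointed n) : Set where
  private
    module X = Pointed X
    module Y = Pointed Y
  field
    iso         : Iso θ X.matroid Y.matroid
    equivariant : ∀ {x} → x ∈ X.ground → 𝔖.act θ (X.σ x) ≡ Y.σ (𝔖.act θ x)
  open Iso iso public

  fixed⁺ : ∀ {F} → F ⊆ X.ground → X.Fixed F → Y.Fixed (θ 𝔖.· F)
  fixed⁺ {F} F⊆ fix = Y.fixed λ {y} y∈ → let x∈ = 𝔖.∈·⁻ θ y∈ in
    subst (_∈ θ 𝔖.· F) (trans (equivariant (F⊆ x∈)) (cong Y.σ (𝔖.act-invʳ θ y))) (𝔖.act-∈· θ (X.σ-fixed⁺ fix x∈))

pointedIso-sym : ∀ {θ : SymElement {n} ⊤} {X Y} → PointedIso θ X Y → PointedIso (𝔖-inverse θ) Y X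
pointedIso-sym {θ = θ} {X} {Y} i = record
  { iso         = iso-sym iso
  ; equivariant = λ {y} y∈ → trans
      (cong (𝔖.act (𝔖-inverse θ)) (trans (cong (Pointed.σ Y) (sym (𝔖.act-invʳ θ y))) (sym (equivariant (ground⁻ y∈)))))
      (𝔖.act-invˡ θ _)
  }
  where open PointedIso i

contract-iso : ∀ {θ : SymElement {n} ⊤} {X Y} → PointedIso θ X Y → ∀ F fix fix′ →
               PointedIso θ (Pointed.contract X F fix) (Pointed.contract Y (θ 𝔖.· F) fix′)
contract-iso {X = X} i F fix fix′ = record
  { iso         = iso-/ iso F
  ; equivariant = λ x∈ → equivariant (p─q⊆p (Pointed.ground X) F x∈)
  }
  where open PointedIso i

module _ {W : FiniteGroup} {M : Matroid n} (a : MatroidAction W M) where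
  open FiniteGroup W
    using (Carrier; _∙_; _⁻¹; assoc; ∙-congʳ; inverseʳ; identityˡ; ⁻¹-involutive)
    renaming (_≈_ to _≈ᵂ_; trans to ≈-trans; sym to ≈-sym)
  open MatroidAction a

  permutation-of : Carrier → SymElement {n} ⊤
  permutation-of t = permOf t , λ x x∉ → contradiction ∈⊤ x∉

  -- Acting by `t` carries the conjugate t⁻¹gt to `g`. It turns a summand of Frobenius's formula,
  -- which evaluates at such a conjugate, into a term evaluated at `g`.
  conjugation-iso : ∀ g t → PointedIso (permutation-of t)
    (record { matroidAction = a ; element = (t ⁻¹ ∙ g) ∙ t }) (record { matroidAction = a ; element = g })
  conjugation-iso g t = record
    { iso = record
      { ground⁺ = ground-invariant t
      ; ground⁻ = ground-invariant (t ⁻¹)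
      ; indep⁺  = indepInvariant a t
      ; indep⁻  = λ {I} ind → subst (Matroid.Indep M) (Vec.tabulate-cong (λ x → cong (lookup I) (act-cong (⁻¹-involutive t) x)))
          (indepInvariant a (t ⁻¹) ind)
      }
    ; equivariant = λ {x} _ → trans (sym (act-∙ t ((t ⁻¹ ∙ g) ∙ t) x)) (trans (act-cong conj x) (act-∙ g t x))
    }
    where
    conj : t ∙ ((t ⁻¹ ∙ g) ∙ t) ≈ᵂ g ∙ t
    conj = ≈-trans (≈-sym (assoc t (t ⁻¹ ∙ g) t)) (∙-congʳ (≈-trans (≈-sym (assoc t (t ⁻¹) g))
      (≈-trans (∙-congʳ (inverseʳ t)) (identityˡ g))))

-- Kazhdan–Lusztig polynomials at a group element

∣─∣< : ∀ {S F : Subset n} → F ⊆ S → Nonempty F → ∣ S ─ F ∣ < ∣ S ∣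
∣─∣< {S = S} {F} F⊆S (x , x∈) = p∩q≢∅⇒∣p─q∣<∣p∣ S F (x , x∈p∩q⁺ (F⊆S x∈ , x∈))

shift-sum : ∀ {m} a (f : Fin m → Series) i →
            shift a (λ k → Σℚ.sum (λ j → f j k)) i ≡ Σℚ.sum (λ j → shift a (f j) i)
shift-sum zero    f i       = refl
shift-sum {m} (suc a) f zero    = sym (sum-zero {m} _ (λ _ → refl))
shift-sum (suc a) f (suc i) = shift-sum a f i

module Characters (KL : EquivariantKL) where
  open EquivariantKL KL

  p z : Pointed n → Series
  p X = charᵍ {group} element (P matroid group matroidAction)
    where open Pointed X
  z X = charᵍ {group} element (Z matroid group matroidAction)
    where open Pointed X

  module _ (X : Pointed n) where
    open Pointed X
    open KLConditions (conditions matroidAction)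

    p-loop : HasLoop → p X ≗ˢ 0ˢ
    p-loop l i = trans (charᵍ-cong {group} element (P-loop l) i) (charᵍ-0 {group} element i)

    p-rank-0 : Loopless → rk ≡ 0 → p X ≗ˢ 1ˢ
    p-rank-0 l r i = trans (charᵍ-cong {group} element (P-rank-0 l r) i) (charᵍ-1 {group} element i)

    p-lowDegree : Loopless → 0 < rk → LowDegree rk (p X)
    p-lowDegree l r i rk≤ = trans (charᵍ-coeff {group} element _ i) (≈ᵛ⇒charᵛ {group} (P-degree l r i rk≤) element)

    z-palindromic : Loopless → Palindromic rk (z X)
    z-palindromic l = record
      { symmetric = λ j j≤ → trans (charᵍ-coeff {group} element _ j)
          (trans (≈ᵛ⇒charᵛ {group} (proj₁ (Z-palindromic l) j j≤) element) (sym (charᵍ-coeff {group} element _ (rk ℕ.∸ j))))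
      ; bounded   = λ j j> → trans (charᵍ-coeff {group} element _ j) (≈ᵛ⇒charᵛ {group} (proj₂ (Z-palindromic l) j j>) element)
      }

    loopless : ¬ HasLoop → Loopless
    loopless ¬l x l = ¬l (x , l)

    -- F need not be a flat: the contraction of a non-flat has a loop, hence P = 0.
    term : Subset n → Series
    term F with F ⊆? ground | fixed? F
    ... | yes _ | yes fix = shift (rank F) (p (contract F fix))
    ... | yes _ | no _    = 0ˢ
    ... | no _  | _       = 0ˢ

    term-≡ : F ⊆ ground → (fix : Fixed F) → term F ≗ˢ shift (rank F) (p (contract F fix))
    term-≡ {F} F⊆ fix i with F ⊆? ground | fixed? F
    -- The proof that `F` is fixed is a component of the chosen element of the stabilizer, so two
    -- such proofs have to be identified.
    ... | yes _  | yes fix′ = shift-cong (rank F) (λ i → cong (λ q → p (contract F q) i) (uip fix′ fix)) i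
      where
      uip : ∀ {A : Set} {x y : A} (p q : x ≡ y) → p ≡ q
      uip refl refl = refl
    ... | yes _  | no ¬fix  = contradiction fix ¬fix
    ... | no ¬F⊆ | _        = contradiction (λ {x} → F⊆ {x}) ¬F⊆

    term-support : ∀ i → term F i ≢ 0ℚ → F ⊆ ground × Fixed F
    term-support {F} i ≢0 with F ⊆? ground | fixed? F
    ... | yes F⊆ | yes fix = F⊆ , fix
    ... | yes _  | no _    = contradiction refl ≢0
    ... | no _   | _       = contradiction refl ≢0

    term-0 : ¬ (F ⊆ ground × Fixed F) → term F ≗ˢ 0ˢ
    term-0 {F} ¬s i = decidable-stable (term F i ℚₚ.≟ 0ℚ) (λ ≢0 → ¬s (term-support i ≢0))

    nonemptyTerm : Subset n → Series
    nonemptyTerm F with nonempty? F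
    ... | yes _ = term F
    ... | no  _ = 0ˢ

    nonemptyTerm-≡ : Nonempty F → nonemptyTerm F ≗ˢ term F
    nonemptyTerm-≡ {F} ne i with nonempty? F
    ... | yes _  = refl
    ... | no ¬ne = contradiction ne ¬ne

    nonemptyTerm-0 : ¬ (Nonempty F × F ⊆ ground × Fixed F) → nonemptyTerm F ≗ˢ 0ˢ
    nonemptyTerm-0 {F} ¬s i with nonempty? F
    ... | yes ne = term-0 (λ (F⊆ , fix) → ¬s (ne , F⊆ , fix)) i
    ... | no _   = refl

    nonemptyTerm-support : ∀ i → nonemptyTerm F i ≢ 0ℚ → Nonempty F × F ⊆ ground × Fixed F
    nonemptyTerm-support {F} i ≢0 with nonempty? F
    ... | yes ne = ne , term-support i ≢0
    ... | no _   = contradiction refl ≢0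

  -- Bounded by the size of the ground set because it is proved together with the formula for Z:
  -- that formula moves terms along orbits, and so uses invariance for the contractions by nonempty
  -- sets, whose ground sets are smaller.
  Invariance : ℕ → Set₁
  Invariance N = ∀ {n} {θ : SymElement {n} ⊤} {X Y : Pointed n} → PointedIso θ X Y →
                 ∣ Pointed.ground X ∣ ≤ N → p X ≗ˢ p Y

  module _ {N} (invariance : Invariance N) (X : Pointed n) (size≤ : ∣ Pointed.ground X ∣ ≤ suc N) where
    open Pointed X
    open FiniteGroup group using (Carrier; _∙_; _⁻¹)

    private
      flats : List (Subset n)
      flats = filter (λ F → isFlat? F ×-dec nonempty? F) (subsets n)

      module O = OrbitSum action flats

      P/ : ∀ F → grVRep (Subgroup.finiteGroup (stabilizer F))
      P/ F = P (matroid / F) (Subgroup.finiteGroup (stabilizer F)) (matroidAction /ᴬ F)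

      -- The conjugate t⁻¹gt fixes `F` exactly when `g` fixes `t · F`. In that case `t` carries one
      -- contraction to the other; otherwise both sides are zero.
      coset-term : F ⊆ ground → Nonempty F → ∀ t i →
                   shift (rank F) (char₀ᵍ {group} (stabilizer F) (P/ F) ((t ⁻¹ ∙ element) ∙ t)) i ≡ nonemptyTerm X (t · F) i
      coset-term {F} F⊆ (x , x∈) t i = aux (Subgroup.mem? (stabilizer F) w)
        where
        w : Carrier
        w = (t ⁻¹ ∙ element) ∙ t
        Xw : Pointed n
        Xw = record { matroidAction = matroidAction ; element = w }
        conj : PointedIso (permutation-of matroidAction t) Xw X
        conj = conjugation-iso matroidAction element t
        open PointedIso conj using (fixed⁺; ground-image; rank-iso)
        tF⊆ : t · F ⊆ ground
        tF⊆ {y} y∈ = subst (_∈ ground) (act-invʳ t y) (ground-invariant t (F⊆ (∈·⁻ t y∈)))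
        open ≡-Reasoning
        aux : Dec (Pointed.Fixed Xw F) → shift (rank F) (char₀ᵍ {group} (stabilizer F) (P/ F) w) i ≡ nonemptyTerm X (t · F) i
        aux (yes q) = begin
          shift (rank F) (char₀ᵍ {group} (stabilizer F) (P/ F) w) i
            ≡⟨ shift-cong (rank F) (char₀ᵍ-∈ {group} (stabilizer F) (P/ F) q) i ⟩
          shift (rank F) (p (Pointed.contract Xw F q)) i
            ≡⟨ shift-cong (rank F) (invariance (contract-iso conj F q (fixed⁺ F⊆ q))
                 (ℕ.≤-pred (ℕ.≤-trans (∣─∣< F⊆ (x , x∈)) size≤))) i ⟩
          shift (rank F) (p (contract (t · F) (fixed⁺ F⊆ q))) i
            ≡⟨ cong (λ r → shift r (p (contract (t · F) (fixed⁺ F⊆ q))) i) (rank-iso F) ⟨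
          shift (rank (t · F)) (p (contract (t · F) (fixed⁺ F⊆ q))) i
            ≡⟨ term-≡ X tF⊆ (fixed⁺ F⊆ q) i ⟨
          term X (t · F) i
            ≡⟨ nonemptyTerm-≡ X (act t x , act-∈· t x∈) i ⟨
          nonemptyTerm X (t · F) i ∎
        aux (no ¬q) = trans (shift-0 (rank F) (char₀ᵍ-∉ {group} (stabilizer F) (P/ F) ¬q) i) (sym (nonemptyTerm-0 X (λ (_ , _ , fix) → ¬q
          (subst (Pointed.Fixed Xw) (𝔖.·-invˡ (permutation-of matroidAction t) F)
            (PointedIso.fixed⁺ (pointedIso-sym conj) tF⊆ fix))) i))

      flat-support : ∀ i F → nonemptyTerm X F i ≢ 0ℚ → F ∈ₗ flats
      flat-support i F ≢0 with isFlat? F | nonemptyTerm-support X i ≢0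
      ... | yes flat | ne , _ = Membershipₚ.∈-filter⁺ (λ F → isFlat? F ×-dec nonempty? F) (∈-subsets F) (flat , ne)
      ... | no ¬flat | ne , F⊆ , fix = contradiction (trans (nonemptyTerm-≡ X ne i) (trans (term-≡ X F⊆ fix i)
              (shift-0 (rank F) (p-loop (contract F fix) (Rank.nonflat⇒loop matroid F⊆ ¬flat)) i))) ≢0

      orbit-flat : ∀ k → IsFlat (O.orbit k) × Nonempty (O.orbit k)
      orbit-flat k = proj₂ (Membershipₚ.∈-filter⁻ (λ F → isFlat? F ×-dec nonempty? F) {xs = subsets n}
        (Anyₚ.deduplicate⁻ sameOrbit? (Membershipₚ.∈-lookup k)))

    private
      χ : ∀ F → Fin (InducedCharacter.index (stabilizer F)) → Series
      χ F j = char₀ᵍ {group} (stabilizer F) (P/ F) ((rep j ⁻¹ ∙ element) ∙ rep j)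
        where open InducedCharacter (stabilizer F) using (rep)

      -- The summands are a variable f, known only through its characters, because converting the induced
      -- representations themselves makes type checking blow up.
      z-summands : ∀ xs (f : Subset n → grVRep group) →
                   Z matroid group matroidAction ≈ᵍ P matroid group matroidAction +ᵍ sumᵍ (List.map f xs) →
                   ∀ i → (∀ F → charᵍ {group} element (f F) i ≡ shift (rank F) (λ i → Σℚ.sum (λ j → χ F j i)) i) →
                   z X i ≡ p X i ℚ.+ Σℚ.sum (λ k → shift (rank (List.lookup xs k))
                     (λ i → Σℚ.sum (λ j → χ (List.lookup xs k) j i)) i)
      z-summands xs f eq i f-char = trans (charᵍ-cong {group} element eq i)
        (trans (charᵍ-+ {group} element (P matroid group matroidAction) (sumᵍ (List.map f xs)) i)
          (cong (p X i ℚ.+_) (trans (charᵍ-sum {group} element f xs i) (Σℚ.sum-cong-≗ (λ k → f-char (List.lookup xs k))))))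

      z-orbits : Loopless → ∀ i → z X i ≡
        p X i ℚ.+ Σℚ.sum (λ k → shift (rank (O.orbit k)) (λ i → Σℚ.sum (λ j → χ (O.orbit k) j i)) i)
      z-orbits ll i = z-summands O.orbits _ (KLConditions.Z-formula (conditions matroidAction) ll) i λ F → trans
        (charᵍ-shift {group} element (rank F) _ i)
        (shift-cong (rank F) (λ i → trans
          (charᵍ-map {Subgroup.finiteGroup (stabilizer F)} {group} element _ (ind-char (stabilizer F) element)
            (λ V → InducedCharacter.charᵛ-ind (stabilizer F) V element) (ind-char-0 (stabilizer F) element) (P/ F) i)
          (ind-char-coeff (stabilizer F) element (P/ F) i)) i)

      by-cosets : F ⊆ ground → Nonempty F → ∀ i → shift (rank F) (λ i → Σℚ.sum (λ j → χ F j i)) i ≡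
                  Σℚ.sum (λ j → nonemptyTerm X (InducedCharacter.rep (stabilizer F) j · F) i)
      by-cosets {F} F⊆ ne i = trans (shift-sum (rank F) (χ F) i)
        (Σℚ.sum-cong-≗ (λ j → coset-term F⊆ ne (InducedCharacter.rep (stabilizer F) j) i))

    z-formula : Loopless → z X ≗ˢ p X +ˢ ∑ˢ (nonemptyTerm X)
    z-formula ll i = begin
      z X i
        ≡⟨ z-orbits ll i ⟩
      p X i ℚ.+ Σℚ.sum (λ k → shift (rank (O.orbit k)) (λ i → Σℚ.sum (λ j → χ (O.orbit k) j i)) i)
        ≡⟨ cong (p X i ℚ.+_) (Σℚ.sum-cong-≗ (λ k → by-cosets (proj₁ (proj₁ (orbit-flat k))) (proj₂ (orbit-flat k)) i)) ⟩
      p X i ℚ.+ Σℚ.sum (λ k → Σℚ.sum (λ j → nonemptyTerm X (O.Cosets.rep k j · O.orbit k) i))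
        ≡⟨ cong (p X i ℚ.+_) (O.orbit-sum (λ F → nonemptyTerm X F i) (flat-support i)) ⟩
      p X i ℚ.+ ∑ˢ (nonemptyTerm X) i ∎
      where open ≡-Reasoning

  -- By induction `θ` matches the terms of nonempty subsets in the two Z-polynomials. Hence Z_X -
  -- Z_Y = P_X - P_Y is palindromic of degree rk and of low degree. Loops and rank zero are settled
  -- directly by the conditions.
  invariance : ∀ N → Invariance N
  invariance-pred : ∀ {N N′} → N ≡ suc N′ → Invariance N′
  invariance-pred {suc N} refl = invariance N
  invariance N {n} {θ} {X} {Y} iso size≤ = by-loops (Rank.loop? X.matroid)
    where
    module X = Pointed X
    module Y = Pointed Y
    module i = PointedIso iso
    module i⁻¹ = PointedIso (pointedIso-sym iso)

    sizes : ∣ Y.ground ∣ ≡ ∣ X.ground ∣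
    sizes = trans (cong ∣_∣ (sym i.ground-image)) (𝔖.∣·∣ θ X.ground)

    terms : ∀ {N} → Invariance N → ∣ X.ground ∣ ≤ suc N → ∑ˢ (nonemptyTerm X) ≗ˢ ∑ˢ (nonemptyTerm Y)
    terms invariance size≤ k = ∑-reindex (subsetEnumeration n) (subsetEnumeration n)
      (λ F → nonemptyTerm X F k) (λ F → nonemptyTerm Y F k) (θ 𝔖.·_) (𝔖-inverse θ 𝔖.·_)
      (λ F ≢0 → let s = nonemptyTerm-support X k ≢0 in
        transport (proj₁ s) (proj₁ (proj₂ s)) (proj₂ (proj₂ s)) , 𝔖.·-invˡ θ F)
      (λ F ≢0 → let (x , x∈) , F⊆ , fix = nonemptyTerm-support Y k ≢0 in
        trans (sym (transport (𝔖.act (𝔖-inverse θ) x , 𝔖.act-∈· (𝔖-inverse θ) x∈)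
          (λ {y} y∈ → subst (_∈ X.ground) (𝔖.act-invˡ θ y) (i.ground⁻ (F⊆ (𝔖.∈·⁻ (𝔖-inverse θ) y∈))))
          (i⁻¹.fixed⁺ F⊆ fix)))
          (cong (λ G → nonemptyTerm Y G k) (𝔖.·-invʳ θ F)) , 𝔖.·-invʳ θ F)
      where
      open ≡-Reasoning
      transport : ∀ {F} → Nonempty F → F ⊆ X.ground → X.Fixed F → nonemptyTerm Y (θ 𝔖.· F) k ≡ nonemptyTerm X F k
      transport {F} (x , x∈) F⊆ fix = begin
        nonemptyTerm Y (θ 𝔖.· F) k
          ≡⟨ nonemptyTerm-≡ Y (𝔖.act θ x , 𝔖.act-∈· θ x∈) k ⟩
        term Y (θ 𝔖.· F) k
          ≡⟨ term-≡ Y (λ {y} y∈ → subst (_∈ Y.ground) (𝔖.act-invʳ θ y) (i.ground⁺ (F⊆ (𝔖.∈·⁻ θ y∈)))) (i.fixed⁺ F⊆ fix) k ⟩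
        shift (Y.rank (θ 𝔖.· F)) (p (Y.contract (θ 𝔖.· F) (i.fixed⁺ F⊆ fix))) k
          ≡⟨ cong (λ r → shift r (p (Y.contract (θ 𝔖.· F) (i.fixed⁺ F⊆ fix))) k) (i.rank-iso F) ⟩
        shift (X.rank F) (p (Y.contract (θ 𝔖.· F) (i.fixed⁺ F⊆ fix))) k
          ≡⟨ shift-cong (X.rank F) (invariance (contract-iso iso F fix (i.fixed⁺ F⊆ fix))
               (ℕ.≤-pred (ℕ.≤-trans (∣─∣< F⊆ (x , x∈)) size≤))) k ⟨
        shift (X.rank F) (p (X.contract F fix)) k
          ≡⟨ term-≡ X F⊆ fix k ⟨
        term X F k
          ≡⟨ nonemptyTerm-≡ X (x , x∈) k ⟨
        nonemptyTerm X F k ∎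

    positive-rank : ∀ N → Invariance N → ∣ X.ground ∣ ≤ suc N → X.Loopless → Y.Loopless → 0 < X.rk → p X ≗ˢ p Y
    positive-rank N inv size≤ llX llY 0<rk k = begin
      p X k                       ≡⟨ solve 2 (λ a b → a := (a :- b) :+ b) refl (p X k) (p Y k) ⟩
      (p X -ˢ p Y) k ℚ.+ p Y k    ≡⟨ cong (ℚ._+ p Y k) (palindromic-lowDegree pal low k) ⟩
      0ℚ ℚ.+ p Y k                ≡⟨ ℚR.+-identityˡ (p Y k) ⟩
      p Y k                       ∎
      where
      open ≡-Reasoning
      open +-*-Solver
      pal : Palindromic X.rk (p X -ˢ p Y)
      pal = palindromic-cong
        (λ j → trans (cong₂ ℚ._-_ (trans (z-formula inv X size≤ llX j) (cong (p X j ℚ.+_) (terms inv size≤ j)))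
                                  (z-formula inv Y (ℕ.≤-trans (ℕ.≤-reflexive sizes) size≤) llY j))
          (solve 3 (λ a b t → (a :+ t) :- (b :+ t) := a :- b) refl (p X j) (p Y j) (∑ˢ (nonemptyTerm Y) j)))
        (palindromic-- (z-palindromic X llX) (subst (λ r → Palindromic r (z Y)) i.rk-iso (z-palindromic Y llY)))
      low : LowDegree X.rk (p X -ˢ p Y)
      low j le = cong₂ ℚ._-_ (p-lowDegree X llX 0<rk j le)
        (p-lowDegree Y llY (subst (0 <_) (sym i.rk-iso) 0<rk) j (subst (_≤ 2 ℕ.* j) (sym i.rk-iso) le))

    by-size : ∀ N → (∀ {N′} → N ≡ suc N′ → Invariance N′) → ∣ X.ground ∣ ≤ N → X.Loopless → Y.Loopless → 0 < X.rk → p X ≗ˢ p Y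
    by-size zero     _   size≤ _   _   0<rk = contradiction
      (ℕ.≤-trans 0<rk (ℕ.≤-trans (Rank.rank≤∣∣ X.matroid X.ground) size≤)) (λ ())
    by-size (suc N′) inv size≤ llX llY 0<rk = positive-rank N′ (inv refl) size≤ llX llY 0<rk

    by-loops : Dec X.HasLoop → p X ≗ˢ p Y
    by-loops (yes l) k = trans (p-loop X l k) (sym (p-loop Y (i.loop⁺ l) k))
    by-loops (no ¬l) with X.rk ℕ.≟ 0
    ... | yes rk≡0 = λ k → trans (p-rank-0 X llX rk≡0 k) (sym (p-rank-0 Y llY (trans i.rk-iso rk≡0) k))
      where
      llX = loopless X ¬l
      llY = loopless Y (¬l ∘ i⁻¹.loop⁺)
    ... | no rk≢0 = by-size N (invariance-pred {N}) size≤ (loopless X ¬l) (loopless Y (¬l ∘ i⁻¹.loop⁺)) (ℕ.n≢0⇒n>0 rk≢0)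

  p-invariant : ∀ {θ : SymElement {n} ⊤} {X Y} → PointedIso θ X Y → p X ≗ˢ p Y
  p-invariant iso = invariance _ iso ℕ.≤-refl

  -- M/∅ is M, so the summand that Z-formula splits off is the term of the empty flat.
  term-⊥ : (X : Pointed n) → term X ⊥ ≗ˢ p X
  term-⊥ X i = trans (term-≡ X ⊥⊆ fix i) (trans (cong (λ r → shift r (p (contract ⊥ fix)) i) (Rank.rank-⊥ matroid))
    (p-invariant {θ = 𝔖-id} {contract ⊥ fix} {X} (record { iso = ≃⇒Iso (/⊥-≃ matroid) ; equivariant = λ _ → refl }) i))
    where
    open Pointed X
    fix : Fixed ⊥
    fix = fixed (λ x∈ → contradiction x∈ ∉⊥)

  -- The difference `rest` between all terms and the nonempty ones is concentrated at the empty set,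
  -- where `term-⊥` identifies it with the summand P_X that was split off.
  z-sum : (X : Pointed n) → Pointed.Loopless X → z X ≗ˢ ∑ˢ (term X)
  z-sum {n} X ll i = begin
    z X i
      ≡⟨ z-formula (λ iso _ → p-invariant iso) X (ℕ.n≤1+n _) ll i ⟩
    p X i ℚ.+ ∑ˢ (nonemptyTerm X) i
      ≡⟨ cong (ℚ._+ ∑ˢ (nonemptyTerm X) i) (trans (sym (trans (at-⊥) (term-⊥ X i))) (sym (∑.∑-single rest ⊥ off-⊥))) ⟩
    ∑.∑ rest ℚ.+ ∑ˢ (nonemptyTerm X) i
      ≡⟨ ∑.∑-+ rest (λ F → nonemptyTerm X F i) ⟨
    ∑.∑ (λ F → rest F ℚ.+ nonemptyTerm X F i)
      ≡⟨ ∑.∑-cong {n} (λ F → solve 2 (λ a b → (a :- b) :+ b := a) refl (term X F i) (nonemptyTerm X F i)) ⟩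
    ∑ˢ (term X) i ∎
    where
    open ≡-Reasoning
    open +-*-Solver
    rest : Subset n → ℚ
    rest F = term X F i ℚ.- nonemptyTerm X F i
    at-⊥ : rest ⊥ ≡ term X ⊥ i
    at-⊥ = trans (cong (λ q → term X ⊥ i ℚ.- q) (nonemptyTerm-0 X (λ ((_ , x∈) , _) → ∉⊥ x∈) i)) (ℚR.+-identityʳ _)
    off-⊥ : ∀ F → F ≢ ⊥ → rest F ≡ 0ℚ
    off-⊥ F F≢ with nonempty? F
    ... | yes _ = ℚR.-‿inverseʳ (term X F i)
    ... | no ¬ne = contradiction (Empty-unique ¬ne) F≢

-- Direct sums

record DirectSum (M M₁ M₂ : Matroid n) : Set where
  private
    module M  = Matroid M
    module M₁ = Matroid M₁
    module M₂ = Matroid M₂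
  field
    ground≡  : M.ground ≡ M₁.ground ∪ M₂.ground
    disjoint : ∀ x → x ∈ M₁.ground → x ∉ M₂.ground
    indep₁   : M.Indep I → M₁.Indep (I ∩ M₁.ground)
    indep₂   : M.Indep I → M₂.Indep (I ∩ M₂.ground)
    indep-∪  : ∀ {I₁ I₂} → M₁.Indep I₁ → M₂.Indep I₂ → M.Indep (I₁ ∪ I₂)

  ground₁ : M₁.ground ⊆ M.ground
  ground₁ x∈ = subst (_ ∈_) (sym ground≡) (∈-∪ˡ x∈)

  ground₂ : M₂.ground ⊆ M.ground
  ground₂ x∈ = subst (_ ∈_) (sym ground≡) (∈-∪ʳ x∈)

  ∪⊆ : F₁ ⊆ M₁.ground → F₂ ⊆ M₂.ground → F₁ ∪ F₂ ⊆ M.ground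
  ∪⊆ F₁⊆ F₂⊆ = ∪-lub (λ x∈ → ground₁ (F₁⊆ x∈)) (λ x∈ → ground₂ (F₂⊆ x∈))

  ∩₁ : F₁ ⊆ M₁.ground → F₂ ⊆ M₂.ground → (F₁ ∪ F₂) ∩ M₁.ground ≡ F₁
  ∩₁ {F₁} {F₂} F₁⊆ F₂⊆ = ⊆-antisym
    (λ {x} x∈ → let (y , x∈₁) = x∈p∩q⁻ (F₁ ∪ F₂) M₁.ground x∈ in
      ∪-elim (λ p → p) (λ x∈F₂ → contradiction (F₂⊆ x∈F₂) (disjoint x x∈₁)) y)
    (λ x∈ → x∈p∩q⁺ (∈-∪ˡ x∈ , F₁⊆ x∈))

  ∩₂ : F₁ ⊆ M₁.ground → F₂ ⊆ M₂.ground → (F₁ ∪ F₂) ∩ M₂.ground ≡ F₂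
  ∩₂ {F₁} {F₂} F₁⊆ F₂⊆ = ⊆-antisym
    (λ {x} x∈ → let (y , x∈₂) = x∈p∩q⁻ (F₁ ∪ F₂) M₂.ground x∈ in
      ∪-elim (λ x∈F₁ → contradiction x∈₂ (disjoint x (F₁⊆ x∈F₁))) (λ p → p) y)
    (λ x∈ → x∈p∩q⁺ (∈-∪ʳ x∈ , F₂⊆ x∈))

  ∪∩ : F ⊆ M.ground → (F ∩ M₁.ground) ∪ (F ∩ M₂.ground) ≡ F
  ∪∩ {F} F⊆ = ⊆-antisym (∪-lub (p∩q⊆p F M₁.ground) (p∩q⊆p F M₂.ground))
    (λ {x} x∈ → ∪-elim {S = M₁.ground} {M₂.ground} (λ p → ∈-∪ˡ (x∈p∩q⁺ (x∈ , p))) (λ p → ∈-∪ʳ (x∈p∩q⁺ (x∈ , p)))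
      (subst (x ∈_) ground≡ (F⊆ x∈)))

  basis-∪ : ∀ {J₁ J₂} → F₁ ⊆ M₁.ground → F₂ ⊆ M₂.ground → M₁.IsBasisOf F₁ J₁ → M₂.IsBasisOf F₂ J₂ →
            M.IsBasisOf (F₁ ∪ F₂) (J₁ ∪ J₂)
  basis-∪ {F₁} {F₂} {J₁} {J₂} F₁⊆ F₂⊆ b₁ b₂ = record
    { indep   = indep-∪ b₁.indep b₂.indep
    ; subset  = ∪-mono b₁.subset b₂.subset
    ; maximal = λ {x} x∈ ind → ∪-elim
        (λ x∈₁ → ∈-∪ˡ (b₁.maximal x∈₁ (M₁.heredity (λ y∈ → x∈p∩q⁺
          (∪-mono {A = J₁} {J₁ ∪ J₂} ∈-∪ˡ (λ p → p) y∈ ,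
           ∪-lub (λ p → F₁⊆ (b₁.subset p)) (⁅⁆⊆ (F₁⊆ x∈₁)) y∈)) (indep₁ ind))))
        (λ x∈₂ → ∈-∪ʳ (b₂.maximal x∈₂ (M₂.heredity (λ y∈ → x∈p∩q⁺
          (∪-mono {A = J₂} {J₁ ∪ J₂} ∈-∪ʳ (λ p → p) y∈ ,
           ∪-lub (λ p → F₂⊆ (b₂.subset p)) (⁅⁆⊆ (F₂⊆ x∈₂)) y∈)) (indep₂ ind))))
        x∈
    }
    where
    module b₁ = M₁.IsBasisOf b₁
    module b₂ = M₂.IsBasisOf b₂

  rank-∪ : F₁ ⊆ M₁.ground → F₂ ⊆ M₂.ground → M.rank (F₁ ∪ F₂) ≡ M₁.rank F₁ ℕ.+ M₂.rank F₂
  rank-∪ {F₁} {F₂} F₁⊆ F₂⊆ with J₁ , b₁ ← Rank.basis-exists M₁ F₁ | J₂ , b₂ ← Rank.basis-exists M₂ F₂ = trans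
    (Rank.rank≡∣basis∣ M (basis-∪ F₁⊆ F₂⊆ b₁ b₂))
    (trans (∣A∪B∣ J₁ J₂ (λ x x∈₁ x∈₂ → disjoint x (F₁⊆ (M₁.IsBasisOf.subset b₁ x∈₁)) (F₂⊆ (M₂.IsBasisOf.subset b₂ x∈₂))))
      (sym (cong₂ ℕ._+_ (Rank.rank≡∣basis∣ M₁ b₁) (Rank.rank≡∣basis∣ M₂ b₂))))

  rk-sum : M.rk ≡ M₁.rk ℕ.+ M₂.rk
  rk-sum = trans (cong M.rank ground≡) (rank-∪ (λ p → p) (λ p → p))

  loop₁ : M₁.HasLoop → M.HasLoop
  loop₁ (x , x∈ , ¬ind) = x , ground₁ x∈ , λ ind → ¬ind (M₁.heredity (⁅⁆⊆ (x∈p∩q⁺ (x∈⁅x⁆ x , x∈))) (indep₁ ind))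

  loop₂ : M₂.HasLoop → M.HasLoop
  loop₂ (x , x∈ , ¬ind) = x , ground₂ x∈ , λ ind → ¬ind (M₂.heredity (⁅⁆⊆ (x∈p∩q⁺ (x∈⁅x⁆ x , x∈))) (indep₂ ind))

  loop⁻ : M.HasLoop → M₁.HasLoop ⊎ M₂.HasLoop
  loop⁻ (x , x∈ , ¬ind) = ∪-elim {S = M₁.ground} {M₂.ground}
    (λ x∈₁ → inj₁ (x , x∈₁ , λ ind → ¬ind (M.heredity ∈-∪ˡ (indep-∪ ind M₂.empty))))
    (λ x∈₂ → inj₂ (x , x∈₂ , λ ind → ¬ind (M.heredity ∈-∪ʳ (indep-∪ M₁.empty ind))))
    (subst (x ∈_) ground≡ x∈)

directSum-/ : ∀ {M M₁ M₂ : Matroid n} → DirectSum M M₁ M₂ → F₁ ⊆ Matroid.ground M₁ → F₂ ⊆ Matroid.ground M₂ →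
              DirectSum (M / (F₁ ∪ F₂)) (M₁ / F₁) (M₂ / F₂)
directSum-/ {F₁ = F₁} {F₂ = F₂} {M = M} {M₁} {M₂} s F₁⊆ F₂⊆ = record
  { ground≡  = ⊆-antisym
      (λ {x} x∈ → let x∉ = x∈p─q⇒x∉q M.ground (F₁ ∪ F₂) x∈ in ∪-elim {S = M₁.ground} {M₂.ground}
        (λ x∈₁ → ∈-∪ˡ (x∈p∧x∉q⇒x∈p─q x∈₁ (λ p → x∉ (∈-∪ˡ p))))
        (λ x∈₂ → ∈-∪ʳ (x∈p∧x∉q⇒x∈p─q x∈₂ (λ p → x∉ (∈-∪ʳ p))))
        (subst (x ∈_) ground≡ (p─q⊆p M.ground (F₁ ∪ F₂) x∈)))
      (∪-lub
        (λ {x} x∈ → let x∈₁ = p─q⊆p M₁.ground F₁ x∈ in x∈p∧x∉q⇒x∈p─q (ground₁ x∈₁)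
          (∪-elim (x∈p─q⇒x∉q M₁.ground F₁ x∈) (λ p → disjoint x x∈₁ (F₂⊆ p))))
        (λ {x} x∈ → let x∈₂ = p─q⊆p M₂.ground F₂ x∈ in x∈p∧x∉q⇒x∈p─q (ground₂ x∈₂)
          (∪-elim (λ p → disjoint x (F₁⊆ p) x∈₂) (x∈p─q⇒x∉q M₂.ground F₂ x∈))))
  ; disjoint = λ x x∈₁ x∈₂ → disjoint x (p─q⊆p M₁.ground F₁ x∈₁) (p─q⊆p M₂.ground F₂ x∈₂)
  ; indep₁   = λ {I} ind → Rank.indep/⁺ M₁ b₁ (p∩q⊆q I (M₁.ground ─ F₁))
      (M₁.heredity (λ x∈ → x∈p∩q⁺
        (∪-mono {A = I ∩ (M₁.ground ─ F₁)} {I} {J₁} {J₁ ∪ J₂} (p∩q⊆p I (M₁.ground ─ F₁)) ∈-∪ˡ x∈ ,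
         ∪-lub (λ p → p─q⊆p M₁.ground F₁ (p∩q⊆q I (M₁.ground ─ F₁) p)) (λ p → F₁⊆ (M₁.IsBasisOf.subset b₁ p)) x∈))
        (indep₁ (Rank.indep/⁻ M b ind)))
  ; indep₂   = λ {I} ind → Rank.indep/⁺ M₂ b₂ (p∩q⊆q I (M₂.ground ─ F₂))
      (M₂.heredity (λ x∈ → x∈p∩q⁺
        (∪-mono {A = I ∩ (M₂.ground ─ F₂)} {I} {J₂} {J₁ ∪ J₂} (p∩q⊆p I (M₂.ground ─ F₂)) ∈-∪ʳ x∈ ,
         ∪-lub (λ p → p─q⊆p M₂.ground F₂ (p∩q⊆q I (M₂.ground ─ F₂) p)) (λ p → F₂⊆ (M₂.IsBasisOf.subset b₂ p)) x∈))
        (indep₂ (Rank.indep/⁻ M b ind)))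
  ; indep-∪  = λ {I₁} {I₂} ind₁ ind₂ →
      let I₁⊆ = Matroid.⊆ground (M₁ / F₁) ind₁
          I₂⊆ = Matroid.⊆ground (M₂ / F₂) ind₂ in
      Rank.indep/⁺ M b
        (∪-lub (λ {x} p → let x∈₁ = p─q⊆p M₁.ground F₁ (I₁⊆ p) in x∈p∧x∉q⇒x∈p─q (ground₁ x∈₁)
                 (∪-elim (x∈p─q⇒x∉q M₁.ground F₁ (I₁⊆ p)) (λ q → disjoint x x∈₁ (F₂⊆ q))))
               (λ {x} p → let x∈₂ = p─q⊆p M₂.ground F₂ (I₂⊆ p) in x∈p∧x∉q⇒x∈p─q (ground₂ x∈₂)
                 (∪-elim (λ q → disjoint x (F₁⊆ q) x∈₂) (x∈p─q⇒x∉q M₂.ground F₂ (I₂⊆ p)))))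
        (M.heredity (∪-lub (∪-mono {A = I₁} {I₁ ∪ J₁} {I₂} {I₂ ∪ J₂} ∈-∪ˡ ∈-∪ˡ)
                             (∪-mono {A = J₁} {I₁ ∪ J₁} {J₂} {I₂ ∪ J₂} ∈-∪ʳ ∈-∪ʳ))
          (indep-∪ (Rank.indep/⁻ M₁ b₁ ind₁) (Rank.indep/⁻ M₂ b₂ ind₂)))
  }
  where
  open DirectSum s
  module M  = Matroid M
  module M₁ = Matroid M₁
  module M₂ = Matroid M₂
  J₁ = proj₁ (Rank.basis-exists M₁ F₁)
  J₂ = proj₁ (Rank.basis-exists M₂ F₂)
  b₁ = proj₂ (Rank.basis-exists M₁ F₁)
  b₂ = proj₂ (Rank.basis-exists M₂ F₂)
  b : M.IsBasisOf (F₁ ∪ F₂) (J₁ ∪ J₂)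
  b = basis-∪ F₁⊆ F₂⊆ b₁ b₂

record PointedSum (X Y₁ Y₂ : Pointed n) : Set where
  private
    module X  = Pointed X
    module Y₁ = Pointed Y₁
    module Y₂ = Pointed Y₂
  field
    directSum : DirectSum X.matroid Y₁.matroid Y₂.matroid
    agree₁    : ∀ {x} → x ∈ Y₁.ground → X.σ x ≡ Y₁.σ x
    agree₂    : ∀ {x} → x ∈ Y₂.ground → X.σ x ≡ Y₂.σ x
  open DirectSum directSum public

  fixed-∪ : F₁ ⊆ Y₁.ground → F₂ ⊆ Y₂.ground → Y₁.Fixed F₁ → Y₂.Fixed F₂ → X.Fixed (F₁ ∪ F₂)
  fixed-∪ F₁⊆ F₂⊆ fix₁ fix₂ = X.fixed (∪-elim
    (λ p → ∈-∪ˡ (subst (_∈ _) (sym (agree₁ (F₁⊆ p))) (Y₁.σ-fixed⁺ fix₁ p)))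
    (λ p → ∈-∪ʳ (subst (_∈ _) (sym (agree₂ (F₂⊆ p))) (Y₂.σ-fixed⁺ fix₂ p))))

  fixed₁ : X.Fixed F → Y₁.Fixed (F ∩ Y₁.ground)
  fixed₁ {F} fix = Y₁.fixed λ x∈ → let x∈F , x∈₁ = x∈p∩q⁻ F Y₁.ground x∈ in
    x∈p∩q⁺ (subst (_∈ F) (agree₁ x∈₁) (X.σ-fixed⁺ fix x∈F) , Y₁.ground-invariant Y₁.element x∈₁)

  fixed₂ : X.Fixed F → Y₂.Fixed (F ∩ Y₂.ground)
  fixed₂ {F} fix = Y₂.fixed λ x∈ → let x∈F , x∈₂ = x∈p∩q⁻ F Y₂.ground x∈ in
    x∈p∩q⁺ (subst (_∈ F) (agree₂ x∈₂) (X.σ-fixed⁺ fix x∈F) , Y₂.ground-invariant Y₂.element x∈₂)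

pointedSum-/ : ∀ {X Y₁ Y₂ : Pointed n} → PointedSum X Y₁ Y₂ → F₁ ⊆ Pointed.ground Y₁ → F₂ ⊆ Pointed.ground Y₂ →
               ∀ fix fix₁ fix₂ → PointedSum (Pointed.contract X (F₁ ∪ F₂) fix)
                 (Pointed.contract Y₁ F₁ fix₁) (Pointed.contract Y₂ F₂ fix₂)
pointedSum-/ {F₁ = F₁} {F₂ = F₂} {Y₁ = Y₁} {Y₂} s F₁⊆ F₂⊆ fix fix₁ fix₂ = record
  { directSum = directSum-/ directSum F₁⊆ F₂⊆
  ; agree₁    = λ x∈ → agree₁ (p─q⊆p (Pointed.ground Y₁) F₁ x∈)
  ; agree₂    = λ x∈ → agree₂ (p─q⊆p (Pointed.ground Y₂) F₂ x∈)
  }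
  where open PointedSum s

-- Changes `f` at the empty set only. An induction gives a termwise identity at the nonempty
-- subsets; with the predicted value `c` put in at the empty set, the discrepancy between the sums
-- is `c ℚ.- f ⊥`, exactly the quantity to be shown zero.
patch : (Subset n → ℚ) → ℚ → Subset n → ℚ
patch f c F with nonempty? F
... | yes _ = f F
... | no  _ = c

patch-⊥ : (f : Subset n → ℚ) (c : ℚ) → patch f c ⊥ ≡ c
patch-⊥ {n} f c with nonempty? (⊥ {n})
... | yes (_ , x∈) = contradiction x∈ ∉⊥
... | no _         = refl

∑-patch : (f : Subset n → ℚ) (c : ℚ) → ∑.∑ (patch f c) ≡ (c ℚ.- f ⊥) ℚ.+ ∑.∑ f
∑-patch {n} f c = begin
  ∑.∑ (patch f c)
    ≡⟨ solve 2 (λ a b → a := (a :- b) :+ b) refl (∑.∑ (patch f c)) (∑.∑ f) ⟩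
  (∑.∑ (patch f c) ℚ.- ∑.∑ f) ℚ.+ ∑.∑ f
    ≡⟨ cong (ℚ._+ ∑.∑ f) (trans (sym (∑.∑-- (patch f c) f)) (∑.∑-single (λ F → patch f c F ℚ.- f F) ⊥ off)) ⟩
  (patch f c ⊥ ℚ.- f ⊥) ℚ.+ ∑.∑ f
    ≡⟨ cong (λ z → (z ℚ.- f ⊥) ℚ.+ ∑.∑ f) (patch-⊥ f c) ⟩
  (c ℚ.- f ⊥) ℚ.+ ∑.∑ f ∎
  where
  open ≡-Reasoning
  open +-*-Solver
  off : ∀ F → F ≢ ⊥ → patch f c F ℚ.- f F ≡ 0ℚ
  off F F≢ with nonempty? F
  ... | yes _  = ℚR.-‿inverseʳ (f F)
  ... | no ¬ne = contradiction (Empty-unique ¬ne) F≢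

module DirectSums (KL : EquivariantKL) where
  open Characters KL

  module _ {X Y₁ Y₂ : Pointed n} (s : PointedSum X Y₁ Y₂) where
    private
      module X  = Pointed X
      module Y₁ = Pointed Y₁
      module Y₂ = Pointed Y₂
    open PointedSum s

    term-∪ : ∀ {F₁ F₂} → (F₁⊆ : F₁ ⊆ Y₁.ground) (F₂⊆ : F₂ ⊆ Y₂.ground) (fix₁ : Y₁.Fixed F₁) (fix₂ : Y₂.Fixed F₂) →
             p (X.contract (F₁ ∪ F₂) (fixed-∪ F₁⊆ F₂⊆ fix₁ fix₂)) ≗ˢ p (Y₁.contract F₁ fix₁) *ˢ p (Y₂.contract F₂ fix₂) →
             term X (F₁ ∪ F₂) ≗ˢ term Y₁ F₁ *ˢ term Y₂ F₂
    term-∪ {F₁} {F₂} F₁⊆ F₂⊆ fix₁ fix₂ product i = begin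
      term X (F₁ ∪ F₂) i
        ≡⟨ term-≡ X (∪⊆ F₁⊆ F₂⊆) (fixed-∪ F₁⊆ F₂⊆ fix₁ fix₂) i ⟩
      shift (X.rank (F₁ ∪ F₂)) (p (X.contract (F₁ ∪ F₂) (fixed-∪ F₁⊆ F₂⊆ fix₁ fix₂))) i
        ≡⟨ shift-cong (X.rank (F₁ ∪ F₂)) product i ⟩
      shift (X.rank (F₁ ∪ F₂)) (p (Y₁.contract F₁ fix₁) *ˢ p (Y₂.contract F₂ fix₂)) i
        ≡⟨ cong (λ r → shift r (p (Y₁.contract F₁ fix₁) *ˢ p (Y₂.contract F₂ fix₂)) i) (rank-∪ F₁⊆ F₂⊆) ⟩
      shift (Y₁.rank F₁ ℕ.+ Y₂.rank F₂) (p (Y₁.contract F₁ fix₁) *ˢ p (Y₂.contract F₂ fix₂)) i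
        ≡⟨ shift-*ˢ (Y₁.rank F₁) (Y₂.rank F₂) (p (Y₁.contract F₁ fix₁)) (p (Y₂.contract F₂ fix₂)) i ⟨
      (shift (Y₁.rank F₁) (p (Y₁.contract F₁ fix₁)) *ˢ shift (Y₂.rank F₂) (p (Y₂.contract F₂ fix₂))) i
        ≡⟨ *ˢ-cong (term-≡ Y₁ F₁⊆ fix₁) (term-≡ Y₂ F₂⊆ fix₂) i ⟨
      (term Y₁ F₁ *ˢ term Y₂ F₂) i ∎
      where open ≡-Reasoning

  Product : ℕ → Set₁
  Product N = ∀ {n} {X Y₁ Y₂ : Pointed n} → PointedSum X Y₁ Y₂ → ∣ Pointed.ground X ∣ ≤ N → p X ≗ˢ p Y₁ *ˢ p Y₂

  -- Expand Z₁Z₂ over pairs of subsets and compare with Z_X. By induction the terms agree except at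
  -- the empty set, so P₁P₂ - P_X = Z₁Z₂ - Z_X, which is palindromic of degree rk X = rk Y₁ + rk Y₂
  -- and of low degree.
  product : ∀ N → Product N
  product-pred : ∀ {N N′} → N ≡ suc N′ → Product N′
  product-pred {suc N} refl = product N
  product N {n} {X} {Y₁} {Y₂} s size≤ = by-loops (Rank.loop? Y₁.matroid) (Rank.loop? Y₂.matroid)
    where
    module X  = Pointed X
    module Y₁ = Pointed Y₁
    module Y₂ = Pointed Y₂
    open PointedSum s
    open ≡-Reasoning

    module _ {N′} (product : Product N′) (size≤ : ∣ X.ground ∣ ≤ suc N′) (k : ℕ) where
      a : Subset n → Subset n → ℚ
      a F₁ F₂ = (term Y₁ F₁ *ˢ term Y₂ F₂) k
      b : Subset n → ℚ
      b = patch (λ F → term X F k) ((p Y₁ *ˢ p Y₂) k)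

      b≡a : F₁ ⊆ Y₁.ground → F₂ ⊆ Y₂.ground → Y₁.Fixed F₁ → Y₂.Fixed F₂ → b (F₁ ∪ F₂) ≡ a F₁ F₂
      b≡a {F₁} {F₂} F₁⊆ F₂⊆ fix₁ fix₂ with nonempty? (F₁ ∪ F₂)
      ... | yes ne = term-∪ s F₁⊆ F₂⊆ fix₁ fix₂ (product (pointedSum-/ s F₁⊆ F₂⊆ _ fix₁ fix₂)
              (ℕ.≤-pred (ℕ.≤-trans (∣─∣< (∪⊆ F₁⊆ F₂⊆) ne) size≤))) k
      ... | no ¬ne with refl ← Empty-unique {p = F₁} (λ (x , p) → ¬ne (x , ∈-∪ˡ p))
                      | refl ← Empty-unique {p = F₂} (λ (x , p) → ¬ne (x , ∈-∪ʳ p)) =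
              sym (*ˢ-cong (term-⊥ Y₁) (term-⊥ Y₂) k)

      a-support : ∀ F₁ F₂ → a F₁ F₂ ≢ 0ℚ → (F₁ ⊆ Y₁.ground × Y₁.Fixed F₁) × (F₂ ⊆ Y₂.ground × Y₂.Fixed F₂)
      a-support F₁ F₂ ≢0 =
        decidable-stable ((F₁ ⊆? Y₁.ground) ×-dec Y₁.fixed? F₁)
          (λ ¬s → ≢0 (*ˢ-0ˡ (term Y₂ F₂) (term-0 Y₁ ¬s) k)) ,
        decidable-stable ((F₂ ⊆? Y₂.ground) ×-dec Y₂.fixed? F₂)
          (λ ¬s → ≢0 (*ˢ-0ʳ (term Y₁ F₁) (term-0 Y₂ ¬s) k))

      b-support : ∀ F → b F ≢ 0ℚ → F ⊆ X.ground × X.Fixed F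
      b-support F ≢0 with nonempty? F
      ... | yes _ = term-support X k ≢0
      ... | no ¬ne with refl ← Empty-unique ¬ne = ⊥⊆ , X.fixed (λ x∈ → contradiction x∈ ∉⊥)

      -- Pairs correspond to subsets by union and by intersection with the two ground sets. These
      -- maps are inverse to each other only within the ground sets, which is where the terms are
      -- supported.
      reindexed : ∑.∑ (λ F₁ → ∑.∑ (a F₁)) ≡ ∑.∑ b
      reindexed = trans (∑-pairs (subsetEnumeration n) (subsetEnumeration n) a)
        (∑-reindex (pairs (subsetEnumeration n) (subsetEnumeration n)) (subsetEnumeration n)
          (λ (F₁ , F₂) → a F₁ F₂) b (λ (F₁ , F₂) → F₁ ∪ F₂) (λ F → F ∩ Y₁.ground , F ∩ Y₂.ground)
          (λ (F₁ , F₂) ≢0 → let ((⊆₁ , fix₁) , (⊆₂ , fix₂)) = a-support F₁ F₂ ≢0 in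
            b≡a ⊆₁ ⊆₂ fix₁ fix₂ , cong₂ _,_ (∩₁ ⊆₁ ⊆₂) (∩₂ ⊆₁ ⊆₂))
          (λ F ≢0 → let (F⊆ , fix) = b-support F ≢0 in
            trans (sym (b≡a (p∩q⊆q F Y₁.ground) (p∩q⊆q F Y₂.ground) (fixed₁ fix) (fixed₂ fix))) (cong b (∪∩ F⊆)) ,
            ∪∩ F⊆))

      z-product : X.Loopless → Y₁.Loopless → Y₂.Loopless →
                  (z Y₁ *ˢ z Y₂) k ≡ ((p Y₁ *ˢ p Y₂) k ℚ.- p X k) ℚ.+ z X k
      z-product llX ll₁ ll₂ = begin
        (z Y₁ *ˢ z Y₂) k
          ≡⟨ *ˢ-cong (z-sum Y₁ ll₁) (z-sum Y₂ ll₂) k ⟩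
        (∑ˢ (term Y₁) *ˢ ∑ˢ (term Y₂)) k
          ≡⟨ ∑ˢ-*ʳ (term Y₁) (∑ˢ (term Y₂)) k ⟩
        ∑.∑ (λ F₁ → (term Y₁ F₁ *ˢ ∑ˢ (term Y₂)) k)
          ≡⟨ ∑.∑-cong {n} (λ F₁ → ∑ˢ-*ˡ (term Y₁ F₁) (term Y₂) k) ⟩
        ∑.∑ (λ F₁ → ∑.∑ (a F₁))
          ≡⟨ reindexed ⟩
        ∑.∑ b
          ≡⟨ ∑-patch (λ F → term X F k) ((p Y₁ *ˢ p Y₂) k) ⟩
        ((p Y₁ *ˢ p Y₂) k ℚ.- term X ⊥ k) ℚ.+ ∑ˢ (term X) k
          ≡⟨ cong₂ (λ u v → ((p Y₁ *ˢ p Y₂) k ℚ.- u) ℚ.+ v) (term-⊥ X k) (sym (z-sum X llX k)) ⟩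
        ((p Y₁ *ˢ p Y₂) k ℚ.- p X k) ℚ.+ z X k ∎

    -- A factor of rank zero has P = 1, which violates the strict bound for its own rank; the
    -- product then reduces to the other factor, which has positive rank.
    lowDegree : Y₁.Loopless → Y₂.Loopless → 0 < Y₁.rk ℕ.+ Y₂.rk → LowDegree (Y₁.rk ℕ.+ Y₂.rk) (p Y₁ *ˢ p Y₂)
    lowDegree ll₁ ll₂ 0<rk k rk≤ with Y₁.rk ℕ.≟ 0 | Y₂.rk ℕ.≟ 0
    ... | yes r₁≡0 | _ = trans (*ˢ-cong (p-rank-0 Y₁ ll₁ r₁≡0) (λ _ → refl) k) (trans (*ˢ-identityˡ (p Y₂) k)
            (p-lowDegree Y₂ ll₂ (subst (λ r → 0 < r ℕ.+ Y₂.rk) r₁≡0 0<rk) k (subst (λ r → r ℕ.+ Y₂.rk ≤ 2 ℕ.* k) r₁≡0 rk≤)))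
    ... | no r₁≢0 | yes r₂≡0 = trans (*ˢ-cong {p Y₁} (λ _ → refl) (p-rank-0 Y₂ ll₂ r₂≡0) k) (trans (*ˢ-identityʳ (p Y₁) k)
            (p-lowDegree Y₁ ll₁ (ℕ.n≢0⇒n>0 r₁≢0) k (ℕ.m+n≤o⇒m≤o Y₁.rk rk≤)))
    ... | no r₁≢0 | no r₂≢0 = *ˢ-lowDegree (p-lowDegree Y₁ ll₁ (ℕ.n≢0⇒n>0 r₁≢0)) (p-lowDegree Y₂ ll₂ (ℕ.n≢0⇒n>0 r₂≢0)) k
            (ℕ.m≤n⇒m≤1+n rk≤)

    by-size : ∀ N → (∀ {N′} → N ≡ suc N′ → Product N′) → ∣ X.ground ∣ ≤ N →
              X.Loopless → Y₁.Loopless → Y₂.Loopless → 0 < X.rk → p X ≗ˢ p Y₁ *ˢ p Y₂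
    by-size zero     _   size≤ _   _   _   0<rk = contradiction
      (ℕ.≤-trans 0<rk (ℕ.≤-trans (Rank.rank≤∣∣ X.matroid X.ground) size≤)) (λ ())
    by-size (suc N′) prd size≤ llX ll₁ ll₂ 0<rk k = begin
      p X k                                 ≡⟨ solve 2 (λ a b → a := b :- (b :- a)) refl (p X k) ((p Y₁ *ˢ p Y₂) k) ⟩
      (p Y₁ *ˢ p Y₂) k ℚ.- ((p Y₁ *ˢ p Y₂) -ˢ p X) k
        ≡⟨ cong (λ z → (p Y₁ *ˢ p Y₂) k ℚ.- z) (palindromic-lowDegree pal low k) ⟩
      (p Y₁ *ˢ p Y₂) k ℚ.- 0ℚ               ≡⟨ ℚR.+-identityʳ _ ⟩
      (p Y₁ *ˢ p Y₂) k                      ∎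
      where
      open +-*-Solver
      pal : Palindromic X.rk ((p Y₁ *ˢ p Y₂) -ˢ p X)
      pal = palindromic-cong
        (λ j → trans (cong (ℚ._- z X j) (z-product (prd refl) size≤ j llX ll₁ ll₂))
          (solve 2 (λ d z → (d :+ z) :- z := d) refl ((p Y₁ *ˢ p Y₂) j ℚ.- p X j) (z X j)))
        (palindromic-- (subst (λ r → Palindromic r (z Y₁ *ˢ z Y₂)) (sym rk-sum)
          (palindromic-* (z-palindromic Y₁ ll₁) (z-palindromic Y₂ ll₂))) (z-palindromic X llX))
      low : LowDegree X.rk ((p Y₁ *ˢ p Y₂) -ˢ p X)
      low j le = cong₂ ℚ._-_
        (lowDegree ll₁ ll₂ (subst (0 <_) rk-sum 0<rk) j (subst (_≤ 2 ℕ.* j) rk-sum le))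
        (p-lowDegree X llX 0<rk j le)

    by-loops : Dec Y₁.HasLoop → Dec Y₂.HasLoop → p X ≗ˢ p Y₁ *ˢ p Y₂
    by-loops (yes l) _       k = trans (p-loop X (loop₁ l) k) (sym (*ˢ-0ˡ (p Y₂) (p-loop Y₁ l) k))
    by-loops (no _)  (yes l) k = trans (p-loop X (loop₂ l) k) (sym (*ˢ-0ʳ (p Y₁) (p-loop Y₂ l) k))
    by-loops (no ¬l₁) (no ¬l₂) with X.rk ℕ.≟ 0
    ... | no rk≢0 = by-size N (product-pred {N}) size≤ (loopless X (λ l → [ ¬l₁ , ¬l₂ ]′ (loop⁻ l)))
            (loopless Y₁ ¬l₁) (loopless Y₂ ¬l₂) (ℕ.n≢0⇒n>0 rk≢0)
    ... | yes rk≡0 = λ k → trans (p-rank-0 X (loopless X (λ l → [ ¬l₁ , ¬l₂ ]′ (loop⁻ l))) rk≡0 k)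
            (sym (trans (*ˢ-cong (p-rank-0 Y₁ (loopless Y₁ ¬l₁) (ℕ.m+n≡0⇒m≡0 Y₁.rk (trans (sym rk-sum) rk≡0)))
                                 (p-rank-0 Y₂ (loopless Y₂ ¬l₂) (ℕ.m+n≡0⇒n≡0 Y₁.rk (trans (sym rk-sum) rk≡0))) k)
                        (*ˢ-identityˡ 1ˢ k)))

  p-product : ∀ {X Y₁ Y₂ : Pointed n} → PointedSum X Y₁ Y₂ → p X ≗ˢ p Y₁ *ˢ p Y₂
  p-product s = product _ s ℕ.≤-refl

-- The glued cycles

∈-─⁺ : x ∈ S → x ∉ T → x ∈ S ─ T
∈-─⁺ = x∈p∧x∉q⇒x∈p─q

∈-─⁻ : x ∈ S ─ T → x ∈ S × x ∉ T
∈-─⁻ {S = S} {T} x∈ = p─q⊆p S T x∈ , x∈p─q⇒x∉q S T x∈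

─⊆⇒⊆∪ : S ─ F ⊆ I → S ⊆ I ∪ F
─⊆⇒⊆∪ {F = F} p {x} x∈ with x ∈? F
... | yes x∈F = ∈-∪ʳ x∈F
... | no x∉F  = ∈-∪ˡ (p (∈-─⁺ x∈ x∉F))

⊆∪⇒─⊆ : S ⊆ I ∪ F → S ─ F ⊆ I
⊆∪⇒─⊆ {S = S} {I} {F} p x∈ = let x∈S , x∉F = ∈-─⁻ {S = S} x∈ in
  ∪-elim (λ q → q) (λ x∈F → contradiction x∈F x∉F) (p x∈S)

─-distrib-∪ : ∀ (S T F : Subset n) → (S ∪ T) ─ F ≡ (S ─ F) ∪ (T ─ F)
─-distrib-∪ S T F = ⊆-antisym
  (λ x∈ → let y , x∉F = ∈-─⁻ {S = S ∪ T} x∈ in ∪-elim (λ q → ∈-∪ˡ (∈-─⁺ q x∉F)) (λ q → ∈-∪ʳ (∈-─⁺ q x∉F)) y)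
  (∪-elim (λ x∈ → let y , x∉F = ∈-─⁻ {S = S} x∈ in ∈-─⁺ (∈-∪ˡ y) x∉F)
          (λ x∈ → let y , x∉F = ∈-─⁻ {S = T} x∈ in ∈-─⁺ (∈-∪ʳ y) x∉F))

─-∩ : ∀ (S F : Subset n) → S ─ (F ∩ S) ≡ S ─ F
─-∩ S F = ⊆-antisym
  (λ x∈ → let y , x∉ = ∈-─⁻ {S = S} x∈ in ∈-─⁺ y (λ x∈F → x∉ (x∈p∩q⁺ (x∈F , y))))
  (λ x∈ → let y , x∉ = ∈-─⁻ {S = S} x∈ in ∈-─⁺ y (λ x∈∩ → x∉ (p∩q⊆p F S x∈∩)))

∈⁅⁆ : ∀ {x y : Fin n} → x ∈ ⁅ y ⁆ → x ≡ y
∈⁅⁆ {y = y} = x∈⁅y⁆⇒x≡y y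

∣-∣ : x ∈ S → suc ∣ S - x ∣ ≡ ∣ S ∣
∣-∣ {x = x} {S} x∈ = begin
  suc ∣ S - x ∣                ≡⟨ ℕ.+-comm 1 ∣ S - x ∣ ⟩
  ∣ S - x ∣ ℕ.+ 1              ≡⟨ cong (∣ S - x ∣ ℕ.+_) (∣⁅x⁆∣≡1 x) ⟨
  ∣ S - x ∣ ℕ.+ ∣ ⁅ x ⁆ ∣      ≡⟨ ∣A∪B∣ (S - x) ⁅ x ⁆ (λ y → x∈p─q⇒x∉q S ⁅ x ⁆) ⟨
  ∣ (S - x) ∪ ⁅ x ⁆ ∣          ≡⟨ cong ∣_∣ (⊆-antisym (∪-lub (p─q⊆p S ⁅ x ⁆) (⁅⁆⊆ x∈)) (─⊆⇒⊆∪ (λ p → p))) ⟩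
  ∣ S ∣                        ∎
  where open ≡-Reasoning

-- A description by independent sets that passes to contractions, whereas `C[ S ] / F` is not
-- literally of the form `C[ S ─ F ]`.
record IsCycle (M : Matroid n) (S : Subset n) : Set where
  open Matroid M
  field
    ground≡ : ground ≡ S
    indep⁺  : I ⊆ S → ¬ S ⊆ I → Indep I
    indep⁻  : Indep I → ¬ S ⊆ I

  suc-rk : Nonempty S → suc rk ≡ ∣ S ∣
  suc-rk (x , x∈) = trans (cong suc (Rank.rank≡∣basis∣ M (subst (λ G → IsBasisOf G (S - x)) (sym ground≡) record
    { indep   = indep⁺ (p─q⊆p S ⁅ x ⁆) (λ S⊆ → x∈p─q⇒x∉q S ⁅ x ⁆ (S⊆ x∈) (x∈⁅x⁆ x))
    ; subset  = p─q⊆p S ⁅ x ⁆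
    ; maximal = λ {y} y∈ ind → decidable-stable (y ∈? S - x) (λ y∉ → indep⁻ ind (λ {w} w∈ → cover w∈ y∈ y∉))
    }))) (∣-∣ x∈)
    where
    cover : ∀ {w y} → w ∈ S → y ∈ S → y ∉ S - x → w ∈ (S - x) ∪ ⁅ y ⁆
    cover {w} {y} w∈ y∈ y∉ with w ∈? ⁅ x ⁆
    ... | no w∉  = ∈-∪ˡ (∈-─⁺ w∈ w∉)
    ... | yes w∈x with y ∈? ⁅ x ⁆
    ...   | no y∉x  = contradiction (∈-─⁺ y∈ y∉x) y∉
    ...   | yes y∈x rewrite ∈⁅⁆ w∈x | ∈⁅⁆ y∈x = ∈-∪ʳ (x∈⁅x⁆ x)

cycle-/ : {M : Matroid n} → IsCycle M S → F ⊆ S → ¬ S ⊆ F → IsCycle (M / F) (S ─ F)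
cycle-/ {S = S} {F} {M} c F⊆ S⊈F = record
  { ground≡ = cong (_─ F) ground≡
  ; indep⁺  = λ {I} I⊆ S─F⊈I → Rank.indep/⁺ M basis (subst (λ G → I ⊆ G ─ F) (sym ground≡) I⊆)
      (indep⁺ (∪-lub (λ p → p─q⊆p S F (I⊆ p)) F⊆) (λ S⊆ → S─F⊈I (⊆∪⇒─⊆ S⊆)))
  ; indep⁻  = λ ind S─F⊆I → indep⁻ (Rank.indep/⁻ M basis ind) (─⊆⇒⊆∪ S─F⊆I)
  }
  where
  open IsCycle c
  basis : Matroid.IsBasisOf M F F
  basis = record { indep = indep⁺ F⊆ S⊈F ; subset = λ p → p ; maximal = λ p _ → p }

-- The circuits are the unions of two of the three sets `G₁`, `G₂` and `⁅ e ⁆`. In this form the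
-- matroid is recognized again after a contraction that shortens `G₁` and `G₂`.
record IsTheta (M : Matroid n) (G₁ G₂ : Subset n) (e : Fin n) : Set where
  open Matroid M
  field
    ground≡  : ground ≡ (G₁ ∪ G₂) ∪ ⁅ e ⁆
    indep⁺   : I ⊆ ground → ¬ (G₁ ⊆ I × e ∈ I) → ¬ (G₂ ⊆ I × e ∈ I) → ¬ (G₁ ⊆ I × G₂ ⊆ I) → Indep I
    indep₁   : Indep I → ¬ (G₁ ⊆ I × e ∈ I)
    indep₂   : Indep I → ¬ (G₂ ⊆ I × e ∈ I)
    indep₁₂  : Indep I → ¬ (G₁ ⊆ I × G₂ ⊆ I)

  G₁⊆ground : G₁ ⊆ ground
  G₁⊆ground x∈ = subst (_ ∈_) (sym ground≡) (∈-∪ˡ (∈-∪ˡ x∈))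

  G₂⊆ground : G₂ ⊆ ground
  G₂⊆ground x∈ = subst (_ ∈_) (sym ground≡) (∈-∪ˡ (∈-∪ʳ x∈))

  e∈ground : e ∈ ground
  e∈ground = subst (e ∈_) (sym ground≡) (∈-∪ʳ (x∈⁅x⁆ e))

  ground-e : x ∈ ground → x ∉ ⁅ e ⁆ → x ∈ G₁ ∪ G₂
  ground-e x∈ x∉ = ∪-elim (λ p → p) (λ p → contradiction p x∉) (subst (_ ∈_) ground≡ x∈)

-- The glued graph consists of three paths with common endpoints, with edge sets G₁ = A∖e, G₂ = B∖e and {e};
-- a set of edges is independent when it contains at most one of the paths.
record Theta (X N Y₁ Y₂ : Pointed n) (G₁ G₂ : Subset n) (e : Fin n) : Set where
  private
    module X  = Pointed X
    module N  = Pointed N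
    module Y₁ = Pointed Y₁
    module Y₂ = Pointed Y₂
  field
    e∉₁      : e ∉ G₁
    e∉₂      : e ∉ G₂
    disjoint : ∀ x → x ∈ G₁ → x ∉ G₂
    ne₁      : Nonempty G₁
    ne₂      : Nonempty G₂
    theta    : IsTheta X.matroid G₁ G₂ e
    cycle    : IsCycle N.matroid (G₁ ∪ G₂)
    cycle₁   : IsCycle Y₁.matroid G₁
    cycle₂   : IsCycle Y₂.matroid G₂
    σ-e      : X.σ e ≡ e
    agree    : ∀ {x} → x ∈ G₁ ∪ G₂ → X.σ x ≡ N.σ x
    agree₁   : ∀ {x} → x ∈ G₁ → X.σ x ≡ Y₁.σ x
    agree₂   : ∀ {x} → x ∈ G₂ → X.σ x ≡ Y₂.σ x

  open IsTheta theta public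
  module C  = IsCycle cycle
  module C₁ = IsCycle cycle₁
  module C₂ = IsCycle cycle₂

  e∉₁₂ : e ∉ G₁ ∪ G₂
  e∉₁₂ = ∪-elim e∉₁ e∉₂

  G⊆ground : G₁ ∪ G₂ ⊆ X.ground
  G⊆ground = ∪-lub G₁⊆ground G₂⊆ground

  -- Every circuit contains two disjoint nonempty paths, so no singleton contains a circuit.
  X-loopless : X.Loopless
  X-loopless x (x∈ , ¬ind) = ¬ind (indep⁺ (⁅⁆⊆ x∈)
    (λ (p , q) → e∉₁ (subst (_∈ G₁) (trans (∈⁅⁆ (p (proj₂ ne₁))) (sym (∈⁅⁆ q))) (proj₂ ne₁)))
    (λ (p , q) → e∉₂ (subst (_∈ G₂) (trans (∈⁅⁆ (p (proj₂ ne₂))) (sym (∈⁅⁆ q))) (proj₂ ne₂)))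
    (λ (p , q) → disjoint (proj₁ ne₁) (proj₂ ne₁)
      (subst (_∈ G₂) (trans (∈⁅⁆ (q (proj₂ ne₂))) (sym (∈⁅⁆ (p (proj₂ ne₁))))) (proj₂ ne₂))))

  N-loopless : N.Loopless
  N-loopless x (x∈ , ¬ind) = ¬ind (C.indep⁺ (⁅⁆⊆ (subst (x ∈_) C.ground≡ x∈))
    (λ p → disjoint (proj₁ ne₁) (proj₂ ne₁) (subst (_∈ G₂)
      (trans (∈⁅⁆ (p (∈-∪ʳ (proj₂ ne₂)))) (sym (∈⁅⁆ (p (∈-∪ˡ (proj₂ ne₁)))))) (proj₂ ne₂))))

  σ-G₁ : ∀ {x} → x ∈ G₁ → X.σ x ∈ G₁
  σ-G₁ x∈ = subst₂ _∈_ (sym (agree₁ x∈)) C₁.ground≡ (Y₁.ground-invariant Y₁.element (subst (_ ∈_) (sym C₁.ground≡) x∈))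

  σ-G₂ : ∀ {x} → x ∈ G₂ → X.σ x ∈ G₂
  σ-G₂ x∈ = subst₂ _∈_ (sym (agree₂ x∈)) C₂.ground≡ (Y₂.ground-invariant Y₂.element (subst (_ ∈_) (sym C₂.ground≡) x∈))

  module _ (F⊆ : F ⊆ G₁ ∪ G₂) where

    e∉F : e ∉ F
    e∉F e∈ = e∉₁₂ (F⊆ e∈)

    F⊆X : F ⊆ X.ground
    F⊆X x∈ = G⊆ground (F⊆ x∈)

    F⊆N : F ⊆ N.ground
    F⊆N x∈ = subst (_ ∈_) (sym C.ground≡) (F⊆ x∈)

    F∪e⊆ : F ∪ ⁅ e ⁆ ⊆ X.ground
    F∪e⊆ = ∪-lub F⊆X (⁅⁆⊆ e∈ground)

    fixed-e : X.Fixed F → X.Fixed (F ∪ ⁅ e ⁆)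
    fixed-e fix = X.fixed (∪-elim (λ p → ∈-∪ˡ (X.σ-fixed⁺ fix p))
      (λ p → ∈-∪ʳ (subst (_∈ ⁅ e ⁆) (sym (trans (cong X.σ (∈⁅⁆ p)) σ-e)) (x∈⁅x⁆ e))))

    fixed-N : X.Fixed F → N.Fixed F
    fixed-N fix = N.fixed (λ x∈ → subst (_∈ F) (agree (F⊆ x∈)) (X.σ-fixed⁺ fix x∈))

    fixed-X : N.Fixed F → X.Fixed F
    fixed-X fix = X.fixed (λ x∈ → subst (_∈ F) (sym (agree (F⊆ x∈))) (N.σ-fixed⁺ fix x∈))

    fixed-Y₁ : X.Fixed F → Y₁.Fixed (F ∩ G₁)
    fixed-Y₁ fix = Y₁.fixed λ x∈ → let x∈F , x∈₁ = x∈p∩q⁻ F G₁ x∈ in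
      subst (_∈ F ∩ G₁) (agree₁ x∈₁) (x∈p∩q⁺ (X.σ-fixed⁺ fix x∈F , σ-G₁ x∈₁))

    fixed-Y₂ : X.Fixed F → Y₂.Fixed (F ∩ G₂)
    fixed-Y₂ fix = Y₂.fixed λ x∈ → let x∈F , x∈₂ = x∈p∩q⁻ F G₂ x∈ in
      subst (_∈ F ∩ G₂) (agree₂ x∈₂) (x∈p∩q⁺ (X.σ-fixed⁺ fix x∈F , σ-G₂ x∈₂))

    indep-X⇒N : X.Indep F → N.Indep F
    indep-X⇒N ind = C.indep⁺ F⊆ (λ p → indep₁₂ ind ((λ q → p (∈-∪ˡ q)) , (λ q → p (∈-∪ʳ q))))

    indep-N⇒X : N.Indep F → X.Indep F
    indep-N⇒X ind = indep⁺ F⊆X (λ (_ , q) → e∉F q) (λ (_ , q) → e∉F q) (λ (p , q) → C.indep⁻ ind (∪-lub p q))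

  -- `N` is `X` with `e` deleted: on subsets of `G₁ ∪ G₂` both have the same independent sets.
  basis-N⇒X : F ⊆ G₁ ∪ G₂ → N.IsBasisOf F J → X.IsBasisOf F J
  basis-N⇒X {F} {J} F⊆ b = record
    { indep   = indep-N⇒X (λ p → F⊆ (b.subset p)) b.indep
    ; subset  = b.subset
    ; maximal = λ x∈ ind → b.maximal x∈ (indep-X⇒N (∪-lub (λ p → F⊆ (b.subset p)) (⁅⁆⊆ (F⊆ x∈))) ind)
    }
    where module b = N.IsBasisOf b

  -- A single path is independent, so some basis of `F` contains the path in question, and `e`
  -- closes it to a circuit. If `e` could be added to another basis `J` of `F`, the exchange
  -- property would add it to that one too.
  e-spanned : F ⊆ G₁ ∪ G₂ → G₁ ⊆ F ⊎ G₂ ⊆ F → X.IsBasisOf F J → ¬ X.Indep (⁅ e ⁆ ∪ J)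
  e-spanned F⊆ (inj₁ G₁⊆) b ind with K , G₁⊆K , bK ← X.extend
      (indep⁺ G₁⊆ground (λ (_ , q) → e∉₁ q) (λ (_ , q) → e∉₁ q)
        (λ (_ , q) → disjoint (proj₁ ne₂) (q (proj₂ ne₂)) (proj₂ ne₂))) G₁⊆ =
    indep₁ (Rank.basis-exchange X.matroid b bK (λ x p q → e∉F F⊆ (subst (_∈ _) (∈⁅⁆ p) q)) ind)
      ((λ p → ∈-∪ʳ (G₁⊆K p)) , ∈-∪ˡ (x∈⁅x⁆ e))
  e-spanned F⊆ (inj₂ G₂⊆) b ind with K , G₂⊆K , bK ← X.extend
      (indep⁺ G₂⊆ground (λ (_ , q) → e∉₂ q) (λ (_ , q) → e∉₂ q)
        (λ (q , _) → disjoint (proj₁ ne₁) (proj₂ ne₁) (q (proj₂ ne₁)))) G₂⊆ =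
    indep₂ (Rank.basis-exchange X.matroid b bK (λ x p q → e∉F F⊆ (subst (_∈ _) (∈⁅⁆ p) q)) ind)
      ((λ p → ∈-∪ʳ (G₂⊆K p)) , ∈-∪ˡ (x∈⁅x⁆ e))

  module Spanning (F⊆ : F ⊆ G₁ ∪ G₂) (path : G₁ ⊆ F ⊎ G₂ ⊆ F) where

    loop-e : Matroid.HasLoop (X.matroid / F)
    loop-e = e , ∈-─⁺ e∈ground (e∉F F⊆) , λ ind →
      let J , b = Rank.basis-exists X.matroid F in e-spanned F⊆ path b (Rank.indep/⁻ X.matroid b ind)

    basis-e : N.IsBasisOf F J → X.IsBasisOf (F ∪ ⁅ e ⁆) J
    basis-e {J} b = record
      { indep   = bX.indep
      ; subset  = λ p → ∈-∪ˡ (bX.subset p)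
      ; maximal = λ x∈ ind → ∪-elim (λ p → bX.maximal p ind)
          (λ p → contradiction (subst X.Indep (∪-comm J ⁅ e ⁆) (subst (λ y → X.Indep (J ∪ ⁅ y ⁆)) (∈⁅⁆ p) ind))
            (e-spanned F⊆ path (basis-N⇒X F⊆ b))) x∈
      }
      where module bX = X.IsBasisOf (basis-N⇒X F⊆ b)

    rank-e : X.rank (F ∪ ⁅ e ⁆) ≡ N.rank F
    rank-e = let J , b = Rank.basis-exists N.matroid F in
      trans (Rank.rank≡∣basis∣ X.matroid (basis-e b)) (sym (Rank.rank≡∣basis∣ N.matroid b))

    -- Since `F` spans `e`, a basis of `F` in `N` is also a basis of `F ∪ ⁅ e ⁆` in `X`. With it
    -- both contractions test independence on subsets of `G₁ ∪ G₂`, where `X` and `N` agree.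
    contract-e : X.matroid / (F ∪ ⁅ e ⁆) ≃ N.matroid / F
    contract-e = record
      { ground≡ = grounds
      ; to      = λ {I} ind → let I⊆ = Matroid.⊆ground (X.matroid / (F ∪ ⁅ e ⁆)) ind in
          Rank.indep/⁺ N.matroid b₀ (λ p → subst (_ ∈_) grounds (I⊆ p))
            (indep-X⇒N (I∪J⊆ (λ p → subst (_ ∈_) grounds (I⊆ p))) (Rank.indep/⁻ X.matroid (basis-e b₀) ind))
      ; from    = λ {I} ind → let I⊆ = Matroid.⊆ground (N.matroid / F) ind in
          Rank.indep/⁺ X.matroid (basis-e b₀) (λ p → subst (_ ∈_) (sym grounds) (I⊆ p))
            (indep-N⇒X (I∪J⊆ I⊆) (Rank.indep/⁻ N.matroid b₀ ind))
      }
      where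
      J₀ = proj₁ (Rank.basis-exists N.matroid F)
      b₀ = proj₂ (Rank.basis-exists N.matroid F)
      grounds : X.ground ─ (F ∪ ⁅ e ⁆) ≡ N.ground ─ F
      grounds = ⊆-antisym
        (λ x∈ → let y , x∉ = ∈-─⁻ {S = X.ground} x∈ in
          ∈-─⁺ (subst (_ ∈_) (sym C.ground≡) (ground-e y (λ q → x∉ (∈-∪ʳ q)))) (λ q → x∉ (∈-∪ˡ q)))
        (λ x∈ → let y , x∉ = ∈-─⁻ {S = N.ground} x∈
                    y′ = subst (_ ∈_) C.ground≡ y in
          ∈-─⁺ (G⊆ground y′) (∪-elim x∉ (λ q → e∉₁₂ (subst (_∈ G₁ ∪ G₂) (∈⁅⁆ q) y′))))
      I∪J⊆ : I ⊆ N.ground ─ F → I ∪ J₀ ⊆ G₁ ∪ G₂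
      I∪J⊆ I⊆ = ∪-lub (λ p → subst (_ ∈_) C.ground≡ (p─q⊆p N.ground F (I⊆ p))) (λ p → F⊆ (N.IsBasisOf.subset b₀ p))

    contract-e-iso : ∀ fix fix′ → PointedIso 𝔖-id (X.contract (F ∪ ⁅ e ⁆) fix) (N.contract F fix′)
    contract-e-iso fix fix′ = record
      { iso         = ≃⇒Iso contract-e
      ; equivariant = λ x∈ → agree (subst (_ ∈_) C.ground≡ (p─q⊆p N.ground F (subst (_ ∈_) (_≃_.ground≡ contract-e) x∈)))
      }

  module Proper (F⊆ : F ⊆ G₁ ∪ G₂) (G₁⊈ : ¬ G₁ ⊆ F) (G₂⊈ : ¬ G₂ ⊆ F) where

    indep-F : X.Indep F
    indep-F = indep⁺ (F⊆X F⊆) (λ (p , _) → G₁⊈ p) (λ (p , _) → G₂⊈ p) (λ (p , _) → G₁⊈ p)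

    indep-F∪e : X.Indep (F ∪ ⁅ e ⁆)
    indep-F∪e = indep⁺ (F∪e⊆ F⊆) (λ (p , _) → G₁⊈ (drop e∉₁ p)) (λ (p , _) → G₂⊈ (drop e∉₂ p)) (λ (p , _) → G₁⊈ (drop e∉₁ p))
      where
      drop : ∀ {G} → e ∉ G → G ⊆ F ∪ ⁅ e ⁆ → G ⊆ F
      drop {G} e∉ p x∈ = ∪-elim (λ q → q) (λ q → contradiction (subst (_∈ G) (∈⁅⁆ q) x∈) e∉) (p x∈)

    ⊈₁ : ¬ G₁ ⊆ F ∩ G₁
    ⊈₁ p = G₁⊈ (λ q → p∩q⊆p F G₁ (p q))

    ⊈₂ : ¬ G₂ ⊆ F ∩ G₂
    ⊈₂ p = G₂⊈ (λ q → p∩q⊆p F G₂ (p q))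

    indep-F₁ : Y₁.Indep (F ∩ G₁)
    indep-F₁ = C₁.indep⁺ (p∩q⊆q F G₁) ⊈₁

    indep-F₂ : Y₂.Indep (F ∩ G₂)
    indep-F₂ = C₂.indep⁺ (p∩q⊆q F G₂) ⊈₂

    rank-X≡N : X.rank F ≡ N.rank F
    rank-X≡N = trans (Rank.indep-rank X.matroid indep-F) (sym (Rank.indep-rank N.matroid (indep-X⇒N F⊆ indep-F)))

    split-F : (F ∩ G₁) ∪ (F ∩ G₂) ≡ F
    split-F = ⊆-antisym (∪-lub (p∩q⊆p F G₁) (p∩q⊆p F G₂))
      (λ x∈ → ∪-elim (λ q → ∈-∪ˡ (x∈p∩q⁺ (x∈ , q))) (λ q → ∈-∪ʳ (x∈p∩q⁺ (x∈ , q))) (F⊆ x∈))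

    -- All the sets involved are independent, so ranks are cardinalities. The extra one, contributed
    -- by `e`, becomes the factor x of the correction term.
    rank-e : X.rank (F ∪ ⁅ e ⁆) ≡ suc (Y₁.rank (F ∩ G₁) ℕ.+ Y₂.rank (F ∩ G₂))
    rank-e = begin
      X.rank (F ∪ ⁅ e ⁆)                   ≡⟨ Rank.indep-rank X.matroid indep-F∪e ⟩
      ∣ F ∪ ⁅ e ⁆ ∣                        ≡⟨ ∣A∪B∣ F ⁅ e ⁆ (λ x p q → e∉F F⊆ (subst (_∈ F) (∈⁅⁆ q) p)) ⟩
      ∣ F ∣ ℕ.+ ∣ ⁅ e ⁆ ∣                  ≡⟨ cong (∣ F ∣ ℕ.+_) (∣⁅x⁆∣≡1 e) ⟩
      ∣ F ∣ ℕ.+ 1                          ≡⟨ ℕ.+-comm ∣ F ∣ 1 ⟩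
      suc ∣ F ∣                            ≡⟨ cong (suc ∘ ∣_∣) split-F ⟨
      suc ∣ (F ∩ G₁) ∪ (F ∩ G₂) ∣
        ≡⟨ cong suc (∣A∪B∣ (F ∩ G₁) (F ∩ G₂) (λ x p q → disjoint x (p∩q⊆q F G₁ p) (p∩q⊆q F G₂ q))) ⟩
      suc (∣ F ∩ G₁ ∣ ℕ.+ ∣ F ∩ G₂ ∣)
        ≡⟨ cong suc (cong₂ ℕ._+_ (Rank.indep-rank Y₁.matroid indep-F₁) (Rank.indep-rank Y₂.matroid indep-F₂)) ⟨
      suc (Y₁.rank (F ∩ G₁) ℕ.+ Y₂.rank (F ∩ G₂)) ∎
      where open ≡-Reasoning

    -- `F` is independent and hence its own basis; contracting it shortens the two paths, neither of
    -- which is used up.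
    theta-/ : IsTheta (X.matroid / F) (G₁ ─ F) (G₂ ─ F) e
    theta-/ = record
      { ground≡ = ⊆-antisym
          (λ x∈ → let y , x∉ = ∈-─⁻ {S = X.ground} x∈ in
            ∪-elim (∪-elim (λ q → ∈-∪ˡ (∈-∪ˡ (∈-─⁺ q x∉))) (λ q → ∈-∪ˡ (∈-∪ʳ (∈-─⁺ q x∉)))) ∈-∪ʳ
              (subst (_ ∈_) ground≡ y))
          (∪-lub (∪-lub (λ x∈ → let y , x∉ = ∈-─⁻ {S = G₁} x∈ in ∈-─⁺ (G₁⊆ground y) x∉)
                        (λ x∈ → let y , x∉ = ∈-─⁻ {S = G₂} x∈ in ∈-─⁺ (G₂⊆ground y) x∉))
                 (⁅⁆⊆ (∈-─⁺ e∈ground (e∉F F⊆))))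
      ; indep⁺  = λ {I} I⊆ c₁ c₂ c₁₂ → Rank.indep/⁺ X.matroid basis I⊆
          (indep⁺ (∪-lub (λ p → p─q⊆p X.ground F (I⊆ p)) (F⊆X F⊆))
            (λ (p , q) → c₁ (⊆∪⇒─⊆ p , e∈I q)) (λ (p , q) → c₂ (⊆∪⇒─⊆ p , e∈I q))
            (λ (p , q) → c₁₂ (⊆∪⇒─⊆ p , ⊆∪⇒─⊆ q)))
      ; indep₁  = λ ind (p , q) → indep₁ (Rank.indep/⁻ X.matroid basis ind) (─⊆⇒⊆∪ p , ∈-∪ˡ q)
      ; indep₂  = λ ind (p , q) → indep₂ (Rank.indep/⁻ X.matroid basis ind) (─⊆⇒⊆∪ p , ∈-∪ˡ q)
      ; indep₁₂ = λ ind (p , q) → indep₁₂ (Rank.indep/⁻ X.matroid basis ind) (─⊆⇒⊆∪ p , ─⊆⇒⊆∪ q)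
      }
      where
      basis : X.IsBasisOf F F
      basis = record { indep = indep-F ; subset = λ p → p ; maximal = λ p _ → p }
      e∈I : e ∈ I ∪ F → e ∈ I
      e∈I = ∪-elim (λ q → q) (λ q → contradiction q (e∉F F⊆))

    pointed-/ : ∀ fix fixN fix₁ fix₂ → Theta (X.contract F fix) (N.contract F fixN)
                  (Y₁.contract (F ∩ G₁) fix₁) (Y₂.contract (F ∩ G₂) fix₂) (G₁ ─ F) (G₂ ─ F) e
    pointed-/ fix fixN fix₁ fix₂ = record
      { e∉₁      = λ p → e∉₁ (p─q⊆p G₁ F p)
      ; e∉₂      = λ p → e∉₂ (p─q⊆p G₂ F p)
      ; disjoint = λ x p q → disjoint x (p─q⊆p G₁ F p) (p─q⊆p G₂ F q)
      ; ne₁      = let x , x∈ , x∉ = ⊈⇒∃ G₁⊈ in x , ∈-─⁺ x∈ x∉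
      ; ne₂      = let x , x∈ , x∉ = ⊈⇒∃ G₂⊈ in x , ∈-─⁺ x∈ x∉
      ; theta    = theta-/
      ; cycle    = subst (IsCycle (N.matroid / F)) (─-distrib-∪ G₁ G₂ F) (cycle-/ cycle F⊆ (λ p → G₁⊈ (λ q → p (∈-∪ˡ q))))
      ; cycle₁   = subst (IsCycle (Y₁.matroid / (F ∩ G₁))) (─-∩ G₁ F) (cycle-/ cycle₁ (p∩q⊆q F G₁) ⊈₁)
      ; cycle₂   = subst (IsCycle (Y₂.matroid / (F ∩ G₂))) (─-∩ G₂ F) (cycle-/ cycle₂ (p∩q⊆q F G₂) ⊈₂)
      ; σ-e      = σ-e
      ; agree    = λ x∈ → agree (∪-mono (p─q⊆p G₁ F) (p─q⊆p G₂ F) x∈)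
      ; agree₁   = λ x∈ → agree₁ (p─q⊆p G₁ F x∈)
      ; agree₂   = λ x∈ → agree₂ (p─q⊆p G₂ F x∈)
      }

    basis-F∪e : X.IsBasisOf (F ∪ ⁅ e ⁆) (F ∪ ⁅ e ⁆)
    basis-F∪e = record { indep = indep-F∪e ; subset = λ p → p ; maximal = λ p _ → p }

    basis-F₁ : Y₁.IsBasisOf (F ∩ G₁) (F ∩ G₁)
    basis-F₁ = record { indep = indep-F₁ ; subset = λ p → p ; maximal = λ p _ → p }

    basis-F₂ : Y₂.IsBasisOf (F ∩ G₂) (F ∩ G₂)
    basis-F₂ = record { indep = indep-F₂ ; subset = λ p → p ; maximal = λ p _ → p }

    in-G₁ : x ∈ Y₁.ground ─ (F ∩ G₁) → x ∈ G₁ × x ∉ F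
    in-G₁ x∈ = let y , x∉ = ∈-─⁻ {S = Y₁.ground} x∈
                   y′ = subst (_ ∈_) C₁.ground≡ y in y′ , λ q → x∉ (x∈p∩q⁺ (q , y′))

    in-G₂ : x ∈ Y₂.ground ─ (F ∩ G₂) → x ∈ G₂ × x ∉ F
    in-G₂ x∈ = let y , x∉ = ∈-─⁻ {S = Y₂.ground} x∈
                   y′ = subst (_ ∈_) C₂.ground≡ y in y′ , λ q → x∉ (x∈p∩q⁺ (q , y′))

    out-G₁ : x ∈ G₁ → x ∉ F → x ∈ Y₁.ground ─ (F ∩ G₁)
    out-G₁ x∈ x∉ = ∈-─⁺ (subst (_ ∈_) (sym C₁.ground≡) x∈) (λ q → x∉ (p∩q⊆p F G₁ q))

    out-G₂ : x ∈ G₂ → x ∉ F → x ∈ Y₂.ground ─ (F ∩ G₂)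
    out-G₂ x∈ x∉ = ∈-─⁺ (subst (_ ∈_) (sym C₂.ground≡) x∈) (λ q → x∉ (p∩q⊆p F G₂ q))

    in-ground : x ∈ G₁ ∪ G₂ → x ∉ F → x ∈ X.ground ─ (F ∪ ⁅ e ⁆)
    in-ground x∈ x∉ = ∈-─⁺ (G⊆ground x∈) (∪-elim x∉ (λ q → e∉₁₂ (subst (_∈ G₁ ∪ G₂) (∈⁅⁆ q) x∈)))

    -- Contracting `e` identifies the common endpoints, so each remaining path closes to a cycle of
    -- its own. A set that contains both paths contains the first, so `c₁` settles the third circuit
    -- as well.
    sum-e : DirectSum (X.matroid / (F ∪ ⁅ e ⁆)) (Y₁.matroid / (F ∩ G₁)) (Y₂.matroid / (F ∩ G₂))
    sum-e = record
      { ground≡  = ⊆-antisym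
          (λ x∈ → let y , x∉ = ∈-─⁻ {S = X.ground} x∈ in
            ∪-elim (λ q → ∈-∪ˡ (out-G₁ q (λ r → x∉ (∈-∪ˡ r)))) (λ q → ∈-∪ʳ (out-G₂ q (λ r → x∉ (∈-∪ˡ r))))
              (ground-e y (λ q → x∉ (∈-∪ʳ q))))
          (∪-lub (λ x∈ → let y , x∉ = in-G₁ x∈ in in-ground (∈-∪ˡ y) x∉)
                 (λ x∈ → let y , x∉ = in-G₂ x∈ in in-ground (∈-∪ʳ y) x∉))
      ; disjoint = λ x p q → disjoint x (proj₁ (in-G₁ p)) (proj₁ (in-G₂ q))
      ; indep₁   = λ {I} ind → let R = Y₁.ground ─ (F ∩ G₁) in Rank.indep/⁺ Y₁.matroid basis-F₁ (p∩q⊆q I R)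
          (C₁.indep⁺ (∪-lub (λ p → proj₁ (in-G₁ (p∩q⊆q I R p))) (p∩q⊆q F G₁))
            (λ G₁⊆ → indep₁ (Rank.indep/⁻ X.matroid basis-F∪e ind)
              ((λ p → ∪-mono {A = I ∩ R} (p∩q⊆p I R) (λ q → ∈-∪ˡ (p∩q⊆p F G₁ q)) (G₁⊆ p)) , ∈-∪ʳ (∈-∪ʳ (x∈⁅x⁆ e)))))
      ; indep₂   = λ {I} ind → let R = Y₂.ground ─ (F ∩ G₂) in Rank.indep/⁺ Y₂.matroid basis-F₂ (p∩q⊆q I R)
          (C₂.indep⁺ (∪-lub (λ p → proj₁ (in-G₂ (p∩q⊆q I R p))) (p∩q⊆q F G₂))
            (λ G₂⊆ → indep₂ (Rank.indep/⁻ X.matroid basis-F∪e ind)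
              ((λ p → ∪-mono {A = I ∩ R} (p∩q⊆p I R) (λ q → ∈-∪ˡ (p∩q⊆p F G₂ q)) (G₂⊆ p)) , ∈-∪ʳ (∈-∪ʳ (x∈⁅x⁆ e)))))
      ; indep-∪  = λ {I₁} {I₂} ind₁ ind₂ →
          let I₁⊆ : ∀ {x} → x ∈ I₁ → x ∈ G₁ × x ∉ F
              I₁⊆ p = in-G₁ (Matroid.⊆ground (Y₁.matroid / (F ∩ G₁)) ind₁ p)
              I₂⊆ : ∀ {x} → x ∈ I₂ → x ∈ G₂ × x ∉ F
              I₂⊆ p = in-G₂ (Matroid.⊆ground (Y₂.matroid / (F ∩ G₂)) ind₂ p)
              c₁ : ¬ G₁ ⊆ (I₁ ∪ I₂) ∪ (F ∪ ⁅ e ⁆)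
              c₁ G₁⊆ = C₁.indep⁻ (Rank.indep/⁻ Y₁.matroid basis-F₁ ind₁) λ {x} x∈ → ∪-elim
                (∪-elim ∈-∪ˡ (λ q → contradiction (proj₁ (I₂⊆ q)) (disjoint x x∈)))
                (∪-elim (λ q → ∈-∪ʳ (x∈p∩q⁺ (q , x∈))) (λ q → contradiction (subst (_∈ G₁) (∈⁅⁆ q) x∈) e∉₁)) (G₁⊆ x∈)
              c₂ : ¬ G₂ ⊆ (I₁ ∪ I₂) ∪ (F ∪ ⁅ e ⁆)
              c₂ G₂⊆ = C₂.indep⁻ (Rank.indep/⁻ Y₂.matroid basis-F₂ ind₂) λ {x} x∈ → ∪-elim
                (∪-elim (λ q → contradiction x∈ (disjoint x (proj₁ (I₁⊆ q)))) ∈-∪ˡ)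
                (∪-elim (λ q → ∈-∪ʳ (x∈p∩q⁺ (q , x∈))) (λ q → contradiction (subst (_∈ G₂) (∈⁅⁆ q) x∈) e∉₂)) (G₂⊆ x∈) in
          Rank.indep/⁺ X.matroid basis-F∪e
            (∪-lub (λ p → in-ground (∈-∪ˡ (proj₁ (I₁⊆ p))) (proj₂ (I₁⊆ p)))
                   (λ p → in-ground (∈-∪ʳ (proj₁ (I₂⊆ p))) (proj₂ (I₂⊆ p))))
            (indep⁺ (∪-lub (∪-lub (λ p → G₁⊆ground (proj₁ (I₁⊆ p))) (λ p → G₂⊆ground (proj₁ (I₂⊆ p)))) (F∪e⊆ F⊆))
              (λ (p , _) → c₁ p) (λ (p , _) → c₂ p) (λ (p , _) → c₁ p))
      }

    pointed-sum-e : ∀ fix fix₁ fix₂ → PointedSum (X.contract (F ∪ ⁅ e ⁆) fix)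
                      (Y₁.contract (F ∩ G₁) fix₁) (Y₂.contract (F ∩ G₂) fix₂)
    pointed-sum-e fix fix₁ fix₂ = record
      { directSum = sum-e
      ; agree₁    = λ x∈ → agree₁ (proj₁ (in-G₁ x∈))
      ; agree₂    = λ x∈ → agree₂ (proj₁ (in-G₂ x∈))
      }

-- Comparison of the Z-polynomials of the glued cycles and the large cycle

-- Each pair is collected at its member without `e`, and the other member gets zero. The result is
-- still a function on all subsets and can be compared termwise with Z_N, whose terms also vanish at
-- sets containing `e`.
paired : Fin n → (Subset n → ℚ) → Subset n → ℚ
paired e t F with e ∈? F
... | yes _ = 0ℚ
... | no  _ = t F ℚ.+ t (F ∪ ⁅ e ⁆)

∑-paired : (e : Fin n) (t : Subset n → ℚ) → ∑.∑ (paired e t) ≡ ∑.∑ t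
∑-paired {n} e t = sym (begin
  ∑.∑ t                                         ≡⟨ ∑.∑-cong split ⟩
  ∑.∑ (λ F → without F ℚ.+ with-e F)            ≡⟨ ∑.∑-+ without with-e ⟩
  ∑.∑ without ℚ.+ ∑.∑ with-e                    ≡⟨ cong (∑.∑ without ℚ.+_) remove-e ⟩
  ∑.∑ without ℚ.+ ∑.∑ removed                   ≡⟨ ∑.∑-+ without removed ⟨
  ∑.∑ (λ F → without F ℚ.+ removed F)           ≡⟨ ∑.∑-cong join′ ⟩
  ∑.∑ (paired e t)                              ∎)
  where
  open ≡-Reasoning
  without with-e removed : Subset n → ℚ
  without F with e ∈? F
  ... | yes _ = 0ℚ
  ... | no  _ = t F
  with-e F with e ∈? F
  ... | yes _ = t F
  ... | no  _ = 0ℚ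
  removed F with e ∈? F
  ... | yes _ = 0ℚ
  ... | no  _ = t (F ∪ ⁅ e ⁆)
  split : ∀ F → t F ≡ without F ℚ.+ with-e F
  split F with e ∈? F
  ... | yes _ = sym (ℚR.+-identityˡ (t F))
  ... | no  _ = sym (ℚR.+-identityʳ (t F))
  join′ : ∀ F → without F ℚ.+ removed F ≡ paired e t F
  join′ F with e ∈? F
  ... | yes _ = refl
  ... | no  _ = refl
  e∉-e : ∀ F → e ∉ F - e
  e∉-e F p = x∈p─q⇒x∉q F ⁅ e ⁆ p (x∈⁅x⁆ e)
  add-remove : ∀ {F} → e ∈ F → (F - e) ∪ ⁅ e ⁆ ≡ F
  add-remove {F} e∈ = ⊆-antisym (∪-lub (p─q⊆p F ⁅ e ⁆) (⁅⁆⊆ e∈)) (─⊆⇒⊆∪ (λ p → p))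
  remove-add : ∀ {F} → e ∉ F → (F ∪ ⁅ e ⁆) - e ≡ F
  remove-add {F} e∉ = ⊆-antisym (⊆∪⇒─⊆ (λ p → p))
    (λ x∈ → ∈-─⁺ (∈-∪ˡ x∈) (λ q → e∉ (subst (_∈ F) (∈⁅⁆ q) x∈)))
  with-e-∈ : ∀ {F} → e ∈ F → with-e F ≡ t F
  with-e-∈ {F} e∈ with e ∈? F
  ... | yes _ = refl
  ... | no e∉ = contradiction e∈ e∉
  removed-∉ : ∀ {F} → e ∉ F → removed F ≡ t (F ∪ ⁅ e ⁆)
  removed-∉ {F} e∉ with e ∈? F
  ... | yes e∈ = contradiction e∈ e∉
  ... | no _   = refl
  with-e-support : ∀ F → with-e F ≢ 0ℚ → e ∈ F
  with-e-support F ≢0 with e ∈? F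
  ... | yes e∈ = e∈
  ... | no _   = contradiction refl ≢0
  removed-support : ∀ F → removed F ≢ 0ℚ → e ∉ F
  removed-support F ≢0 with e ∈? F
  ... | yes _ = contradiction refl ≢0
  ... | no e∉ = e∉
  remove-e : ∑.∑ with-e ≡ ∑.∑ removed
  remove-e = ∑-reindex (subsetEnumeration n) (subsetEnumeration n) with-e removed (_- e) (_∪ ⁅ e ⁆)
    (λ F ≢0 → let e∈ = with-e-support F ≢0 in
      trans (removed-∉ (e∉-e F)) (trans (cong t (add-remove e∈)) (sym (with-e-∈ e∈))) , add-remove e∈)
    (λ F ≢0 → let e∉ = removed-support F ≢0 in
      trans (with-e-∈ (∈-∪ʳ (x∈⁅x⁆ e))) (sym (removed-∉ e∉)) , remove-add e∉)

module ThetaFormula (KL : EquivariantKL) where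
  open Characters KL
  open DirectSums KL

  Formula : ℕ → Set₁
  Formula N = ∀ {n} {X N′ Y₁ Y₂ : Pointed n} {G₁ G₂ e} → Theta X N′ Y₁ Y₂ G₁ G₂ e → ∣ Pointed.ground X ∣ ≤ N →
              p X +ˢ shift 1 (p Y₁ *ˢ p Y₂) ≗ˢ p N′

  positive-rank : (Y : Pointed n) → Nonempty (Pointed.ground Y) → Pointed.Loopless Y → 0 < Pointed.rk Y
  positive-rank Y (x , x∈) ll = ℕ.≤-trans (ℕ.≤-reflexive (sym (∣⁅x⁆∣≡1 x)))
    (Rank.indep≤rank matroid (decidable-stable (indep? ⁅ x ⁆) (λ ¬ind → ll x (x∈ , ¬ind))) (⁅⁆⊆ x∈))
    where open Pointed Y

  module _ {X N Y₁ Y₂ : Pointed n} {G₁ G₂ e} (θ : Theta X N Y₁ Y₂ G₁ G₂ e) where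
    private
      module X  = Pointed X
      module N  = Pointed N
      module Y₁ = Pointed Y₁
      module Y₂ = Pointed Y₂
    open Theta θ
    open ≡-Reasoning
    open +-*-Solver

    spanning-term : (F⊆ : F ⊆ G₁ ∪ G₂) → X.Fixed F → G₁ ⊆ F ⊎ G₂ ⊆ F →
                    term X F +ˢ term X (F ∪ ⁅ e ⁆) ≗ˢ term N F
    spanning-term {F} F⊆ fix path k = begin
      term X F k ℚ.+ term X (F ∪ ⁅ e ⁆) k
        ≡⟨ cong₂ ℚ._+_
             (trans (term-≡ X (F⊆X F⊆) fix k) (shift-0 (X.rank F) (p-loop (X.contract F fix) loop-e) k))
             (term-≡ X (F∪e⊆ F⊆) (fixed-e F⊆ fix) k) ⟩
      0ℚ ℚ.+ shift (X.rank (F ∪ ⁅ e ⁆)) (p (X.contract (F ∪ ⁅ e ⁆) (fixed-e F⊆ fix))) k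
        ≡⟨ ℚR.+-identityˡ _ ⟩
      shift (X.rank (F ∪ ⁅ e ⁆)) (p (X.contract (F ∪ ⁅ e ⁆) (fixed-e F⊆ fix))) k
        ≡⟨ shift-cong (X.rank (F ∪ ⁅ e ⁆)) (p-invariant (contract-e-iso (fixed-e F⊆ fix) (fixed-N F⊆ fix))) k ⟩
      shift (X.rank (F ∪ ⁅ e ⁆)) (p (N.contract F (fixed-N F⊆ fix))) k
        ≡⟨ cong (λ r → shift r (p (N.contract F (fixed-N F⊆ fix))) k) rank-e ⟩
      shift (N.rank F) (p (N.contract F (fixed-N F⊆ fix))) k
        ≡⟨ term-≡ N (F⊆N F⊆) (fixed-N F⊆ fix) k ⟨
      term N F k ∎
      where open Spanning F⊆ path

    module _ (F⊆ : F ⊆ G₁ ∪ G₂) (fix : X.Fixed F) (G₁⊈ : ¬ G₁ ⊆ F) (G₂⊈ : ¬ G₂ ⊆ F) where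
      open Proper F⊆ G₁⊈ G₂⊈
      private
        q : Series
        q = p (Y₁.contract (F ∩ G₁) (fixed-Y₁ F⊆ fix)) *ˢ p (Y₂.contract (F ∩ G₂) (fixed-Y₂ F⊆ fix))
        r₁ = Y₁.rank (F ∩ G₁)
        r₂ = Y₂.rank (F ∩ G₂)

      e-term : term X (F ∪ ⁅ e ⁆) ≗ˢ shift (suc (r₁ ℕ.+ r₂)) q
      e-term k = trans (term-≡ X (F∪e⊆ F⊆) (fixed-e F⊆ fix) k)
        (trans (shift-cong (X.rank (F ∪ ⁅ e ⁆)) (p-product (pointed-sum-e _ (fixed-Y₁ F⊆ fix) (fixed-Y₂ F⊆ fix))) k)
          (cong (λ r → shift r q k) rank-e))

      e-term-product : term X (F ∪ ⁅ e ⁆) ≗ˢ shift 1 (term Y₁ (F ∩ G₁) *ˢ term Y₂ (F ∩ G₂))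
      e-term-product k = trans (e-term k) (trans (shift-suc (r₁ ℕ.+ r₂) q k)
        (shift-cong 1 (λ i → sym (trans
          (*ˢ-cong (term-≡ Y₁ (λ x∈ → subst (_ ∈_) (sym C₁.ground≡) (p∩q⊆q F G₁ x∈)) (fixed-Y₁ F⊆ fix))
                   (term-≡ Y₂ (λ x∈ → subst (_ ∈_) (sym C₂.ground≡) (p∩q⊆q F G₂ x∈)) (fixed-Y₂ F⊆ fix)) i)
          (shift-*ˢ r₁ r₂ _ _ i))) k))

      proper-term : p (X.contract F fix) +ˢ shift 1 q ≗ˢ p (N.contract F (fixed-N F⊆ fix)) →
                    term X F +ˢ term X (F ∪ ⁅ e ⁆) ≗ˢ term N F
      proper-term formula k = begin
        term X F k ℚ.+ term X (F ∪ ⁅ e ⁆) k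
          ≡⟨ cong₂ ℚ._+_ (term-≡ X (F⊆X F⊆) fix k)
               (trans (e-term k) (trans (cong (λ r → shift r q k) (trans (ℕ.+-comm 1 _) (cong (ℕ._+ 1) (sym rank-F))))
                 (sym (shift-shift (X.rank F) 1 q k)))) ⟩
        shift (X.rank F) (p (X.contract F fix)) k ℚ.+ shift (X.rank F) (shift 1 q) k
          ≡⟨ shift-+ˢ (X.rank F) (p (X.contract F fix)) (shift 1 q) k ⟨
        shift (X.rank F) (p (X.contract F fix) +ˢ shift 1 q) k
          ≡⟨ shift-cong (X.rank F) formula k ⟩
        shift (X.rank F) (p (N.contract F (fixed-N F⊆ fix))) k
          ≡⟨ cong (λ r → shift r (p (N.contract F (fixed-N F⊆ fix))) k) rank-X≡N ⟩
        shift (N.rank F) (p (N.contract F (fixed-N F⊆ fix))) k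
          ≡⟨ term-≡ N (F⊆N F⊆) (fixed-N F⊆ fix) k ⟨
        term N F k ∎
        where
        shift-+ˢ : ∀ a f h → shift a (f +ˢ h) ≗ˢ shift a f +ˢ shift a h
        shift-+ˢ zero    f h i       = refl
        shift-+ˢ (suc a) f h zero    = refl
        shift-+ˢ (suc a) f h (suc i) = shift-+ˢ a f h i
        rank-F : X.rank F ≡ r₁ ℕ.+ r₂
        rank-F = begin
          X.rank F                            ≡⟨ Rank.indep-rank X.matroid indep-F ⟩
          ∣ F ∣                               ≡⟨ cong ∣_∣ split-F ⟨
          ∣ (F ∩ G₁) ∪ (F ∩ G₂) ∣
            ≡⟨ ∣A∪B∣ (F ∩ G₁) (F ∩ G₂) (λ x p q → disjoint x (p∩q⊆q F G₁ p) (p∩q⊆q F G₂ q)) ⟩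
          ∣ F ∩ G₁ ∣ ℕ.+ ∣ F ∩ G₂ ∣
            ≡⟨ cong₂ ℕ._+_ (Rank.indep-rank Y₁.matroid indep-F₁) (Rank.indep-rank Y₂.matroid indep-F₂) ⟨
          r₁ ℕ.+ r₂                           ∎

    -- The origin of the correction term: contracting `e` alone leaves the direct sum of the cycles
    -- on `G₁` and `G₂`, with the factor x from the rank of `⁅ e ⁆`.
    ⊥-term : term X ⊥ +ˢ term X (⊥ ∪ ⁅ e ⁆) ≗ˢ p X +ˢ shift 1 (p Y₁ *ˢ p Y₂)
    ⊥-term k = cong₂ ℚ._+_ (term-⊥ X k) (trans
      (e-term-product ⊥⊆ (X.fixed (λ x∈ → contradiction x∈ ∉⊥)) (λ p → ∉⊥ (p (proj₂ ne₁))) (λ p → ∉⊥ (p (proj₂ ne₂))) k)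
      (shift-cong 1 (*ˢ-cong (λ i → trans (cong (λ S → term Y₁ S i) (⊥∩ G₁)) (term-⊥ Y₁ i))
                             (λ i → trans (cong (λ S → term Y₂ S i) (⊥∩ G₂)) (term-⊥ Y₂ i))) k))
      where
      ⊥∩ : ∀ (G : Subset n) → ⊥ ∩ G ≡ ⊥
      ⊥∩ G = ⊆-antisym (p∩q⊆p ⊥ G) ⊥⊆

    -- If `F ∪ ⁅ e ⁆` is fixed then so is `F`: the permutation fixes `e` and is injective, so it
    -- cannot move a point of `F` to `e`.
    term-zero : ¬ (F ⊆ G₁ ∪ G₂ × X.Fixed F) → e ∉ F → ∀ k → term X F k ℚ.+ term X (F ∪ ⁅ e ⁆) k ≡ 0ℚ
    term-zero {F} ¬s e∉ k = cong₂ ℚ._+_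
      (term-0 X (λ (F⊆ , fix) → ¬s ((λ x∈ → drop-e (F⊆ x∈) (x≢e x∈)) , fix)) k)
      (term-0 X (λ (F⊆ , fix) → ¬s ((λ x∈ → drop-e (F⊆ (∈-∪ˡ x∈)) (x≢e x∈)) , X.fixed λ {x} x∈ →
        ∪-elim (λ q → q) (λ q → contradiction (moved x (∈⁅⁆ q)) (λ x≡e → e∉ (subst (_∈ F) x≡e x∈)))
          (X.σ-fixed⁺ fix (∈-∪ˡ x∈)))) k)
      where
      x≢e : ∀ {x} → x ∈ F → x ∉ ⁅ e ⁆
      x≢e x∈ q = e∉ (subst (_∈ F) (∈⁅⁆ q) x∈)
      drop-e : ∀ {x} → x ∈ X.ground → x ∉ ⁅ e ⁆ → x ∈ G₁ ∪ G₂
      drop-e = ground-e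
      moved : ∀ x → X.σ x ≡ e → x ≡ e
      moved x p = trans (sym (X.act-invˡ X.element x))
        (trans (cong (X.act (FiniteGroup._⁻¹ X.group X.element)) (trans p (sym σ-e))) (X.act-invˡ X.element e))

    rk-N : N.rk ≡ suc (Y₁.rk ℕ.+ Y₂.rk)
    rk-N = ℕ.suc-injective (begin
      suc N.rk                      ≡⟨ C.suc-rk (proj₁ ne₁ , ∈-∪ˡ (proj₂ ne₁)) ⟩
      ∣ G₁ ∪ G₂ ∣                   ≡⟨ ∣A∪B∣ G₁ G₂ disjoint ⟩
      ∣ G₁ ∣ ℕ.+ ∣ G₂ ∣             ≡⟨ cong₂ ℕ._+_ (C₁.suc-rk ne₁) (C₂.suc-rk ne₂) ⟨
      suc Y₁.rk ℕ.+ suc Y₂.rk       ≡⟨ cong suc (ℕ.+-suc Y₁.rk Y₂.rk) ⟩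
      suc (suc (Y₁.rk ℕ.+ Y₂.rk))   ∎)

    -- `Spanning` applied to all of `G₁ ∪ G₂`: adding `e` to it does not raise the rank.
    rk-X : X.rk ≡ N.rk
    rk-X = trans (cong X.rank ground≡) (trans (Spanning.rank-e (λ p → p) (inj₁ ∈-∪ˡ)) (cong N.rank (sym C.ground≡)))

    0<rk-X : 0 < X.rk
    0<rk-X = subst (0 <_) (sym (trans rk-X rk-N)) (s≤s z≤n)

    -- As rk X = r₁ + r₂ + 1, the coefficient of x^(k+1) has to vanish once r₁ + r₂ is at most 2k +
    -- 1, which is the strengthened bound of `*ˢ-lowDegree`. A path with a single edge makes the
    -- corresponding cycle a loop, and then its P is zero.
    lowDegree : LowDegree X.rk (shift 1 (p Y₁ *ˢ p Y₂))
    lowDegree zero    _  = refl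
    lowDegree (suc k) le with Rank.loop? Y₁.matroid | Rank.loop? Y₂.matroid
    ... | yes l₁ | _      = *ˢ-0ˡ (p Y₂) (p-loop Y₁ l₁) k
    ... | no _   | yes l₂ = *ˢ-0ʳ (p Y₁) (p-loop Y₂ l₂) k
    ... | no ¬l₁ | no ¬l₂ = *ˢ-lowDegree
      (p-lowDegree Y₁ (loopless Y₁ ¬l₁) (positive-rank Y₁ (subst Nonempty (sym C₁.ground≡) ne₁) (loopless Y₁ ¬l₁)))
      (p-lowDegree Y₂ (loopless Y₂ ¬l₂) (positive-rank Y₂ (subst Nonempty (sym C₂.ground≡) ne₂) (loopless Y₂ ¬l₂)))
      k (ℕ.≤-pred (ℕ.≤-trans (ℕ.≤-reflexive (sym (trans rk-X rk-N))) (ℕ.≤-trans le (ℕ.≤-reflexive (ℕ.*-suc 2 k)))))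

  formula : ∀ N → Formula N
  formula-pred : ∀ {N N′} → N ≡ suc N′ → Formula N′
  formula-pred {suc N} refl = formula N
  formula N₀ {n} {X} {N} {Y₁} {Y₂} {G₁} {G₂} {e} θ size≤ k = begin
    c k                        ≡⟨ solve 2 (λ a b → a := (a :- b) :+ b) refl (c k) (p N k) ⟩
    (c -ˢ p N) k ℚ.+ p N k     ≡⟨ cong (ℚ._+ p N k) (palindromic-lowDegree pal low k) ⟩
    0ℚ ℚ.+ p N k               ≡⟨ ℚR.+-identityˡ (p N k) ⟩
    p N k                      ∎
    where
    module X  = Pointed X
    module N  = Pointed N
    module Y₁ = Pointed Y₁
    module Y₂ = Pointed Y₂
    open Theta θ
    open ≡-Reasoning
    open +-*-Solver
    c : Series
    c = p X +ˢ shift 1 (p Y₁ *ˢ p Y₂)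

    recurse : ∀ {F} → (F⊆ : F ⊆ G₁ ∪ G₂) (fix : X.Fixed F) → Nonempty F → (G₁⊈ : ¬ G₁ ⊆ F) (G₂⊈ : ¬ G₂ ⊆ F) →
              term X F +ˢ term X (F ∪ ⁅ e ⁆) ≗ˢ term N F
    recurse {F} F⊆ fix ne G₁⊈ G₂⊈ = by-size N₀ (formula-pred {N₀}) size≤
      where
      by-size : ∀ N′ → (∀ {N″} → N′ ≡ suc N″ → Formula N″) → ∣ X.ground ∣ ≤ N′ →
                term X F +ˢ term X (F ∪ ⁅ e ⁆) ≗ˢ term N F
      by-size zero     _    size≤ = contradiction (ℕ.≤-trans (∣─∣< (F⊆X F⊆) ne) size≤) (λ ())
      by-size (suc N′) form size≤ = proper-term θ F⊆ fix G₁⊈ G₂⊈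
        (form refl (Proper.pointed-/ F⊆ G₁⊈ G₂⊈ fix (fixed-N F⊆ fix) (fixed-Y₁ F⊆ fix) (fixed-Y₂ F⊆ fix))
          (ℕ.≤-pred (ℕ.≤-trans (∣─∣< (F⊆X F⊆) ne) size≤)))

    nonempty-term : ∀ {F} → Nonempty F → F ⊆ G₁ ∪ G₂ → X.Fixed F → Dec (G₁ ⊆ F) → Dec (G₂ ⊆ F) →
                    term X F +ˢ term X (F ∪ ⁅ e ⁆) ≗ˢ term N F
    nonempty-term ne F⊆ fix (yes G₁⊆) _          = spanning-term θ F⊆ fix (inj₁ G₁⊆)
    nonempty-term ne F⊆ fix (no _)    (yes G₂⊆)  = spanning-term θ F⊆ fix (inj₂ G₂⊆)
    nonempty-term ne F⊆ fix (no G₁⊈)  (no G₂⊈)   = recurse F⊆ fix ne G₁⊈ G₂⊈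

    N-zero : ∀ {F} → ¬ (F ⊆ G₁ ∪ G₂ × X.Fixed F) → ∀ k → term N F k ≡ 0ℚ
    N-zero ¬s = term-0 N (λ (F⊆ , fix) →
      let F⊆G = λ {x} x∈ → subst (x ∈_) C.ground≡ (F⊆ x∈) in ¬s (F⊆G , fixed-X F⊆G fix))

    -- The paired terms of X agree with the terms of N except at the empty set, where the pair gives
    -- `c` in place of P_N; `patch` records this one difference.
    pointwise : ∀ k F → paired e (λ F → term X F k) F ≡ patch (λ F → term N F k) (c k) F
    pointwise k F with nonempty? F | e ∈? F
    ... | yes ne | yes e∈ = sym (N-zero (λ (F⊆ , _) → e∉F F⊆ e∈) k)
    ... | no ¬ne | yes e∈ = contradiction (e , e∈) ¬ne
    ... | no ¬ne | no _   with refl ← Empty-unique ¬ne = ⊥-term θ k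
    pointwise k F | yes ne | no e∉ with (F ⊆? G₁ ∪ G₂) ×-dec X.fixed? F
    ... | yes (F⊆ , fix) = nonempty-term ne F⊆ fix (G₁ ⊆? F) (G₂ ⊆? F) k
    ... | no ¬s          = trans (term-zero θ ¬s e∉ k) (sym (N-zero ¬s k))

    z-X : ∀ k → z X k ≡ (c k ℚ.- p N k) ℚ.+ z N k
    z-X k = begin
      z X k
        ≡⟨ z-sum X X-loopless k ⟩
      ∑ˢ (term X) k
        ≡⟨ ∑-paired e (λ F → term X F k) ⟨
      ∑.∑ (paired e (λ F → term X F k))
        ≡⟨ ∑.∑-cong {n} (pointwise k) ⟩
      ∑.∑ (patch (λ F → term N F k) (c k))
        ≡⟨ ∑-patch (λ F → term N F k) (c k) ⟩
      (c k ℚ.- term N ⊥ k) ℚ.+ ∑ˢ (term N) k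
        ≡⟨ cong₂ (λ u v → (c k ℚ.- u) ℚ.+ v) (term-⊥ N k) (sym (z-sum N N-loopless k)) ⟩
      (c k ℚ.- p N k) ℚ.+ z N k ∎

    pal : Palindromic X.rk (c -ˢ p N)
    pal = palindromic-cong
      (λ j → trans (cong (ℚ._- z N j) (z-X j)) (solve 2 (λ d z → (d :+ z) :- z := d) refl (c j ℚ.- p N j) (z N j)))
      (palindromic-- (z-palindromic X X-loopless)
        (subst (λ r → Palindromic r (z N)) (sym (rk-X θ)) (z-palindromic N N-loopless)))

    low : LowDegree X.rk (c -ˢ p N)
    low j le = cong₂ ℚ._-_
      (cong₂ ℚ._+_ (p-lowDegree X X-loopless (0<rk-X θ) j le) (lowDegree θ j le))
      (p-lowDegree N N-loopless (subst (0 <_) (rk-X θ) (0<rk-X θ)) j (subst (_≤ 2 ℕ.* j) (rk-X θ) le))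

  p-theta : ∀ {X N Y₁ Y₂ : Pointed n} {G₁ G₂ e} → Theta X N Y₁ Y₂ G₁ G₂ e → p X +ˢ shift 1 (p Y₁ *ˢ p Y₂) ≗ˢ p N
  p-theta θ = formula _ θ ℕ.≤-refl

-- The theorem for the given matroids and groups

uniform-cycle : (S : Subset n) → Nonempty S → IsCycle C[ S ] S
uniform-cycle S (x , x∈) = record
  { ground≡ = refl
  ; indep⁺  = λ {I} I⊆ S⊈ → (λ {y} → I⊆ {y}) , ℕ.≤-pred (ℕ.≤-trans
      (p⊂q⇒∣p∣<∣q∣ ((λ {y} → I⊆ {y}) , ⊈⇒∃ S⊈)) (ℕ.≤-reflexive (sym suc-pred)))
  ; indep⁻  = λ (_ , ∣I∣≤) S⊆ → ℕ.<⇒≱ (ℕ.≤-reflexive suc-pred) (ℕ.≤-trans (p⊆q⇒∣p∣≤∣q∣ S⊆) ∣I∣≤)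
  }
  where
  suc-pred : suc (∣ S ∣ ℕ.∸ 1) ≡ ∣ S ∣
  suc-pred = ℕ.m+[n∸m]≡n (ℕ.≤-trans (s≤s z≤n) (x∈p⇒∣p-x∣<∣p∣ x∈))

module _ (A B : Subset n) (e : Fin n) (2≤∣A∣ : 2 ≤ ∣ A ∣) (2≤∣B∣ : 2 ≤ ∣ B ∣) (A∩B≡e : A ∩ B ≡ ⁅ e ⁆) where
  open Gluing A B e 2≤∣A∣ 2≤∣B∣ A∩B≡e

  E-e≡ : E - e ≡ (A - e) ∪ (B - e)
  E-e≡ = ─-distrib-∪ A B ⁅ e ⁆

  ⊆-insert : ∀ {S I : Subset n} → S - e ⊆ I → e ∈ I → S ⊆ I
  ⊆-insert {S} {I} S-e⊆ e∈ x∈ = ∪-elim {S = I} {⁅ e ⁆} (λ p → p) (λ p → subst (_∈ I) (sym (∈⁅⁆ p)) e∈) (─⊆⇒⊆∪ S-e⊆ x∈)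

  remove-nonempty : ∀ {S : Subset n} → 2 ≤ ∣ S ∣ → Nonempty (S - e)
  remove-nonempty {S} 2≤ with x , x∈S , x∉e ← ∃-∈-∉ ⁅ e ⁆ S (ℕ.≤-trans (s≤s (ℕ.≤-reflexive (∣⁅x⁆∣≡1 e))) 2≤) =
    x , ∈-─⁺ x∈S x∉e

  glued-theta : IsTheta C⟨A,B⟩ (A - e) (B - e) e
  glued-theta = record
    { ground≡  = ⊆-antisym
        (λ x∈ → subst (λ S → _ ∈ S ∪ ⁅ e ⁆) E-e≡ (─⊆⇒⊆∪ (λ p → p) x∈))
        (∪-lub (λ x∈ → p─q⊆p E ⁅ e ⁆ (subst (_ ∈_) (sym E-e≡) x∈)) (⁅⁆⊆ (∈-∪ˡ e∈A)))
    ; indep⁺   = λ {I} I⊆ c₁ c₂ c₁₂ → (λ {y} → I⊆ {y}) ,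
        (λ A⊆ → c₁ ((λ x∈ → A⊆ (p─q⊆p A ⁅ e ⁆ x∈)) , A⊆ e∈A)) ∷
        (λ B⊆ → c₂ ((λ x∈ → B⊆ (p─q⊆p B ⁅ e ⁆ x∈)) , B⊆ e∈B)) ∷
        (λ E⊆ → c₁₂ ((λ x∈ → E⊆ (subst (_ ∈_) (sym E-e≡) (∈-∪ˡ x∈))) ,
                     (λ x∈ → E⊆ (subst (_ ∈_) (sym E-e≡) (∈-∪ʳ x∈))))) ∷ []
    ; indep₁   = λ { (_ , A⊈ ∷ _) (p , e∈) → A⊈ (⊆-insert p e∈) }
    ; indep₂   = λ { (_ , _ ∷ B⊈ ∷ _) (p , e∈) → B⊈ (⊆-insert p e∈) }
    ; indep₁₂  = λ { (_ , _ ∷ _ ∷ E⊈ ∷ []) (p , q) → E⊈ (λ x∈ → ∪-lub p q (subst (_ ∈_) E-e≡ x∈)) }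
    }

  module _ (σ : SymElement (A - e)) (τ : SymElement (B - e)) where
    open SymElement

    e∉-e : ∀ {S : Subset n} → e ∉ S - e
    e∉-e {S} p = x∈p─q⇒x∉q S ⁅ e ⁆ p (x∈⁅x⁆ e)

    disjoint-e : ∀ x → x ∈ A - e → x ∉ B - e
    disjoint-e x x∈A x∈B = ∈-e⁻ {A} x∈A (A∩B⇒e (p─q⊆p A ⁅ e ⁆ x∈A) (p─q⊆p B ⁅ e ⁆ x∈B))

    -- On `A - e` the pair (σ , τ) acts as `σ` alone, and on `B - e` as `τ` alone. This is how the
    -- product group is matched with the separate actions of its two factors on the small cycles.
    pointed-theta : Theta
      (record { matroidAction = W-on-C⟨A,B⟩ ; element = σ , τ })
      (record { matroidAction = W-on-C[E-e] ; element = σ , τ })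
      (record { matroidAction = symOnCycle (A - e) ; element = σ })
      (record { matroidAction = symOnCycle (B - e) ; element = τ })
      (A - e) (B - e) e
    pointed-theta = record
      { e∉₁      = e∉-e {A}
      ; e∉₂      = e∉-e {B}
      ; disjoint = disjoint-e
      ; ne₁      = ne₁
      ; ne₂      = ne₂
      ; theta    = glued-theta
      ; cycle    = subst (IsCycle C[ E - e ]) E-e≡
          (uniform-cycle (E - e) (proj₁ ne₁ , subst (_ ∈_) (sym E-e≡) (∈-∪ˡ (proj₂ ne₁))))
      ; cycle₁   = uniform-cycle (A - e) ne₁
      ; cycle₂   = uniform-cycle (B - e) ne₂
      ; σ-e      = trans (cong (perm σ ⟨$⟩ʳ_) (fixes τ e (e∉-e {B}))) (fixes σ e (e∉-e {A}))
      ; agree    = λ _ → refl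
      ; agree₁   = λ {x} x∈ → cong (perm σ ⟨$⟩ʳ_) (fixes τ x (disjoint-e x x∈))
      ; agree₂   = λ {x} x∈ → fixes σ _ (λ p → disjoint-e _ p (preserves τ x∈))
      }
      where
      ne₁ = remove-nonempty {A} 2≤∣A∣
      ne₂ = remove-nonempty {B} 2≤∣B∣

mainTheorem2 : (KL : EquivariantKL) →
    ∀ {n} (A B : Subset n) (e : Fin n)
    (2≤∣A∣ : 2 ≤ ∣ A ∣) (2≤∣B∣ : 2 ≤ ∣ B ∣) (A∩B≡e : A ∩ B ≡ ⁅ e ⁆) →
    let open EquivariantKL KL
        open Gluing A B e 2≤∣A∣ 2≤∣B∣ A∩B≡e
    in
    P C⟨A,B⟩ W W-on-C⟨A,B⟩
      ≈ᵍ P C[ E - e ] W W-on-C[E-e]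
         -ᵍ x^ 1 · (P C[ A - e ] (Sym (A - e)) (symOnCycle (A - e))
                    ⊗ᵍ P C[ B - e ] (Sym (B - e)) (symOnCycle (B - e)))
mainTheorem2 KL A B e 2≤∣A∣ 2≤∣B∣ A∩B≡e i = charᵛ⇒≈ᵛ {W} λ { (σ , τ) → begin
  charᵛ (coeff PX i) (σ , τ)
    ≡⟨ charᵍ-coeff {W} (σ , τ) PX i ⟨
  charᵍ {W} (σ , τ) PX i
    ≡⟨ solve 2 (λ a b → a := (a :+ b) :- b) refl (charᵍ {W} (σ , τ) PX i) (tail σ τ i) ⟩
  (charᵍ {W} (σ , τ) PX i ℚ.+ tail σ τ i) ℚ.- tail σ τ i
    ≡⟨ cong (ℚ._- tail σ τ i) (ThetaFormula.p-theta KL (pointed-theta A B e 2≤∣A∣ 2≤∣B∣ A∩B≡e σ τ) i) ⟩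
  charᵍ {W} (σ , τ) PN i ℚ.- tail σ τ i
    -- The character of an external tensor product is the product of the characters, so `tail` is
    -- the value of the correction term at (σ , τ).
    ≡⟨ cong (λ t → charᵍ {W} (σ , τ) PN i ℚ.- t) (trans (charᵍ-shift {W} (σ , τ) 1 (P₁ ⊗ᵍ P₂) i)
         (shift-cong 1 (charᵍ-⊗ {Sym (A - e)} {Sym (B - e)} P₁ P₂ σ τ) i)) ⟨
  charᵍ {W} (σ , τ) PN i ℚ.- charᵍ {W} (σ , τ) (x^ 1 · (P₁ ⊗ᵍ P₂)) i
    ≡⟨ charᵍ-- {W} (σ , τ) PN (x^ 1 · (P₁ ⊗ᵍ P₂)) i ⟨
  charᵍ {W} (σ , τ) (PN -ᵍ x^ 1 · (P₁ ⊗ᵍ P₂)) i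
    ≡⟨ charᵍ-coeff {W} (σ , τ) (PN -ᵍ x^ 1 · (P₁ ⊗ᵍ P₂)) i ⟩
  charᵛ (coeff (PN -ᵍ x^ 1 · (P₁ ⊗ᵍ P₂)) i) (σ , τ) ∎ }
  where
  open EquivariantKL KL
  open Gluing A B e 2≤∣A∣ 2≤∣B∣ A∩B≡e
  open ≡-Reasoning
  open +-*-Solver
  PX PN : grVRep W
  PX = P C⟨A,B⟩ W W-on-C⟨A,B⟩
  PN = P C[ E - e ] W W-on-C[E-e]
  P₁ : grVRep (Sym (A - e))
  P₁ = P C[ A - e ] (Sym (A - e)) (symOnCycle (A - e))
  P₂ : grVRep (Sym (B - e))
  P₂ = P C[ B - e ] (Sym (B - e)) (symOnCycle (B - e))
  tail : SymElement (A - e) → SymElement (B - e) → Series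
  tail σ τ = shift 1 (charᵍ {Sym (A - e)} σ P₁ *ˢ charᵍ {Sym (B - e)} τ P₂)
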